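{- Let $F=aX^3+bX^2Y+cXY^2+dY^3$ be a binary cubic form with rational coefficients and nonzero (positive or negative) discriminant, and let $\alpha,\beta,\gamma\in\mathbb{P}^1(\mathbb{C})$ be its roots. Embed the upper half plane $\mathbb{H}$ into hyperbolic upper half space $\mathbb{H}_3$ in the natural way, so that $\mathbb{P}^1(\mathbb{R})=\partial\mathbb{H}\subset\partial\mathbb{H}_3=\mathbb{P}^1(\mathbb{C})$. Then the attractor point in $\mathbb{H}$ associated to $F$ is the center of mass of $\alpha,\beta,\gamma$ inside $\mathbb{H}_3$.
   Context: **The model ($t^3$-model).** The moduli space is the upper half plane $\mathbb{H}$ with coordinate $\tau=x+iy$, carrying the variation of Hodge structure $\mathrm{Sym}^3$ of the weight one Hodge structure of the universal elliptic curve; a fibre is identified with the space of binary cubic forms. For a form $F$, put $Z(\tau)=F(\tau,1)=a\tau^3+b\tau^2+c\tau+d$ (the pairing of the charge with the holomorphic section $\Omega$ of $H^{3,0}$). With $e^{ -K}=\tfrac43(\operatorname{Im}\tau)^3$ (so $K=-3\log\operatorname{Im}\tau+\mathrm{const}$), $DZ=\partial_\tau Z+(\partial_\tau K)Z$ and $g_{\tau\bar\tau}=\partial_\tau\partial_{\bar\tau}K=\frac{3}{4y^2}$, define $$V_{\mathrm{eff}}(\tau)=e^{K}\left[g^{\tau\bar\tau}|DZ|^2+|Z|^2\right].$$ The attractor points associated to $F$ are the critical points of $V_{\mathrm{eff}}$ on $\mathbb{H}$. They are called BPS if $F$ has positive discriminant (three real roots) and non-BPS if $F$ has negative discriminant (one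 real root and a pair of complex conjugate roots). In the BPS case the attractor point is equivalently the minimum of $|Z|^2/(\operatorname{Im}\tau)^3$. **Center of mass (Julia's covariant).** $\mathbb{H}_3=\{(t,u):t\in\mathbb{C},u>0\}$ and $\mathbb{H}\hookrightarrow\mathbb{H}_3$ is $x+iy\mapsto(x,y)$. The center of mass of three distinct points $\alpha,\beta,\gamma\in\mathbb{C}$ is the unique point $(t,u)\in\mathbb{H}_3$ minimizing $$\log\frac{|t-\alpha|^2+u^2}{u}+\log\frac{|t-\beta|^2+u^2}{u}+\log\frac{|t-\gamma|^2+u^2}{u}$$ (if a root is $\infty$, the corresponding term is replaced by $\log\frac1u$). It is equivariant under $SL_2(\mathbb{C})$, and lies in $\mathbb{H}$ when the set of roots is stable under complex conjugation. -}

module Defs where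

open import Level using (0ℓ)
open import Algebra.Bundles using (CommutativeRing)
import Algebra.Definitions.RawMonoid as RawMonoidDefinitions
open import Data.Empty using (⊥)
open import Data.Integer.Base as Int using (ℤ)
open import Data.Nat.Base as Nat using ()
open import Data.Product.Base using (Σ-syntax; ∃-syntax; _×_; _,_)
open import Data.Rational.Base as Rat using (ℚ; mkℚ)
open import Data.Unit.Base using (⊤)
open import Relation.Binary.Core using (Rel)
open import Relation.Binary.Definitions using (tri<; tri≈; tri>)
open import Relation.Binary.Structures using (IsStrictTotalOrder)
import Relation.Binary.Construct.StrictToNonStrict as StrictToNonStrict
open import Relation.Nullary.Negation.Core using (¬_)

-- The classical real numbers, given by the axioms that determine them up to
-- unique isomorphism: a totally ordered field in which every inhabited
-- subset that is bounded above has a least upper bound.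
-- As usual for a total inverse, the value of 0# ⁻¹ is unspecified.
record CompleteOrderedField : Set₁ where
  field
    commutativeRing : CommutativeRing 0ℓ 0ℓ

  open CommutativeRing commutativeRing public

  infix 4 _<_
  infix 9 _⁻¹

  field
    _<_                : Rel Carrier 0ℓ
    isStrictTotalOrder : IsStrictTotalOrder _≈_ _<_
    0<1                : 0# < 1#
    +-monoʳ-<          : ∀ x {y z} → y < z → x + y < x + z
    *-pos              : ∀ {x y} → 0# < x → 0# < y → 0# < x * y
    _⁻¹                : Carrier → Carrier
    ⁻¹-cong            : ∀ {x y} → x ≈ y → x ⁻¹ ≈ y ⁻¹
    ⁻¹-inverseʳ        : ∀ x → ¬ (x ≈ 0#) → x * x ⁻¹ ≈ 1#

  open StrictToNonStrict _≈_ _<_ public using (_≤_)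

  IsUpperBound : (Carrier → Set) → Carrier → Set
  IsUpperBound P b = ∀ x → P x → x ≤ b

  IsSupremum : (Carrier → Set) → Carrier → Set
  IsSupremum P s = IsUpperBound P s × (∀ b → IsUpperBound P b → s ≤ b)

  field
    complete : ∀ (P : Carrier → Set) →
               ∃[ x ] P x → ∃[ b ] IsUpperBound P b → ∃[ s ] IsSupremum P s

-- The natural logarithm is the only function on the positive reals with
-- log (x y) = log x + log y and log x ≤ x - 1: together these give
-- 1 - 1/x ≤ log x ≤ x - 1, hence log′ x = 1/x and log 1 = 0.
-- Values at nonpositive arguments are unspecified.
record NaturalLogarithm (R : CompleteOrderedField) : Set where
  open CompleteOrderedField R
  field
    log      : Carrier → Carrier
    log-cong : ∀ {x y} → x ≈ y → log x ≈ log y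
    log-*    : ∀ x y → 0# < x → 0# < y → log (x * y) ≈ log x + log y
    log-≤    : ∀ x → 0# < x → log x ≤ x - 1#

-- a X³ + b X² Y + c X Y² + d Y³
record CubicForm (A : Set) : Set where
  constructor cubic
  field
    a b c d : A

discriminant : CubicForm ℚ → ℚ
discriminant (cubic a b c d) =
  b * b * c * c - 4ℚ * (a * c * c * c) - 4ℚ * (b * b * b * d)
    - 27ℚ * (a * a * d * d) + 18ℚ * (a * b * c * d)
  where
  open Rat using (_+_; _*_; _-_)
  4ℚ 18ℚ 27ℚ : ℚ
  4ℚ  = Int.+ 4 Rat./ 1
  18ℚ = Int.+ 18 Rat./ 1
  27ℚ = Int.+ 27 Rat./ 1

module RealAnalysis (R : CompleteOrderedField) where
  open CompleteOrderedField R
  open RawMonoidDefinitions +-rawMonoid using () renaming (_×_ to _·_)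

  ℝ : Set
  ℝ = Carrier

  ∣_∣ : ℝ → ℝ
  ∣ x ∣ with IsStrictTotalOrder.compare isStrictTotalOrder x 0#
  ... | tri< _ _ _ = - x
  ... | tri≈ _ _ _ = x
  ... | tri> _ _ _ = x

  fromℤ : ℤ → ℝ
  fromℤ (Int.+ n)    = n · 1#
  fromℤ Int.-[1+ n ] = - (Nat.suc n · 1#)

  fromℚ : ℚ → ℝ
  fromℚ (mkℚ n d-1 _) = fromℤ n * (Nat.suc d-1 · 1#) ⁻¹

  -- f (x + h) = f x + f′ h + o(h); only values of f near x matter.
  HasDerivativeAt : (ℝ → ℝ) → ℝ → ℝ → Set
  HasDerivativeAt f x f′ =
    ∀ ε → 0# < ε → ∃[ δ ] (0# < δ ×
      (∀ h → ∣ h ∣ < δ → ∣ f (x + h) - f x - f′ * h ∣ ≤ ε * ∣ h ∣))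

  infix  4 _≈ᶜ_
  infixl 6 _+ᶜ_ _-ᶜ_
  infixl 7 _*ᶜ_

  record ℂ : Set where
    constructor _+i_
    field
      re im : ℝ
  open ℂ public

  _≈ᶜ_ : Rel ℂ 0ℓ
  z ≈ᶜ w = re z ≈ re w × im z ≈ im w

  real : ℝ → ℂ
  real x = x +i 0#

  0ᶜ 1ᶜ i : ℂ
  0ᶜ = real 0#
  1ᶜ = real 1#
  i  = 0# +i 1#

  _+ᶜ_ _-ᶜ_ _*ᶜ_ : ℂ → ℂ → ℂ
  z +ᶜ w = (re z + re w) +i (im z + im w)
  z -ᶜ w = (re z - re w) +i (im z - im w)
  z *ᶜ w = (re z * re w - im z * im w) +i (re z * im w + im z * re w)

  ∣_∣² : ℂ → ℝ
  ∣ z ∣² = re z * re z + im z * im z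

  record HasPartialsAt (f : ℂ → ℝ) (τ : ℂ) (fx fy : ℝ) : Set where
    field
      ∂x : HasDerivativeAt (λ x → f (x +i im τ)) (re τ) fx
      ∂y : HasDerivativeAt (λ y → f (re τ +i y)) (im τ) fy

  IsCriticalPoint : (ℂ → ℝ) → ℂ → Set
  IsCriticalPoint f τ = HasPartialsAt f τ 0# 0#

  record HasComplexPartialsAt (f : ℂ → ℂ) (τ fx fy : ℂ) : Set where
    field
      real-part      : HasPartialsAt (λ σ → re (f σ)) τ (re fx) (re fy)
      imaginary-part : HasPartialsAt (λ σ → im (f σ)) τ (im fx) (im fy)

  -- ∂/∂τ = ½ (∂/∂x - i ∂/∂y)
  Has∂τAt : (ℂ → ℂ) → ℂ → ℂ → Set
  Has∂τAt f τ w = ∃[ fx ] ∃[ fy ] (HasComplexPartialsAt f τ fx fy ×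
    w ≈ᶜ real (fromℚ Rat.½) *ᶜ (fx -ᶜ i *ᶜ fy))

  -- ∂/∂τ̄ = ½ (∂/∂x + i ∂/∂y)
  Has∂τ̄At : (ℂ → ℂ) → ℂ → ℂ → Set
  Has∂τ̄At f τ w = ∃[ fx ] ∃[ fy ] (HasComplexPartialsAt f τ fx fy ×
    w ≈ᶜ real (fromℚ Rat.½) *ᶜ (fx +ᶜ i *ᶜ fy))

  -- The point [ z ] has homogeneous coordinates (z : 1), and ∞ is (1 : 0).
  data ℙ¹ : Set where
    [_] : ℂ → ℙ¹
    ∞   : ℙ¹

  infix 4 _≈ᴾ_
  _≈ᴾ_ : Rel ℙ¹ 0ℓ
  [ z ] ≈ᴾ [ w ] = z ≈ᶜ w
  [ _ ] ≈ᴾ ∞     = ⊥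
  ∞     ≈ᴾ [ _ ] = ⊥
  ∞     ≈ᴾ ∞     = ⊤

  evaluate : CubicForm ℚ → ℂ → ℂ → ℂ
  evaluate (cubic a b c d) X Y =
    coeff a *ᶜ (X *ᶜ X *ᶜ X) +ᶜ coeff b *ᶜ (X *ᶜ X *ᶜ Y)
      +ᶜ coeff c *ᶜ (X *ᶜ Y *ᶜ Y) +ᶜ coeff d *ᶜ (Y *ᶜ Y *ᶜ Y)
    where
    coeff : ℚ → ℂ
    coeff q = real (fromℚ q)

  IsRoot : CubicForm ℚ → ℙ¹ → Set
  IsRoot F [ z ] = evaluate F z 1ᶜ ≈ᶜ 0ᶜ
  IsRoot F ∞     = evaluate F 1ᶜ 0ᶜ ≈ᶜ 0ᶜ

  -- A cubic form of nonzero discriminant has exactly three roots in ℙ¹(ℂ), so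
  -- three distinct roots are all of them.
  record AreTheRoots (F : CubicForm ℚ) (α β γ : ℙ¹) : Set where
    field
      root-α : IsRoot F α
      root-β : IsRoot F β
      root-γ : IsRoot F γ
      α≉β    : ¬ (α ≈ᴾ β)
      β≉γ    : ¬ (β ≈ᴾ γ)
      α≉γ    : ¬ (α ≈ᴾ γ)

  record ℍ : Set where
    constructor mkℍ
    field
      point  : ℂ
      0<im   : 0# < im point
  open ℍ public

  infix 4 _≈ᴴ_
  _≈ᴴ_ : Rel ℍ 0ℓ
  σ ≈ᴴ τ = point σ ≈ᶜ point τ

  record ℍ₃ : Set where
    constructor mkℍ₃
    field
      t   : ℂ
      u   : ℝ
      0<u : 0# < u
  open ℍ₃ public

  infix 4 _≈³_
  _≈³_ : Rel ℍ₃ 0ℓ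
  p ≈³ q = t p ≈ᶜ t q × u p ≈ u q

  embed : ℍ → ℍ₃
  embed (mkℍ (x +i y) 0<y) = mkℍ₃ (real x) y 0<y

module T³Model (R : CompleteOrderedField) (L : NaturalLogarithm R) where
  open CompleteOrderedField R
  open NaturalLogarithm L
  open RealAnalysis R

  Z : CubicForm ℚ → ℂ → ℂ
  Z F τ = evaluate F τ 1ᶜ

  -- e^{-K} = ⁴⁄₃ (Im τ)³
  exp-K : ℂ → ℝ
  exp-K τ = fromℚ (Int.+ 4 Rat./ 3) * (im τ * im τ * im τ)

  K : ℂ → ℝ
  K τ = - log (exp-K τ)

  -- The derivatives entering V_eff. They are determined on ℍ, and only their
  -- values there matter.
  record PotentialData (F : CubicForm ℚ) : Set where
    field
      ∂Z ∂K ∂̄K : ℂ → ℂ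
      g         : ℂ → ℝ
      ∂Z-spec   : ∀ (τ : ℍ) → Has∂τAt (Z F) (point τ) (∂Z (point τ))
      ∂K-spec   : ∀ (τ : ℍ) → Has∂τAt (λ σ → real (K σ)) (point τ) (∂K (point τ))
      ∂̄K-spec   : ∀ (τ : ℍ) → Has∂τ̄At (λ σ → real (K σ)) (point τ) (∂̄K (point τ))
      g-spec    : ∀ (τ : ℍ) → Has∂τAt ∂̄K (point τ) (real (g (point τ)))

    DZ : ℂ → ℂ
    DZ τ = ∂Z τ +ᶜ ∂K τ *ᶜ Z F τ

    Veff : ℂ → ℝ
    Veff τ = (exp-K τ) ⁻¹ * ((g τ) ⁻¹ * ∣ DZ τ ∣² + ∣ Z F τ ∣²)

  IsAttractorPoint : CubicForm ℚ → ℍ → Set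
  IsAttractorPoint F τ =
    Σ[ D ∈ PotentialData F ] IsCriticalPoint (PotentialData.Veff D) (point τ)

  IsTheAttractorPoint : CubicForm ℚ → ℍ → Set
  IsTheAttractorPoint F τ =
    IsAttractorPoint F τ × (∀ σ → IsAttractorPoint F σ → σ ≈ᴴ τ)

  energyTerm : ℙ¹ → ℍ₃ → ℝ
  energyTerm [ α ] p = log ((∣ t p -ᶜ α ∣² + u p * u p) * u p ⁻¹)
  energyTerm ∞     p = log (u p ⁻¹)

  energy : ℙ¹ → ℙ¹ → ℙ¹ → ℍ₃ → ℝ
  energy α β γ p = energyTerm α p + energyTerm β p + energyTerm γ p

  IsMinimizer : (ℍ₃ → ℝ) → ℍ₃ → Set
  IsMinimizer f p = ∀ q → f p ≤ f q

  IsCenterOfMass : ℙ¹ → ℙ¹ → ℙ¹ → ℍ₃ → Set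
  IsCenterOfMass α β γ p =
    IsMinimizer (energy α β γ) p
      × (∀ q → IsMinimizer (energy α β γ) q → q ≈³ p)

{-# OPTIONS --safe #-}
-- Write A, B, C, D for the Taylor coefficients of F(·, 1) at x = Re τ and y = Im τ. Then
--   V_eff = 3 D² y⁻³ + C² y⁻¹ + B² y + 3 A² y³,
-- so attractor points are the solutions of two polynomial equations E₁ = E₂ = 0 in x and Y = y².
-- On the other side, let (Xᵢ : sᵢ) be the roots and wᵢ = |Xⱼ sₖ − Xₖ sⱼ|². Put Gᵢ = wᵢ (|sᵢ t − Xᵢ|² + sᵢ² u²).
-- The Gᵢ / u are the squared sides of a triangle whose area is bounded below by Heron's formula, so Schur's
-- inequality shows that their product is minimal exactly when their sum is, which happens at
--   t = Σ wᵢ sᵢ Xᵢ / S,   u² = 3 w₁ w₂ w₃ / S²,   S = Σ wᵢ sᵢ².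
-- It remains to solve E₁ = E₂ = 0 for real roots and for one real and two conjugate roots, and to compare.
module Submission where

open import Defs
open import Algebra.Bundles using (CommutativeRing)
import Algebra.Properties.AbelianGroup
import Algebra.Properties.Ring
import Algebra.Properties.Semiring.Mult.TCOptimised as Multiples
import Algebra.Solver.Ring
import Algebra.Solver.Ring.AlmostCommutativeRing as ACR
import Data.Bool.Base as Bool
open import Data.Empty using (⊥; ⊥-elim)
open import Data.Integer.Base as ℤ using (ℤ; +_; -[1+_]; _⊖_)
import Data.Integer.Properties as ℤₚ
open import Data.List.Base as List using (List; []; _∷_)
open import Data.Maybe.Base using (just; is-just; map)
open import Data.Nat.Base as ℕ using (ℕ; zero; suc)
import Data.Nat.Properties as ℕₚ
open import Data.Product.Base using (∃-syntax; _×_; _,_; proj₁; proj₂)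
open import Data.Rational.Base as ℚ using (ℚ; mkℚ; 0ℚ; ½)
import Data.Rational.Properties as ℚₚ
open import Data.Sum.Base using (_⊎_; inj₁; inj₂)
open import Data.Unit.Base using (⊤; tt)
open import Data.Vec.Base as Vec using (Vec; []; _∷_)
open import Data.Vec.N-ary using (N-ary; _$ⁿ_; curryⁿ; curryⁿ-cong; Eq; ∀ⁿ; uncurry-∀ⁿ; left-inverse)
open import Function.Base using (id)
open import Function.Bundles using (Equivalence)
open import Level using (0ℓ)
import Relation.Binary.Construct.StrictToNonStrict as StrictToNonStrict
open import Relation.Binary.Definitions using (tri<; tri≈; tri>)
open import Relation.Binary.PropositionalEquality.Core as ≡ using (_≡_; _≢_)
import Relation.Binary.Reasoning.Setoid
open import Relation.Binary.Structures using (IsStrictTotalOrder)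
open import Relation.Nullary.Decidable using (dec⇒maybe)
open import Relation.Nullary.Decidable.Core using (Dec; yes; no)
open import Relation.Nullary.Negation.Core using (¬_)

-- The derivative data behind `Veff` are arbitrary functions constrained only on ℍ, so critical
-- points can be discussed only after locality and uniqueness of derivatives are established. The
-- pair E₁ = E₂ = 0 is one complex equation 3 λ μ̄ + μ² = 0, with λ proportional to Z and μ to y DZ.
-- Taking absolute values, either DZ = 0 or g⁻¹ |DZ|² = 3 |Z|². For real roots only the first branch
-- survives, and it says that τ is a root of the Hessian of F. For one real root the second branch
-- occurs; there the equations become tractable when solved for the conjugate roots in terms of τ
-- and the real root, and only afterwards inverted. The weights are chosen so that three vectors in
-- ℂ² close up to a triangle whose area has a lower bound involving only W and u. Schur's inequality
-- then bounds the product everywhere from below by a multiple of the sum, and the inequality of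
-- means is applied at the centre alone to show that the bound is attained. Homogeneous coordinates
-- treat a root at ∞ like any other.

-- Polynomial identities with integer coefficients over a commutative ring

module IntegerRingSolver (A : CommutativeRing 0ℓ 0ℓ) where
  open CommutativeRing A
  open Multiples semiring using (×-homo-+; ×1-homo-*) renaming (_×_ to _×′_)
  open Algebra.Properties.Ring ring using (-‿distribˡ-*; -‿distribʳ-*)
  open Algebra.Properties.AbelianGroup +-abelianGroup using (⁻¹-∙-comm; ⁻¹-involutive; ε⁻¹≈ε; x∙y⁻¹≈ε⇒x≈y)
  open Relation.Binary.Reasoning.Setoid setoid

  -- The optimised multiple makes `ι (+ 0)` and `ι (+ 1)` reduce to `0#` and `1#`, so the solver
  -- numerals `# 0` and `# 1` match the constants of the ring definitionally.
  ι : ℤ → Carrier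
  ι (+ n)    = n ×′ 1#
  ι -[1+ n ] = - (suc n ×′ 1#)

  ι-⊖ : ∀ m n → ι (m ⊖ n) ≈ m ×′ 1# - n ×′ 1#
  ι-⊖ m n with ℕₚ.≤-total n m
  ... | inj₁ n≤m = begin
    ι (m ⊖ n)                             ≡⟨ ≡.cong ι (ℤₚ.⊖-≥ n≤m) ⟩
    (m ℕ.∸ n) ×′ 1#                       ≈⟨ x≈x+y-y _ _ ⟩
    (m ℕ.∸ n) ×′ 1# + n ×′ 1# - n ×′ 1#   ≈⟨ +-congʳ (×-homo-+ 1# (m ℕ.∸ n) n) ⟨
    (m ℕ.∸ n ℕ.+ n) ×′ 1# - n ×′ 1#       ≡⟨ ≡.cong (λ k → k ×′ 1# - n ×′ 1#) (ℕₚ.m∸n+n≡m n≤m) ⟩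
    m ×′ 1# - n ×′ 1#                     ∎
    where
    x≈x+y-y : ∀ x y → x ≈ x + y - y
    x≈x+y-y x y = sym (trans (+-assoc x y (- y)) (trans (+-congˡ (-‿inverseʳ y)) (+-identityʳ x)))
  ... | inj₂ m≤n = begin
    ι (m ⊖ n)                             ≡⟨ ≡.cong ι (ℤₚ.⊖-≤ m≤n) ⟩
    ι (ℤ.- (+ (n ℕ.∸ m)))                 ≈⟨ ι-neg (n ℕ.∸ m) ⟩
    - ((n ℕ.∸ m) ×′ 1#)                   ≈⟨ +-identityˡ _ ⟨
    0# + - ((n ℕ.∸ m) ×′ 1#)              ≈⟨ +-congʳ (-‿inverseʳ _) ⟨
    m ×′ 1# - m ×′ 1# - (n ℕ.∸ m) ×′ 1#   ≈⟨ +-assoc _ _ _ ⟩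
    m ×′ 1# + (- (m ×′ 1#) - (n ℕ.∸ m) ×′ 1#) ≈⟨ +-congˡ (⁻¹-∙-comm _ _) ⟩
    m ×′ 1# - (m ×′ 1# + (n ℕ.∸ m) ×′ 1#) ≈⟨ +-congˡ (-‿cong (×-homo-+ 1# m (n ℕ.∸ m))) ⟨
    m ×′ 1# - (m ℕ.+ (n ℕ.∸ m)) ×′ 1#     ≡⟨ ≡.cong (λ k → m ×′ 1# - k ×′ 1#) (ℕₚ.m+[n∸m]≡n m≤n) ⟩
    m ×′ 1# - n ×′ 1#                     ∎
    where
    ι-neg : ∀ k → ι (ℤ.- (+ k)) ≈ - (k ×′ 1#)
    ι-neg zero    = sym ε⁻¹≈ε
    ι-neg (suc k) = refl

  ι-+ : ∀ x y → ι (x ℤ.+ y) ≈ ι x + ι y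
  ι-+ (+ m)    (+ n)    = ×-homo-+ 1# m n
  ι-+ (+ m)    -[1+ n ] = ι-⊖ m (suc n)
  ι-+ -[1+ m ] (+ n)    = trans (ι-⊖ n (suc m)) (+-comm _ _)
  ι-+ -[1+ m ] -[1+ n ] = begin
    - (suc (suc (m ℕ.+ n)) ×′ 1#)         ≡⟨ ≡.cong (λ k → - (suc k ×′ 1#)) (ℕₚ.+-suc m n) ⟨
    - ((suc m ℕ.+ suc n) ×′ 1#)           ≈⟨ -‿cong (×-homo-+ 1# (suc m) (suc n)) ⟩
    - (suc m ×′ 1# + suc n ×′ 1#)         ≈⟨ ⁻¹-∙-comm _ _ ⟨
    - (suc m ×′ 1#) - suc n ×′ 1#         ∎

  ι-neg : ∀ x → ι (ℤ.- x) ≈ - ι x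
  ι-neg (+ zero)    = sym ε⁻¹≈ε
  ι-neg (+ (suc n)) = refl
  ι-neg -[1+ n ]    = sym (⁻¹-involutive _)

  ι-*⁺ : ∀ m y → ι (+ m ℤ.* y) ≈ ι (+ m) * ι y
  ι-*⁺ m (+ n)    = trans (reflexive (≡.cong ι (≡.sym (ℤₚ.pos-* m n)))) (×1-homo-* m n)
  ι-*⁺ m -[1+ n ] = begin
    ι (+ m ℤ.* -[1+ n ])           ≡⟨ ≡.cong ι (ℤₚ.neg-distribʳ-* (+ m) (+ suc n)) ⟨
    ι (ℤ.- (+ m ℤ.* + suc n))      ≈⟨ ι-neg (+ m ℤ.* + suc n) ⟩
    - ι (+ m ℤ.* + suc n)          ≈⟨ -‿cong (ι-*⁺ m (+ suc n)) ⟩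
    - (ι (+ m) * ι (+ suc n))      ≈⟨ -‿distribʳ-* _ _ ⟩
    ι (+ m) * - ι (+ suc n)        ∎

  ι-* : ∀ x y → ι (x ℤ.* y) ≈ ι x * ι y
  ι-* (+ m)    y = ι-*⁺ m y
  ι-* -[1+ m ] y = begin
    ι (-[1+ m ] ℤ.* y)             ≡⟨ ≡.cong ι (ℤₚ.neg-distribˡ-* (+ suc m) y) ⟨
    ι (ℤ.- (+ suc m ℤ.* y))        ≈⟨ ι-neg (+ suc m ℤ.* y) ⟩
    - ι (+ suc m ℤ.* y)            ≈⟨ -‿cong (ι-*⁺ (suc m) y) ⟩
    - (ι (+ suc m) * ι y)          ≈⟨ -‿distribˡ-* _ _ ⟩
    - ι (+ suc m) * ι y            ∎

  ι-morphism : CommutativeRing.rawRing ℤₚ.+-*-commutativeRing ACR.-Raw-AlmostCommutative⟶ ACR.fromCommutativeRing A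
  ι-morphism = record
    { ⟦_⟧    = ι
    ; +-homo = ι-+
    ; *-homo = ι-*
    ; -‿homo = ι-neg
    ; 0-homo = refl
    ; 1-homo = refl
    }

  open Algebra.Solver.Ring (CommutativeRing.rawRing ℤₚ.+-*-commutativeRing) (ACR.fromCommutativeRing A) ι-morphism
    (λ x y → map (λ x≡y → reflexive (≡.cong ι x≡y)) (dec⇒maybe (x ℤₚ.≟ y)))
    public using (Polynomial; con; _:+_; _:*_; _:-_; :-_; _:=_; normalise; _≟N_; ⟦_⟧; ⟦_⟧N-cong; correct; var)

  infix  10 #_
  infix  3 _⊛_
  infixr 2 _⊕_
  infix  1 _from_

  #_ : ∀ {n} → ℕ → Polynomial n
  # k = con (+ k)

  Equation Combination Claim : ℕ → Set
  Equation n    = Polynomial n × Polynomial n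
  Combination n = List (Polynomial n × Equation n)
  Claim n       = Equation n × Combination n

  _⊛_ : ∀ {n} → Polynomial n → Equation n → Combination n
  k ⊛ p≈q = List.[ k , p≈q ]

  _⊕_ : ∀ {n} → Combination n → Combination n → Combination n
  _⊕_ = List._++_

  _from_ : ∀ {n} → Equation n → Combination n → Claim n
  _from_ = _,_

  total : ∀ {n} → Combination n → Polynomial n
  total []                  = # 0
  total ((k , p , q) ∷ eqs) = k :* (p :- q) :+ total eqs

  -- A one-element list gives the bare equation rather than a pair ending in `⊤`, so that hypotheses
  -- are passed as a single proof or as a plain tuple.
  Holds : ∀ {n} → Vec Carrier n → Combination n → Set
  Holds ρ []                     = ⊤
  Holds ρ ((_ , p , q) ∷ [])     = ⟦ p ⟧ ρ ≈ ⟦ q ⟧ ρ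
  Holds ρ ((_ , p , q) ∷ e ∷ es) = ⟦ p ⟧ ρ ≈ ⟦ q ⟧ ρ × Holds ρ (e ∷ es)

  private
    multiple≈0 : ∀ {k p q} → p ≈ q → k * (p - q) ≈ 0#
    multiple≈0 {k} p≈q = trans (*-congˡ (trans (+-congʳ p≈q) (-‿inverseʳ _))) (zeroʳ k)

  total≈0 : ∀ {n} (ρ : Vec Carrier n) es → Holds ρ es → ⟦ total es ⟧ ρ ≈ 0#
  total≈0 ρ []                      _           = refl
  total≈0 ρ ((k , p , q) ∷ [])      p≈q         = trans (+-identityʳ _) (multiple≈0 p≈q)
  total≈0 ρ ((k , p , q) ∷ e ∷ es) (p≈q , rest) =
    trans (+-cong (multiple≈0 p≈q) (total≈0 ρ (e ∷ es) rest)) (+-identityˡ 0#)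

  private
    closed : ∀ {a} {A : Set a} n → N-ary n (Polynomial n) A → A
    closed n f = f $ⁿ Vec.map var (Vec.allFin n)

    -- Agreement of normal forms is demanded as `Bool.T` of a Boolean: on closed polynomials it
    -- computes to `⊤`, so the implicit arguments of `solve` and `linear` are filled in silently,
    -- while a false identity leaves `⊥`.
    same-normal-form : ∀ {n} (p q : Polynomial n) → Bool.T (is-just (normalise p ≟N normalise q)) →
                       ∀ ρ → ⟦ p ⟧ ρ ≈ ⟦ q ⟧ ρ
    same-normal-form p q _ ρ with just p≈q ← normalise p ≟N normalise q =
      trans (sym (correct p ρ)) (trans (⟦ p≈q ⟧N-cong ρ) (correct q ρ))

  solve : ∀ n (f : N-ary n (Polynomial n) (Polynomial n × Polynomial n)) →
            {Bool.T (is-just (normalise (proj₁ (closed n f)) ≟N normalise (proj₂ (closed n f))))} →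
         Eq n _≈_ (curryⁿ ⟦ proj₁ (closed n f) ⟧) (curryⁿ ⟦ proj₂ (closed n f) ⟧)
  solve n f {eq} = curryⁿ-cong _≈_ ⟦ proj₁ (closed n f) ⟧ ⟦ proj₂ (closed n f) ⟧
    (same-normal-form (proj₁ (closed n f)) (proj₂ (closed n f)) eq)

  -- l ≈ r from k₁ ⊛ p₁ ≈ q₁ ⊕ k₂ ⊛ p₂ ≈ q₂ ⊕ … by checking the ring identity l − r = k₁ (p₁ − q₁) + k₂ (p₂ − q₂) + ….
  linear : ∀ n (f : N-ary n (Polynomial n) (Claim n)) →
            let (l , r) , es = closed n f in
            {Bool.T (is-just (normalise (l :- r) ≟N normalise (total es)))} →
            ∀ⁿ n (curryⁿ λ ρ → Holds ρ es → ⟦ l ⟧ ρ ≈ ⟦ r ⟧ ρ)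
  linear n f {eq} = let (l , r) , es = closed n f in Equivalence.from (uncurry-∀ⁿ n) λ ρ →
    ≡.subst id (≡.sym (left-inverse (λ ρ → Holds ρ es → ⟦ l ⟧ ρ ≈ ⟦ r ⟧ ρ) ρ)) λ hypotheses →
      x∙y⁻¹≈ε⇒x≈y _ _ (trans (same-normal-form (l :- r) (total es) eq ρ) (total≈0 ρ es hypotheses))

-- Ordered field arithmetic and square roots

module OrderedField (R : CompleteOrderedField) where
  open CompleteOrderedField R hiding (ring)
  open IntegerRingSolver commutativeRing public using
    (ι; Polynomial; solve; linear; #_; _⊛_; _⊕_; _from_; _:+_; _:*_; _:-_; :-_; _:=_)
  open IsStrictTotalOrder isStrictTotalOrder public using (compare)
    renaming (trans to <-trans; irrefl to <-irrefl; asym to <-asym; <-respˡ-≈ to <-respˡ; <-respʳ-≈ to <-respʳ; _≟_ to _≈?_)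
  open IsStrictTotalOrder isStrictTotalOrder using (<-resp-≈)
  private module ≤ = StrictToNonStrict _≈_ _<_

  2# 3# 4# 8# 9# : Carrier
  2# = ι (+ 2)
  3# = ι (+ 3)
  4# = ι (+ 4)
  8# = ι (+ 8)
  9# = ι (+ 9)

  x-y≈0⇒x≈y : ∀ {x y} → x - y ≈ 0# → x ≈ y
  x-y≈0⇒x≈y = x∙y⁻¹≈ε⇒x≈y _ _
    where open Algebra.Properties.AbelianGroup +-abelianGroup using (x∙y⁻¹≈ε⇒x≈y)

  ≤-refl : ∀ {x} → x ≤ x
  ≤-refl = inj₂ refl

  ≤-reflexive : ∀ {x y} → x ≈ y → x ≤ y
  ≤-reflexive = inj₂

  <⇒≤ : ∀ {x y} → x < y → x ≤ y
  <⇒≤ = inj₁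

  ≤-trans : ∀ {x y z} → x ≤ y → y ≤ z → x ≤ z
  ≤-trans = ≤.trans isEquivalence <-resp-≈ <-trans

  <-≤-trans : ∀ {x y z} → x < y → y ≤ z → x < z
  <-≤-trans = ≤.<-≤-trans <-trans <-respʳ

  ≤-<-trans : ∀ {x y z} → x ≤ y → y < z → x < z
  ≤-<-trans = ≤.≤-<-trans sym <-trans <-respˡ

  ≤-antisym : ∀ {x y} → x ≤ y → y ≤ x → x ≈ y
  ≤-antisym = ≤.antisym isEquivalence <-trans <-irrefl

  ≤-total : ∀ x y → x ≤ y ⊎ y ≤ x
  ≤-total = ≤.total compare

  <⇒≱ : ∀ {x y} → x < y → ¬ (y ≤ x)
  <⇒≱ x<y y≤x = <-irrefl refl (<-≤-trans x<y y≤x)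

  <⇒≉ : ∀ {x y} → x < y → ¬ (y ≈ x)
  <⇒≉ x<y y≈x = <-irrefl (sym y≈x) x<y

  ≮⇒≥ : ∀ {x y} → ¬ (x < y) → y ≤ x
  ≮⇒≥ {x} {y} x≮y with compare x y
  ... | tri< x<y _ _ = ⊥-elim (x≮y x<y)
  ... | tri≈ _ x≈y _ = inj₂ (sym x≈y)
  ... | tri> _ _ y<x = inj₁ y<x

  0<-resp : ∀ {x y} → x ≈ y → 0# < x → 0# < y
  0<-resp = <-respʳ

  0≤-resp : ∀ {x y} → x ≈ y → 0# ≤ x → 0# ≤ y
  0≤-resp x≈y 0≤x = ≤-trans 0≤x (inj₂ x≈y)

  x<y⇒0<y-x : ∀ {x y} → x < y → 0# < y - x
  x<y⇒0<y-x {x} {y} x<y = <-respˡ (-‿inverseˡ x)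
    (<-respʳ (solve 2 (λ x y → :- x :+ y := y :- x) x y) (+-monoʳ-< (- x) x<y))

  0<y-x⇒x<y : ∀ {x y} → 0# < y - x → x < y
  0<y-x⇒x<y {x} {y} 0<d = <-respˡ (+-identityʳ x)
    (<-respʳ (solve 2 (λ x y → x :+ (y :- x) := y) x y) (+-monoʳ-< x 0<d))

  x≤y⇒0≤y-x : ∀ {x y} → x ≤ y → 0# ≤ y - x
  x≤y⇒0≤y-x (inj₁ x<y) = inj₁ (x<y⇒0<y-x x<y)
  x≤y⇒0≤y-x (inj₂ x≈y) = inj₂ (sym (trans (+-congˡ (-‿cong x≈y)) (-‿inverseʳ _)))

  0≤y-x⇒x≤y : ∀ {x y} → 0# ≤ y - x → x ≤ y
  0≤y-x⇒x≤y (inj₁ 0<d) = inj₁ (0<y-x⇒x<y 0<d)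
  0≤y-x⇒x≤y {x} {y} (inj₂ 0≈d) = inj₂ (sym (linear 2 (λ y x → y := x from :- # 1 ⊛ # 0 := y :- x) y x 0≈d))

  <-diff : ∀ {x y e} → y - x ≈ e → 0# < e → x < y
  <-diff d≈e 0<e = 0<y-x⇒x<y (0<-resp (sym d≈e) 0<e)

  ≤-diff : ∀ {x y e} → y - x ≈ e → 0# ≤ e → x ≤ y
  ≤-diff d≈e 0≤e = 0≤y-x⇒x≤y (0≤-resp (sym d≈e) 0≤e)

  0<x+y : ∀ {x y} → 0# < x → 0# ≤ y → 0# < x + y
  0<x+y {x} {y} 0<x 0≤y = ≤-<-trans 0≤y (<-diff (solve 2 (λ x y → x :+ y :- y := x) x y) 0<x)

  0≤x+y : ∀ {x y} → 0# ≤ x → 0# ≤ y → 0# ≤ x + y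
  0≤x+y {x} {y} 0≤x 0≤y = ≤-trans 0≤y (≤-diff (solve 2 (λ x y → x :+ y :- y := x) x y) 0≤x)

  0≤x*y : ∀ {x y} → 0# ≤ x → 0# ≤ y → 0# ≤ x * y
  0≤x*y (inj₁ 0<x) (inj₁ 0<y) = inj₁ (*-pos 0<x 0<y)
  0≤x*y (inj₂ 0≈x) _          = inj₂ (sym (trans (*-congʳ (sym 0≈x)) (zeroˡ _)))
  0≤x*y (inj₁ _)   (inj₂ 0≈y) = inj₂ (sym (trans (*-congˡ (sym 0≈y)) (zeroʳ _)))

  x<0⇒0<-x : ∀ {x} → x < 0# → 0# < - x
  x<0⇒0<-x {x} x<0 = 0<-resp (solve 1 (λ x → # 0 :- x := :- x) x) (x<y⇒0<y-x x<0)

  0<x² : ∀ {x} → ¬ (x ≈ 0#) → 0# < x * x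
  0<x² {x} x≉0 with compare x 0#
  ... | tri< x<0 _ _ = 0<-resp (solve 1 (λ x → :- x :* :- x := x :* x) x) (*-pos (x<0⇒0<-x x<0) (x<0⇒0<-x x<0))
  ... | tri≈ _ x≈0 _ = ⊥-elim (x≉0 x≈0)
  ... | tri> _ _ 0<x = *-pos 0<x 0<x

  0≤x² : ∀ x → 0# ≤ x * x
  0≤x² x with x ≈? 0#
  ... | yes x≈0 = inj₂ (sym (trans (*-congʳ x≈0) (zeroˡ x)))
  ... | no x≉0  = inj₁ (0<x² x≉0)

  0<ι : ∀ n → 0# < ι (+ suc n)
  0<ι zero    = 0<1
  0<ι (suc n) = 0<-resp (sym (1+× (suc n) 1#)) (0<x+y 0<1 (<⇒≤ (0<ι n)))
    where open Multiples semiring using (1+×)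

  x²≈0⇒x≈0 : ∀ {x} → x * x ≈ 0# → x ≈ 0#
  x²≈0⇒x≈0 {x} x²≈0 with x ≈? 0#
  ... | yes x≈0 = x≈0
  ... | no x≉0  = ⊥-elim (<⇒≉ (0<x² x≉0) x²≈0)

  x+y≈0⇒x≈0 : ∀ {x y} → 0# ≤ x → 0# ≤ y → x + y ≈ 0# → x ≈ 0#
  x+y≈0⇒x≈0 (inj₁ 0<x) 0≤y x+y≈0 = ⊥-elim (<⇒≉ (0<x+y 0<x 0≤y) x+y≈0)
  x+y≈0⇒x≈0 (inj₂ 0≈x) _   _     = sym 0≈x

  *-cancelˡ : ∀ {x y z} → ¬ (x ≈ 0#) → x * y ≈ x * z → y ≈ z
  *-cancelˡ {x} {y} {z} x≉0 xy≈xz =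
    (linear 4 (λ y z x i →
      y := z
      from :- (y :- z) ⊛ x :* i := # 1
      ⊕ i ⊛ x :* y := x :* z) y z x (x ⁻¹) (⁻¹-inverseʳ x x≉0 , xy≈xz))

  x*y≈0⇒y≈0 : ∀ {x y} → ¬ (x ≈ 0#) → x * y ≈ 0# → y ≈ 0#
  x*y≈0⇒y≈0 {x} x≉0 xy≈0 = *-cancelˡ x≉0 (trans xy≈0 (sym (zeroʳ x)))

  x*y≈0⇒x≈0⊎y≈0 : ∀ {x y} → x * y ≈ 0# → x ≈ 0# ⊎ y ≈ 0#
  x*y≈0⇒x≈0⊎y≈0 {x} xy≈0 with x ≈? 0#
  ... | yes x≈0 = inj₁ x≈0
  ... | no x≉0  = inj₂ (x*y≈0⇒y≈0 x≉0 xy≈0)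

  0<x*y⇒0<y : ∀ {x y} → 0# < x → 0# < x * y → 0# < y
  0<x*y⇒0<y {x} {y} 0<x 0<xy with compare 0# y
  ... | tri< 0<y _ _ = 0<y
  ... | tri≈ _ 0≈y _ = ⊥-elim (<⇒≉ 0<xy (trans (*-congˡ (sym 0≈y)) (zeroʳ x)))
  ... | tri> _ _ y<0 = ⊥-elim (<-asym 0<xy
          (<-diff (solve 2 (λ x y → # 0 :- x :* y := x :* :- y) x y) (*-pos 0<x (x<0⇒0<-x y<0))))

  0≤x*y⇒0≤y : ∀ {x y} → 0# < x → 0# ≤ x * y → 0# ≤ y
  0≤x*y⇒0≤y 0<x (inj₁ 0<xy) = inj₁ (0<x*y⇒0<y 0<x 0<xy)
  0≤x*y⇒0≤y 0<x (inj₂ 0≈xy) = inj₂ (sym (x*y≈0⇒y≈0 (<⇒≉ 0<x) (sym 0≈xy)))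

  0<x⁻¹ : ∀ {x} → 0# < x → 0# < x ⁻¹
  0<x⁻¹ {x} 0<x = 0<x*y⇒0<y 0<x (0<-resp (sym (⁻¹-inverseʳ x (<⇒≉ 0<x))) 0<1)

  inverse-unique : ∀ {x y} → x * y ≈ 1# → x ⁻¹ ≈ y
  inverse-unique {x} {y} xy≈1 = *-cancelˡ x≉0 (trans (⁻¹-inverseʳ x x≉0) (sym xy≈1))
    where
    x≉0 : ¬ (x ≈ 0#)
    x≉0 x≈0 = <⇒≉ 0<1 (trans (sym xy≈1) (trans (*-congʳ x≈0) (zeroˡ y)))

  +-mono-≤ : ∀ {w x y z} → w ≤ x → y ≤ z → w + y ≤ x + z
  +-mono-≤ {w} {x} {y} {z} w≤x y≤z =
    ≤-diff
      (solve 4 (λ x z w y →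
        x :+ z :- (w :+ y) := (x :- w) :+ (z :- y)) x z w y) (0≤x+y (x≤y⇒0≤y-x w≤x) (x≤y⇒0≤y-x y≤z))

  *-mono-≤ : ∀ {w x y z} → 0# ≤ w → 0# ≤ y → w ≤ x → y ≤ z → w * y ≤ x * z
  *-mono-≤ {w} {x} {y} {z} 0≤w 0≤y w≤x y≤z =
    ≤-diff
      (solve 4 (λ x z w y →
        x :* z :- w :* y := (x :- w) :* z :+ w :* (z :- y)) x z w y)
      (0≤x+y (0≤x*y (x≤y⇒0≤y-x w≤x) (≤-trans 0≤y y≤z)) (0≤x*y 0≤w (x≤y⇒0≤y-x y≤z)))

  square-injective : ∀ {x y} → 0# < x → 0# < y → x * x ≈ y * y → x ≈ y
  square-injective {x} {y} 0<x 0<y x²≈y² =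
    *-cancelˡ (<⇒≉ (0<x+y 0<x (<⇒≤ 0<y)))
      (linear 2 (λ x y →
        (x :+ y) :* x := (x :+ y) :* y
        from # 1 ⊛ x :* x := y :* y) x y x²≈y²)

  positive-lower-bound : ∀ {x y} → 0# < x → 0# < y → ∃[ z ] (0# < z × z ≤ x × z ≤ y)
  positive-lower-bound {x} {y} 0<x 0<y with ≤-total x y
  ... | inj₁ x≤y = x , 0<x , ≤-refl , x≤y
  ... | inj₂ y≤x = y , 0<y , y≤x , ≤-refl

  -- A quotient comes as a witness with its multiplication equation, so that later identities stay
  -- polynomial and can be given to `linear` without mentioning an inverse.
  quotient : ∀ {x} y → 0# < x → ∃[ z ] x * z ≈ y
  quotient {x} y 0<x = x ⁻¹ * y ,
    (linear 3 (λ x j y →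
      x :* (j :* y) := y
      from y ⊛ x :* j := # 1) x (x ⁻¹) y (⁻¹-inverseʳ x (<⇒≉ 0<x)))

  -- The increment is δ = (c - s²) / (2 s + 1 + (c - s²)). It is at most 1, hence (s + δ)² ≤ s² + δ
  -- (2 s + 1) ≤ c.
  enlarge-root : ∀ {s c} → 0# ≤ s → s * s < c → ∃[ t ] (s < t × t * t ≤ c)
  enlarge-root {s} {c} 0≤s s²<c = enlarge (quotient (c - s * s) 0<k)
    where
    0<e : 0# < c - s * s
    0<e = x<y⇒0<y-x s²<c
    0≤2s : 0# ≤ 2# * s
    0≤2s = 0≤x*y (<⇒≤ (0<ι 1)) 0≤s
    0<k : 0# < 2# * s + 1# + (c - s * s)
    0<k = 0<-resp
      (solve 2 (λ s c →
        # 1 :+ (# 2 :* s :+ (c :- s :* s)) := # 2 :* s :+ # 1 :+ (c :- s :* s)) s c)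
      (0<x+y 0<1 (0≤x+y 0≤2s (<⇒≤ 0<e)))
    enlarge : ∃[ δ ] (2# * s + 1# + (c - s * s)) * δ ≈ c - s * s → ∃[ t ] (s < t × t * t ≤ c)
    enlarge (δ , kδ≈e) = s + δ , <-diff (solve 2 (λ s δ → s :+ δ :- s := δ) s δ) 0<δ ,
      ≤-diff
        (linear 3 (λ c s δ →
          c :- (s :+ δ) :* (s :+ δ) := δ :* (# 1 :- δ) :+ (c :- s :* s) :* δ
          from :- # 1 ⊛ (# 2 :* s :+ # 1 :+ (c :- s :* s)) :* δ := c :- s :* s) c s δ kδ≈e)
        (0≤x+y (0≤x*y (<⇒≤ 0<δ) 0≤1-δ) (<⇒≤ (*-pos 0<e 0<δ)))
      where
      0<δ : 0# < δ
      0<δ = 0<x*y⇒0<y 0<k (0<-resp (sym kδ≈e) 0<e)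
      0≤1-δ : 0# ≤ 1# - δ
      0≤1-δ = 0≤x*y⇒0≤y 0<k (0≤-resp
        (linear 3 (λ s c δ →
          # 2 :* s :+ # 1 := (# 2 :* s :+ # 1 :+ (c :- s :* s)) :* (# 1 :- δ)
          from # 1 ⊛ (# 2 :* s :+ # 1 :+ (c :- s :* s)) :* δ := c :- s :* s) s c δ kδ≈e)
        (0≤x+y 0≤2s (<⇒≤ 0<1)))

  -- One Newton step t = (s + c / s) / 2 decreases s but stays above the root, because t² - c = (s -
  -- t)².
  reduce-root : ∀ {s c} → 0# < s → 0# < c → c < s * s → ∃[ t ] (0# < t × t < s × c ≤ t * t)
  reduce-root {s} {c} 0<s 0<c c<s² = reduce (quotient (s * s + c) 0<2s)
    where
    0<2s : 0# < 2# * s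
    0<2s = *-pos (0<ι 1) 0<s
    reduce : ∃[ t ] 2# * s * t ≈ s * s + c → ∃[ t ] (0# < t × t < s × c ≤ t * t)
    reduce (t , 2st≈s²+c) =
      t , 0<x*y⇒0<y 0<2s (0<-resp (sym 2st≈s²+c) (0<x+y (*-pos 0<s 0<s) (<⇒≤ 0<c))) ,
      0<y-x⇒x<y (0<x*y⇒0<y 0<2s (0<-resp
        (linear 3 (λ s c t →
          s :* s :- c := # 2 :* s :* (s :- t)
          from # 1 ⊛ # 2 :* s :* t := s :* s :+ c) s c t 2st≈s²+c) (x<y⇒0<y-x c<s²))) ,
      ≤-diff
        (linear 3 (λ t c s →
          t :* t :- c := (s :- t) :* (s :- t)
          from # 1 ⊛ # 2 :* s :* t := s :* s :+ c) t c s 2st≈s²+c) (0≤x² (s - t))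

  -- The square root is the supremum of the elements whose square is at most c.
  square-root : ∀ {c} → 0# < c → ∃[ s ] (0# < s × s * s ≈ c)
  square-root {c} 0<c = root (complete P (0# , 0²≤c)
      (1# + c , P⇒≤ (0<x+y 0<1 (<⇒≤ 0<c))
        (≤-diff
          (solve 1 (λ c →
            (# 1 :+ c) :* (# 1 :+ c) :- c := # 1 :+ c :+ c :* c) c)
          (<⇒≤ (0<x+y (0<x+y 0<1 (<⇒≤ 0<c)) (0≤x² c))))))
    where
    P : Carrier → Set
    P x = x * x ≤ c

    0²≤c : P 0#
    0²≤c = ≤-trans (≤-reflexive (zeroˡ 0#)) (<⇒≤ 0<c)

    P⇒≤ : ∀ {b} → 0# < b → c ≤ b * b → ∀ x → P x → x ≤ b
    P⇒≤ {b} 0<b c≤b² x x²≤c = ≮⇒≥ λ b<x → <⇒≱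
      (<-diff
        (solve 2 (λ x b →
          x :* x :- b :* b := (x :- b) :* (x :- b) :+ # 2 :* (b :* (x :- b))) x b)
        (0<x+y (0<x² (<⇒≉ (x<y⇒0<y-x b<x)))
          (<⇒≤ (*-pos (0<ι 1) (*-pos 0<b (x<y⇒0<y-x b<x))))))
      (≤-trans x²≤c c≤b²)

    root : ∃[ s ] IsSupremum P s → ∃[ s ] (0# < s × s * s ≈ c)
    root (s , upper , least) = s , 0<s , ≤-antisym (≮⇒≥ c≮s²) (≮⇒≥ s²≮c)
      where
      0≤s : 0# ≤ s
      0≤s = upper 0# 0²≤c
      s²≮c : ¬ (s * s < c)
      s²≮c s²<c = let t , s<t , t²≤c = enlarge-root 0≤s s²<c in <⇒≱ s<t (upper t t²≤c)
      positive : 0# ≤ s → 0# < s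
      positive (inj₁ 0<s) = 0<s
      positive (inj₂ 0≈s) = ⊥-elim (s²≮c (<-respˡ (trans (sym (zeroˡ s)) (*-congʳ 0≈s)) 0<c))
      0<s : 0# < s
      0<s = positive 0≤s
      c≮s² : ¬ (c < s * s)
      c≮s² c<s² = let t , 0<t , t<s , c≤t² = reduce-root 0<s 0<c c<s² in <⇒≱ t<s (least t (P⇒≤ 0<t c≤t²))

-- Absolute value

module AbsoluteValue (R : CompleteOrderedField) where
  open CompleteOrderedField R hiding (ring)
  open RealAnalysis R using (∣_∣)
  open OrderedField R

  -- `∣_∣` is defined by a `with` on a comparison; recording the outcome once as a disjunction keeps
  -- later bounds from unfolding it.
  ∣x∣≈x∨-x : ∀ x → (0# ≤ x × ∣ x ∣ ≈ x) ⊎ (0# ≤ - x × ∣ x ∣ ≈ - x)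
  ∣x∣≈x∨-x x with compare x 0#
  ... | tri< x<0 _ _ = inj₂ (<⇒≤ (x<0⇒0<-x x<0) , refl)
  ... | tri≈ _ x≈0 _ = inj₁ (≤-reflexive (sym x≈0) , refl)
  ... | tri> _ _ 0<x = inj₁ (<⇒≤ 0<x , refl)

  private
    0≤-x⇒x≤0 : ∀ {x} → 0# ≤ - x → x ≤ 0#
    0≤-x⇒x≤0 {x} = ≤-diff (solve 1 (λ x → # 0 :- x := :- x) x)

  0≤∣x∣ : ∀ x → 0# ≤ ∣ x ∣
  0≤∣x∣ x with ∣x∣≈x∨-x x
  ... | inj₁ (0≤x  , eq) = 0≤-resp (sym eq) 0≤x
  ... | inj₂ (0≤-x , eq) = 0≤-resp (sym eq) 0≤-x

  x≤∣x∣ : ∀ x → x ≤ ∣ x ∣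
  x≤∣x∣ x with ∣x∣≈x∨-x x
  ... | inj₁ (_    , eq) = ≤-reflexive (sym eq)
  ... | inj₂ (0≤-x , eq) = ≤-trans (0≤-x⇒x≤0 0≤-x) (0≤∣x∣ x)

  -x≤∣x∣ : ∀ x → - x ≤ ∣ x ∣
  -x≤∣x∣ x with ∣x∣≈x∨-x x
  ... | inj₁ (0≤x , eq) = ≤-trans (0≤-x⇒x≤0 (0≤-resp (solve 1 (λ x → x := :- :- x) x) 0≤x)) (0≤∣x∣ x)
  ... | inj₂ (_   , eq) = ≤-reflexive (sym eq)

  ∣x∣≤ : ∀ {x c} → x ≤ c → - x ≤ c → ∣ x ∣ ≤ c
  ∣x∣≤ {x} x≤c -x≤c with ∣x∣≈x∨-x x
  ... | inj₁ (_ , eq) = ≤-trans (≤-reflexive eq) x≤c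
  ... | inj₂ (_ , eq) = ≤-trans (≤-reflexive eq) -x≤c

  ∣∣-cong : ∀ {x y} → x ≈ y → ∣ x ∣ ≈ ∣ y ∣
  ∣∣-cong x≈y = ≤-antisym (half x≈y) (half (sym x≈y))
    where
    half : ∀ {x y} → x ≈ y → ∣ x ∣ ≤ ∣ y ∣
    half {x} {y} x≈y = ∣x∣≤ (≤-trans (≤-reflexive x≈y) (x≤∣x∣ y))
      (≤-trans (≤-reflexive (-‿cong x≈y)) (-x≤∣x∣ y))

  0≤x⇒∣x∣≈x : ∀ {x} → 0# ≤ x → ∣ x ∣ ≈ x
  0≤x⇒∣x∣≈x {x} 0≤x = ≤-antisym
    (∣x∣≤ ≤-refl (≤-trans (0≤-x⇒x≤0 (0≤-resp (solve 1 (λ x → x := :- :- x) x) 0≤x)) 0≤x)) (x≤∣x∣ x)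

  ∣-x∣≈∣x∣ : ∀ x → ∣ - x ∣ ≈ ∣ x ∣
  ∣-x∣≈∣x∣ x = ≤-antisym (∣x∣≤ (-x≤∣x∣ x) (≤-trans (≤-reflexive (solve 1 (λ x → :- :- x := x) x)) (x≤∣x∣ x)))
    (∣x∣≤ (≤-trans (≤-reflexive (solve 1 (λ x → x := :- :- x) x)) (-x≤∣x∣ (- x))) (x≤∣x∣ (- x)))

  ∣x+y∣≤ : ∀ {x y c d} → ∣ x ∣ ≤ c → ∣ y ∣ ≤ d → ∣ x + y ∣ ≤ c + d
  ∣x+y∣≤ {x} {y} x≤c y≤d = ∣x∣≤ (+-mono-≤ (≤-trans (x≤∣x∣ x) x≤c) (≤-trans (x≤∣x∣ y) y≤d))
    (≤-trans (≤-reflexive (solve 2 (λ x y → :- (x :+ y) := :- x :+ :- y) x y))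
      (+-mono-≤ (≤-trans (-x≤∣x∣ x) x≤c) (≤-trans (-x≤∣x∣ y) y≤d)))

  ∣x*y∣≈ : ∀ x y → ∣ x * y ∣ ≈ ∣ x ∣ * ∣ y ∣
  ∣x*y∣≈ x y = cases (∣x∣≈x∨-x x) (∣x∣≈x∨-x y)
    where
    cases : (0# ≤ x × ∣ x ∣ ≈ x) ⊎ (0# ≤ - x × ∣ x ∣ ≈ - x) →
            (0# ≤ y × ∣ y ∣ ≈ y) ⊎ (0# ≤ - y × ∣ y ∣ ≈ - y) → ∣ x * y ∣ ≈ ∣ x ∣ * ∣ y ∣
    cases (inj₁ (0≤x , p)) (inj₁ (0≤y , q)) =
      trans (0≤x⇒∣x∣≈x (0≤x*y 0≤x 0≤y)) (sym (*-cong p q))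
    cases (inj₁ (0≤x , p)) (inj₂ (0≤-y , q)) =
      trans (sym (∣-x∣≈∣x∣ (x * y))) (trans (∣∣-cong (solve 2 (λ x y → :- (x :* y) := x :* :- y) x y))
        (trans (0≤x⇒∣x∣≈x (0≤x*y 0≤x 0≤-y)) (sym (*-cong p q))))
    cases (inj₂ (0≤-x , p)) (inj₁ (0≤y , q)) =
      trans (sym (∣-x∣≈∣x∣ (x * y))) (trans (∣∣-cong (solve 2 (λ x y → :- (x :* y) := :- x :* y) x y))
        (trans (0≤x⇒∣x∣≈x (0≤x*y 0≤-x 0≤y)) (sym (*-cong p q))))
    cases (inj₂ (0≤-x , p)) (inj₂ (0≤-y , q)) =
      trans (∣∣-cong (solve 2 (λ x y → x :* y := :- x :* :- y) x y))
        (trans (0≤x⇒∣x∣≈x (0≤x*y 0≤-x 0≤-y)) (sym (*-cong p q)))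

  ∣x*y∣≤ : ∀ {x y c d} → ∣ x ∣ ≤ c → ∣ y ∣ ≤ d → ∣ x * y ∣ ≤ c * d
  ∣x*y∣≤ {x} {y} x≤c y≤d = ≤-trans (≤-reflexive (∣x*y∣≈ x y)) (*-mono-≤ (0≤∣x∣ x) (0≤∣x∣ y) x≤c y≤d)

-- Derivatives: locality, uniqueness and second order expansions

module Differentiation (R : CompleteOrderedField) where
  open CompleteOrderedField R hiding (ring)
  open RealAnalysis R using (∣_∣; HasDerivativeAt)
  open OrderedField R
  open AbsoluteValue R

  Near : Carrier → (Carrier → Set) → Set
  Near x P = ∃[ δ ] (0# < δ × (∀ z → ∣ z - x ∣ < δ → P z))

  near-centre : ∀ {x P} → Near x P → P x
  near-centre {x} (δ , 0<δ , P-near) =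
    P-near x (≤-<-trans (≤-reflexive (trans (∣∣-cong (-‿inverseʳ x)) (0≤x⇒∣x∣≈x ≤-refl))) 0<δ)

  near-positive : ∀ {x} → 0# < x → Near x (0# <_)
  near-positive {x} 0<x = x , 0<x , λ z ∣z-x∣<x →
    <-diff (solve 2 (λ z x → z :- # 0 := x :- :- (z :- x)) z x) (x<y⇒0<y-x (≤-<-trans (-x≤∣x∣ (z - x)) ∣z-x∣<x))

  derivative-local : ∀ {f g x f′} → Near x (λ z → f z ≈ g z) → HasDerivativeAt f x f′ → HasDerivativeAt g x f′
  derivative-local {f} {g} {x} {f′} near@(δ₁ , 0<δ₁ , f≈g) f-diff ε 0<ε = at (f-diff ε 0<ε)
    where
    at : ∃[ δ ] (0# < δ × (∀ h → ∣ h ∣ < δ → ∣ f (x + h) - f x - f′ * h ∣ ≤ ε * ∣ h ∣)) →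
         ∃[ δ ] (0# < δ × (∀ h → ∣ h ∣ < δ → ∣ g (x + h) - g x - f′ * h ∣ ≤ ε * ∣ h ∣))
    at (δ₂ , 0<δ₂ , bound) = let δ , 0<δ , δ≤δ₁ , δ≤δ₂ = positive-lower-bound 0<δ₁ 0<δ₂ in
      δ , 0<δ , λ h ∣h∣<δ → ≤-trans
        (≤-reflexive (∣∣-cong (+-congʳ (+-cong
          (sym (f≈g (x + h) (≤-<-trans (≤-reflexive (∣∣-cong (solve 2 (λ x h → x :+ h :- x := h) x h))) (<-≤-trans ∣h∣<δ δ≤δ₁))))
          (-‿cong (sym (near-centre {P = λ z → f z ≈ g z} near)))))))
        (bound h (<-≤-trans ∣h∣<δ δ≤δ₂))

  -- If k and l differ, take ε = |k - l| / 4 and for h half of a common radius: the two error bounds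
  -- give |k - l| h ≤ 2 ε h, against |k - l| h = 4 ε h.
  derivative-unique : ∀ {f x k l} → HasDerivativeAt f x k → HasDerivativeAt f x l → k ≈ l
  derivative-unique {f} {x} {k} {l} k-diff l-diff = decide (k ≈? l)
    where
    absurd : ¬ (k ≈ l) → ⊥
    absurd k≉l = refute (quotient ∣ k - l ∣ (0<ι 3))
      where
      0<∣k-l∣ : 0# < ∣ k - l ∣
      0<∣k-l∣ = positive (0≤∣x∣ (k - l))
        where
        positive : 0# ≤ ∣ k - l ∣ → 0# < ∣ k - l ∣
        positive (inj₁ 0<a) = 0<a
        positive (inj₂ 0≈a) = ⊥-elim (k≉l (x-y≈0⇒x≈y (≤-antisym
          (≤-trans (x≤∣x∣ (k - l)) (≤-reflexive (sym 0≈a)))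
          (≤-diff (solve 2 (λ k l → k :- l :- # 0 := # 0 :- :- (k :- l)) k l) (x≤y⇒0≤y-x (≤-trans (-x≤∣x∣ (k - l)) (≤-reflexive (sym 0≈a))))))))
      refute : ∃[ ε ] 4# * ε ≈ ∣ k - l ∣ → ⊥
      refute (ε , 4ε≈∣k-l∣) = steps (k-diff ε 0<ε) (l-diff ε 0<ε)
        where
        0<ε : 0# < ε
        0<ε = 0<x*y⇒0<y (0<ι 3) (0<-resp (sym 4ε≈∣k-l∣) 0<∣k-l∣)
        steps : ∃[ δ ] (0# < δ × (∀ h → ∣ h ∣ < δ → ∣ f (x + h) - f x - k * h ∣ ≤ ε * ∣ h ∣)) →
                ∃[ δ ] (0# < δ × (∀ h → ∣ h ∣ < δ → ∣ f (x + h) - f x - l * h ∣ ≤ ε * ∣ h ∣)) → ⊥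
        steps (δ₁ , 0<δ₁ , bound₁) (δ₂ , 0<δ₂ , bound₂) =
          let δ , 0<δ , δ≤δ₁ , δ≤δ₂ = positive-lower-bound 0<δ₁ 0<δ₂
              h , 2h≈δ = quotient δ (0<ι 1)
          in contradict 0<δ δ≤δ₁ δ≤δ₂ 2h≈δ
          where
          contradict : ∀ {δ h} → 0# < δ → δ ≤ δ₁ → δ ≤ δ₂ → 2# * h ≈ δ → ⊥
          contradict {δ} {h} 0<δ δ≤δ₁ δ≤δ₂ 2h≈δ = <⇒≱ small≤large large≤small
            where
            0<h : 0# < h
            0<h = 0<x*y⇒0<y (0<ι 1) (0<-resp (sym 2h≈δ) 0<δ)
            ∣h∣≈h : ∣ h ∣ ≈ h
            ∣h∣≈h = 0≤x⇒∣x∣≈x (<⇒≤ 0<h)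
            ∣h∣<δ : ∣ h ∣ < δ
            ∣h∣<δ = ≤-<-trans (≤-reflexive ∣h∣≈h) (<-diff (linear 2 (λ δ h → δ :- h := h from :- # 1 ⊛ # 2 :* h := δ) δ h 2h≈δ) 0<h)
            small≤large : 2# * (ε * h) < 4# * (ε * h)
            small≤large = <-diff
              (solve 2 (λ ε h →
                # 4 :* (ε :* h) :- # 2 :* (ε :* h) := # 2 :* (ε :* h)) ε h) (*-pos (0<ι 1) (*-pos 0<ε 0<h))
            large≤small : 4# * (ε * h) ≤ 2# * (ε * h)
            large≤small = ≤-trans (≤-reflexive (trans (sym (*-assoc 4# ε h)) (*-cong 4ε≈∣k-l∣ (sym ∣h∣≈h))))
              (≤-trans (≤-reflexive (trans (sym (∣x*y∣≈ (k - l) h)) (∣∣-cong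
                (solve 5 (λ k l h e f0 →
                  (k :- l) :* h := (e :- f0 :- l :* h) :+ :- (e :- f0 :- k :* h)) k l h (f (x + h)) (f x)))))
              (≤-trans (∣x+y∣≤ (bound₂ h (<-≤-trans ∣h∣<δ δ≤δ₂))
                  (≤-trans (≤-reflexive (∣-x∣≈∣x∣ _)) (bound₁ h (<-≤-trans ∣h∣<δ δ≤δ₁))))
                (≤-reflexive (trans (+-cong (*-congˡ ∣h∣≈h) (*-congˡ ∣h∣≈h))
                  (solve 2 (λ ε h → ε :* h :+ ε :* h := # 2 :* (ε :* h)) ε h)))))
    decide : Dec (k ≈ l) → k ≈ l
    decide (yes k≈l) = k≈l
    decide (no k≉l)  = ⊥-elim (absurd k≉l)

  -- Second order control of the remainder is closed under products without any ε-management.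
  record HasExpansionAt (f : Carrier → Carrier) (x f′ : Carrier) : Set where
    constructor expansion
    field
      bound    : Carrier
      radius   : Carrier
      0<radius : 0# < radius
      expand   : ∀ h → ∣ h ∣ < radius → ∃[ r ] (f (x + h) ≈ f x + f′ * h + r * (h * h) × ∣ r ∣ ≤ bound)

  expansion⇒derivative : ∀ {f x f′} → HasExpansionAt f x f′ → HasDerivativeAt f x f′
  -- The second radius is ε / (1 + |C|); the summand 1 keeps the divisor positive when C vanishes.
  expansion⇒derivative {f} {x} {f′} (expansion C δ₁ 0<δ₁ expand) ε 0<ε = at (quotient ε 0<1+∣C∣)
    where
    0<1+∣C∣ : 0# < 1# + ∣ C ∣
    0<1+∣C∣ = 0<x+y 0<1 (0≤∣x∣ C)
    at : ∃[ z ] (1# + ∣ C ∣) * z ≈ ε →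
         ∃[ δ ] (0# < δ × (∀ h → ∣ h ∣ < δ → ∣ f (x + h) - f x - f′ * h ∣ ≤ ε * ∣ h ∣))
    at (δ₂ , kδ₂≈ε) =
      let δ , 0<δ , δ≤δ₁ , δ≤δ₂ = positive-lower-bound 0<δ₁ (0<x*y⇒0<y 0<1+∣C∣ (0<-resp (sym kδ₂≈ε) 0<ε))
      in δ , 0<δ , λ h ∣h∣<δ → bound h (≤-trans (<⇒≤ ∣h∣<δ) δ≤δ₂) (expand h (<-≤-trans ∣h∣<δ δ≤δ₁))
      where
      bound : ∀ h → ∣ h ∣ ≤ δ₂ → ∃[ r ] (f (x + h) ≈ f x + f′ * h + r * (h * h) × ∣ r ∣ ≤ C) →
              ∣ f (x + h) - f x - f′ * h ∣ ≤ ε * ∣ h ∣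
      bound h ∣h∣≤δ₂ (r , eq , ∣r∣≤C) =
        ≤-trans (≤-reflexive (trans
          (∣∣-cong
            (linear 5 (λ e f0 f′ h r →
              e :- f0 :- f′ :* h := r :* h :* h
              from # 1 ⊛ e := f0 :+ f′ :* h :+ r :* (h :* h)) (f (x + h)) (f x) f′ h r eq))
          (∣x*y∣≈ (r * h) h)))
        (*-mono-≤ (0≤∣x∣ _) (0≤∣x∣ h)
          (≤-trans (∣x*y∣≤ (≤-trans ∣r∣≤C (≤-trans (x≤∣x∣ C) (≤-diff (solve 1 (λ c → # 1 :+ c :- c := # 1) (∣ C ∣)) (<⇒≤ 0<1)))) ∣h∣≤δ₂)
            (≤-reflexive kδ₂≈ε)) ≤-refl)

  expansion-cong : ∀ {f x k l} → k ≈ l → HasExpansionAt f x k → HasExpansionAt f x l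
  expansion-cong k≈l (expansion C δ 0<δ expand) = expansion C δ 0<δ λ h ∣h∣<δ →
    let r , eq , ∣r∣≤C = expand h ∣h∣<δ in r , trans eq (+-congʳ (+-congˡ (*-congʳ k≈l))) , ∣r∣≤C

  expansion-const : ∀ c x → HasExpansionAt (λ _ → c) x 0#
  expansion-const c x = expansion 0# 1# 0<1 λ h _ →
    0# , (solve 2 (λ c h → c := c :+ # 0 :* h :+ # 0 :* (h :* h)) c h) , ≤-reflexive (0≤x⇒∣x∣≈x ≤-refl)

  expansion-id : ∀ x → HasExpansionAt (λ z → z) x 1#
  expansion-id x = expansion 0# 1# 0<1 λ h _ →
    0# , (solve 2 (λ x h → x :+ h := x :+ # 1 :* h :+ # 0 :* (h :* h)) x h) , ≤-reflexive (0≤x⇒∣x∣≈x ≤-refl)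

  expansion-+ : ∀ {f g x f′ g′} → HasExpansionAt f x f′ → HasExpansionAt g x g′ →
                HasExpansionAt (λ z → f z + g z) x (f′ + g′)
  expansion-+ {f} {g} {x} {f′} {g′} (expansion C₁ δ₁ 0<δ₁ expand₁) (expansion C₂ δ₂ 0<δ₂ expand₂) =
    let δ , 0<δ , δ≤δ₁ , δ≤δ₂ = positive-lower-bound 0<δ₁ 0<δ₂ in
    expansion (C₁ + C₂) δ 0<δ λ h ∣h∣<δ →
      add h (expand₁ h (<-≤-trans ∣h∣<δ δ≤δ₁)) (expand₂ h (<-≤-trans ∣h∣<δ δ≤δ₂))
    where
    add : ∀ h → ∃[ r ] (f (x + h) ≈ f x + f′ * h + r * (h * h) × ∣ r ∣ ≤ C₁) →
          ∃[ r ] (g (x + h) ≈ g x + g′ * h + r * (h * h) × ∣ r ∣ ≤ C₂) →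
          ∃[ r ] (f (x + h) + g (x + h) ≈ f x + g x + (f′ + g′) * h + r * (h * h) × ∣ r ∣ ≤ C₁ + C₂)
    add h (r₁ , eq₁ , b₁) (r₂ , eq₂ , b₂) = r₁ + r₂ ,
      (linear 9 (λ F G f0 g0 f′ g′ h r1 r2 →
        F :+ G := f0 :+ g0 :+ (f′ :+ g′) :* h :+ (r1 :+ r2) :* (h :* h)
        from # 1 ⊛ F := f0 :+ f′ :* h :+ r1 :* (h :* h)
        ⊕ # 1 ⊛ G := g0 :+ g′ :* h :+ r2 :* (h :* h)) (f (x + h)) (g (x + h)) (f x) (g x) f′ g′ h r₁ r₂ (eq₁ , eq₂)) , ∣x+y∣≤ b₁ b₂

  expansion-* : ∀ {f g x f′ g′} → HasExpansionAt f x f′ → HasExpansionAt g x g′ →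
                HasExpansionAt (λ z → f z * g z) x (f′ * g x + f x * g′)
  expansion-* {f} {g} {x} {f′} {g′} (expansion C₁ δ₁ 0<δ₁ expand₁) (expansion C₂ δ₂ 0<δ₂ expand₂) =
    let δ₃ , 0<δ₃ , δ₃≤δ₁ , δ₃≤δ₂ = positive-lower-bound 0<δ₁ 0<δ₂
        δ , 0<δ , δ≤1 , δ≤δ₃ = positive-lower-bound 0<1 0<δ₃ in
    expansion C δ 0<δ λ h ∣h∣<δ →
      multiply h (≤-trans (<⇒≤ ∣h∣<δ) δ≤1) (expand₁ h (<-≤-trans ∣h∣<δ (≤-trans δ≤δ₃ δ₃≤δ₁)))
        (expand₂ h (<-≤-trans ∣h∣<δ (≤-trans δ≤δ₃ δ₃≤δ₂)))
    where
    C : Carrier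
    -- This bounds the coefficient of h² in the product of the expansions. The radius is also kept
    -- below 1, and the factors `1#` are the resulting bounds for |h|.
    C = ∣ f x ∣ * C₂ + ∣ g x ∣ * C₁ + ∣ f′ ∣ * ∣ g′ ∣ + (∣ f′ ∣ * C₂ + ∣ g′ ∣ * C₁) * 1# + C₁ * C₂ * (1# * 1#)
    multiply : ∀ h → ∣ h ∣ ≤ 1# → ∃[ r ] (f (x + h) ≈ f x + f′ * h + r * (h * h) × ∣ r ∣ ≤ C₁) →
      ∃[ r ] (g (x + h) ≈ g x + g′ * h + r * (h * h) × ∣ r ∣ ≤ C₂) →
      ∃[ r ] (f (x + h) * g (x + h) ≈ f x * g x + (f′ * g x + f x * g′) * h + r * (h * h) × ∣ r ∣ ≤ C)
    multiply h ∣h∣≤1 (r₁ , eq₁ , b₁) (r₂ , eq₂ , b₂) =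
      f x * r₂ + g x * r₁ + f′ * g′ + (f′ * r₂ + g′ * r₁) * h + r₁ * r₂ * (h * h) ,
      (linear 9 (λ F G f0 g0 f′ g′ h r2 r1 →
        F :* G :=
           f0 :* g0 :+ (f′ :* g0 :+ f0 :* g′) :* h :+ (f0 :* r2 :+ g0 :* r1 :+ f′ :* g′ :+ (f′ :* r2 :+ g′ :* r1) :*
           h :+ r1 :* r2 :* (h :* h)) :* (h :* h)
        from G ⊛ F := f0 :+ f′ :* h :+ r1 :* (h :* h)
        ⊕ f0 :+ f′ :* h :+ r1 :* (h :* h) ⊛ G := g0 :+ g′ :* h :+ r2 :* (h :* h))
        (f (x + h)) (g (x + h)) (f x) (g x) f′ g′ h r₂ r₁ (eq₁ , eq₂)) ,
      ∣x+y∣≤ (∣x+y∣≤ (∣x+y∣≤ (∣x+y∣≤ (∣x*y∣≤ ≤-refl b₂) (∣x*y∣≤ ≤-refl b₁)) (∣x*y∣≤ ≤-refl ≤-refl))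
          (∣x*y∣≤ (∣x+y∣≤ (∣x*y∣≤ ≤-refl b₂) (∣x*y∣≤ ≤-refl b₁)) ∣h∣≤1))
        (∣x*y∣≤ (∣x*y∣≤ b₁ b₂) (∣x*y∣≤ ∣h∣≤1 ∣h∣≤1))

  expansion-neg : ∀ {f x f′} → HasExpansionAt f x f′ → HasExpansionAt (λ z → - f z) x (- f′)
  expansion-neg {f} {x} {f′} (expansion C δ 0<δ expand) = expansion C δ 0<δ λ h ∣h∣<δ →
    let r , eq , ∣r∣≤C = expand h ∣h∣<δ in
    - r , trans (-‿cong eq)
      (solve 4 (λ f0 f′ h r →
        :- (f0 :+ f′ :* h :+ r :* (h :* h)) := :- f0 :+ :- f′ :* h :+ :- r :* (h :* h)) (f x) f′ h r) ,
    ≤-trans (≤-reflexive (∣-x∣≈∣x∣ r)) ∣r∣≤C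

  ⁻¹-antimono-≤ : ∀ {x y} → 0# < x → x ≤ y → y ⁻¹ ≤ x ⁻¹
  ⁻¹-antimono-≤ {x} {y} 0<x x≤y = ≤-diff
    (linear 4 (λ i j y x →
      i :- j := i :* j :* (y :- x)
      from :- i ⊛ y :* j := # 1
      ⊕ j ⊛ x :* i := # 1) (x ⁻¹) (y ⁻¹) y x (⁻¹-inverseʳ y (<⇒≉ 0<y) , ⁻¹-inverseʳ x (<⇒≉ 0<x)))
    (0≤x*y (<⇒≤ (*-pos (0<x⁻¹ 0<x) (0<x⁻¹ 0<y))) (x≤y⇒0≤y-x x≤y))
    where
    0<y = <-≤-trans 0<x x≤y

  -- With radius y / 2 the argument y + h stays at least δ, so 1 / (y + h) has the uniform bound 1 /
  -- δ.
  half-ball : ∀ {y δ h} → 2# * δ ≈ y → ∣ h ∣ < δ → δ ≤ y + h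
  half-ball {y} {δ} {h} 2δ≈y ∣h∣<δ = ≤-diff
    (linear 3 (λ y h δ →
      y :+ h :- δ := δ :- :- h
      from :- # 1 ⊛ # 2 :* δ := y) y h δ 2δ≈y)
    (x≤y⇒0≤y-x (≤-trans (-x≤∣x∣ h) (<⇒≤ ∣h∣<δ)))

  -- The remainder is exact: 1 / (y + h) = 1 / y - h / y² + h² / (y² (y + h)).
  expansion-⁻¹ : ∀ {y} → 0# < y → HasExpansionAt _⁻¹ y (- (y ⁻¹ * y ⁻¹))
  expansion-⁻¹ {y} 0<y = expand (quotient y (0<ι 1))
    where
    expand : ∃[ δ ] 2# * δ ≈ y → HasExpansionAt _⁻¹ y (- (y ⁻¹ * y ⁻¹))
    expand (δ , 2δ≈y) = expansion (∣ y ⁻¹ * y ⁻¹ ∣ * δ ⁻¹) δ 0<δ λ h ∣h∣<δ →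
      let δ≤y+h = half-ball 2δ≈y ∣h∣<δ
          0<y+h = <-≤-trans 0<δ δ≤y+h
      in y ⁻¹ * y ⁻¹ * (y + h) ⁻¹ ,
         (linear 4 (λ k j h y →
           k := j :+ :- (j :* j) :* h :+ j :* j :* k :* (h :* h)
           from :- k :+ j :* h :* k ⊛ y :* j := # 1
           ⊕ j :- j :* j :* h ⊛ (y :+ h) :* k := # 1)
           ((y + h) ⁻¹) (y ⁻¹) h y (⁻¹-inverseʳ y (<⇒≉ 0<y) , ⁻¹-inverseʳ (y + h) (<⇒≉ 0<y+h))) ,
         ∣x*y∣≤ ≤-refl (≤-trans (≤-reflexive (0≤x⇒∣x∣≈x (<⇒≤ (0<x⁻¹ 0<y+h)))) (⁻¹-antimono-≤ 0<δ δ≤y+h))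
      where
      0<δ : 0# < δ
      0<δ = 0<x*y⇒0<y (0<ι 1) (0<-resp (sym 2δ≈y) 0<y)

-- Monotonicity and derivative of the logarithm

module Logarithm (R : CompleteOrderedField) (L : NaturalLogarithm R) where
  open CompleteOrderedField R hiding (ring)
  open NaturalLogarithm L
  open RealAnalysis R using (∣_∣)
  open OrderedField R
  open AbsoluteValue R
  open Differentiation R

  -- This is `log-≤` at x / y. Exchanging x and y gives the lower bound, and both the monotonicity
  -- and the derivative of the logarithm are drawn from it.
  log-difference : ∀ {x y} → 0# < x → 0# < y → log x - log y ≤ x * y ⁻¹ - 1#
  log-difference {x} {y} 0<x 0<y = ≤-trans (≤-reflexive log-quotient) (log-≤ (x * y ⁻¹) 0<x/y)
    where
    0<x/y : 0# < x * y ⁻¹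
    0<x/y = *-pos 0<x (0<x⁻¹ 0<y)
    log-quotient : log x - log y ≈ log (x * y ⁻¹)
    log-quotient = trans (+-congʳ (trans
        (log-cong
          (linear 3 (λ x j y →
            x := x :* j :* y
            from :- x ⊛ y :* j := # 1) x (y ⁻¹) y (⁻¹-inverseʳ y (<⇒≉ 0<y))))
        (log-* (x * y ⁻¹) y 0<x/y 0<y)))
      (solve 2 (λ a b → a :+ b :- b := a) (log (x * y ⁻¹)) (log y))

  log-mono-< : ∀ {x y} → 0# < x → x < y → log x < log y
  log-mono-< {x} {y} 0<x x<y = 0<y-x⇒x<y (<-≤-trans
    (0<-resp
      (linear 3 (λ y x j →
        (y :- x) :* j := # 1 :- x :* j
        from # 1 ⊛ y :* j := # 1) y x (y ⁻¹) (⁻¹-inverseʳ y (<⇒≉ 0<y)))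
      (*-pos (x<y⇒0<y-x x<y) (0<x⁻¹ 0<y)))
    (≤-diff
      (solve 3 (λ b a q →
        b :- a :- (# 1 :- q) := (q :- # 1) :- (a :- b)) (log y) (log x) (x * y ⁻¹))
      (x≤y⇒0≤y-x (log-difference 0<x 0<y))))
    where
    0<y = <-trans 0<x x<y

  log-mono-≤ : ∀ {x y} → 0# < x → x ≤ y → log x ≤ log y
  log-mono-≤ 0<x (inj₁ x<y) = <⇒≤ (log-mono-< 0<x x<y)
  log-mono-≤ 0<x (inj₂ x≈y) = ≤-reflexive (log-cong x≈y)

  log-cancel-≤ : ∀ {x y} → 0# < y → log x ≤ log y → x ≤ y
  log-cancel-≤ 0<y log≤ = ≮⇒≥ λ y<x → <⇒≱ (log-mono-< 0<y y<x) log≤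

  private
    -- The factor r is e / h², so h = 0 has to be separated; there the bound forces e = 0.
    remainder : ∀ {e c h} → ∣ e ∣ ≤ c * (h * h) → 0# ≤ c → ∃[ r ] (e ≈ r * (h * h) × ∣ r ∣ ≤ c)
    remainder {e} {c} {h} ∣e∣≤ch² 0≤c = cases (h ≈? 0#)
      where
      cases : Dec (h ≈ 0#) → ∃[ r ] (e ≈ r * (h * h) × ∣ r ∣ ≤ c)
      cases (yes h≈0) = 0# , trans (≤-antisym (≤-trans (x≤∣x∣ e) ∣e∣≤0) 0≤e) (sym (zeroˡ (h * h))) ,
          ≤-trans (≤-reflexive (0≤x⇒∣x∣≈x ≤-refl)) 0≤c
        where
        ∣e∣≤0 : ∣ e ∣ ≤ 0#
        ∣e∣≤0 = ≤-trans ∣e∣≤ch² (≤-reflexive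
          (linear 2 (λ c h →
            c :* (h :* h) := # 0
            from c :* h ⊛ h := # 0) c h h≈0))
        0≤e : 0# ≤ e
        0≤e = ≤-diff (solve 1 (λ e → e :- # 0 := # 0 :- :- e) e) (x≤y⇒0≤y-x (≤-trans (-x≤∣x∣ e) ∣e∣≤0))
      cases (no h≉0) = divide (quotient e (0<x² h≉0))
        where
        divide : ∃[ r ] h * h * r ≈ e → ∃[ r ] (e ≈ r * (h * h) × ∣ r ∣ ≤ c)
        divide (r , h²r≈e) = r ,
          (linear 3 (λ e r h →
            e := r :* (h :* h)
            from :- # 1 ⊛ h :* h :* r := e) e r h h²r≈e) ,
          0≤y-x⇒x≤y (0≤x*y⇒0≤y (0<x² h≉0) (0≤-resp
            (solve 3 (λ c h r′ →
              c :* (h :* h) :- h :* h :* r′ := h :* h :* (c :- r′)) c h (∣ r ∣))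
            (x≤y⇒0≤y-x (≤-trans (≤-reflexive (trans (*-congʳ (sym (0≤x⇒∣x∣≈x (0≤x² h))))
              (trans (sym (∣x*y∣≈ (h * h) r)) (∣∣-cong h²r≈e)))) ∣e∣≤ch²))))

  -- From h / (y + h) ≤ log (y + h) - log y ≤ h / y, the error lies between -h² / (y (y + h)) and 0.
  expansion-log : ∀ {y} → 0# < y → HasExpansionAt log y (y ⁻¹)
  expansion-log {y} 0<y = expand (quotient y (0<ι 1))
    where
    expand : ∃[ δ ] 2# * δ ≈ y → HasExpansionAt log y (y ⁻¹)
    expand (δ , 2δ≈y) = expansion (y ⁻¹ * δ ⁻¹) δ 0<δ λ h ∣h∣<δ →
      let r , eq , ∣r∣≤ = remainder (bound (half-ball 2δ≈y ∣h∣<δ)) (<⇒≤ (*-pos (0<x⁻¹ 0<y) (0<x⁻¹ 0<δ)))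
      in r ,
        (linear 5 (λ b a j h r →
          b := a :+ j :* h :+ r :* (h :* h)
          from # 1 ⊛ b :- a :- j :* h := r :* (h :* h)) (log (y + h)) (log y) (y ⁻¹) h r eq) , ∣r∣≤
      where
      0<δ : 0# < δ
      0<δ = 0<x*y⇒0<y (0<ι 1) (0<-resp (sym 2δ≈y) 0<y)
      bound : ∀ {h} → δ ≤ y + h → ∣ log (y + h) - log y - y ⁻¹ * h ∣ ≤ y ⁻¹ * δ ⁻¹ * (h * h)
      bound {h} δ≤y+h = ∣x∣≤
        (≤-trans (≤-diff
          (linear 5 (λ b a j h y →
            # 0 :- (b :- a :- j :* h) := ((y :+ h) :* j :- # 1) :- (b :- a)
            from :- # 1 ⊛ y :* j := # 1) (log (y + h)) (log y) (y ⁻¹) h y (⁻¹-inverseʳ y (<⇒≉ 0<y)))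
          (x≤y⇒0≤y-x (log-difference 0<y+h 0<y)))
          (0≤x*y (<⇒≤ (*-pos (0<x⁻¹ 0<y) (0<x⁻¹ 0<δ))) (0≤x² h)))
        (≤-diff
          (linear 7 (λ j i h b a y k →
            j :* i :* (h :* h) :- :- (b :- a :- j :* h) :=
               ((y :* k :- # 1) :- (a :- b)) :+ j :* (i :- k) :* (h :* h)
            from :- # 1 :+ j :* h ⊛ (y :+ h) :* k := # 1
            ⊕ :- # 1 :* h :* k ⊛ y :* j := # 1)
            (y ⁻¹) (δ ⁻¹) h (log (y + h)) (log y) y ((y + h) ⁻¹) (⁻¹-inverseʳ (y + h) (<⇒≉ 0<y+h) , ⁻¹-inverseʳ y
              (<⇒≉ 0<y)))
          (0≤x+y (x≤y⇒0≤y-x (log-difference 0<y 0<y+h))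
            (0≤x*y (0≤x*y (<⇒≤ (0<x⁻¹ 0<y)) (x≤y⇒0≤y-x (⁻¹-antimono-≤ 0<δ δ≤y+h))) (0≤x² h))))
        where
        0<y+h = <-≤-trans 0<δ δ≤y+h

-- Partial and Wirtinger derivatives on the upper half plane

module PartialDerivatives (R : CompleteOrderedField) where
  open CompleteOrderedField R hiding (ring)
  open RealAnalysis R
  open OrderedField R
  open Differentiation R

  record HasExpansionsAt (f : ℂ → ℝ) (τ : ℂ) (fx fy : ℝ) : Set where
    constructor expansions
    field
      x-expansion : HasExpansionAt (λ x → f (x +i im τ)) (re τ) fx
      y-expansion : HasExpansionAt (λ y → f (re τ +i y)) (im τ) fy

  expansions⇒partials : ∀ {f τ fx fy} → HasExpansionsAt f τ fx fy → HasPartialsAt f τ fx fy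
  expansions⇒partials (expansions x-exp y-exp) = record { ∂x = expansion⇒derivative x-exp ; ∂y = expansion⇒derivative y-exp }

  module _ {τ : ℂ} where
    expansions-cong : ∀ {f fx fy gx gy} → fx ≈ gx → fy ≈ gy → HasExpansionsAt f τ fx fy → HasExpansionsAt f τ gx gy
    expansions-cong {f} fx≈gx fy≈gy (expansions x-exp y-exp) =
      expansions (expansion-cong fx≈gx x-exp) (expansion-cong fy≈gy y-exp)

    expansions-const : ∀ k → HasExpansionsAt (λ _ → k) τ 0# 0#
    expansions-const k = expansions (expansion-const k (re τ)) (expansion-const k (im τ))

    expansions-re : HasExpansionsAt re τ 1# 0#
    expansions-re = expansions (expansion-id (re τ)) (expansion-const (re τ) (im τ))

    expansions-im : HasExpansionsAt im τ 0# 1#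
    expansions-im = expansions (expansion-const (im τ) (re τ)) (expansion-id (im τ))

    expansions-∘im : ∀ {f f′} → HasExpansionAt f (im τ) f′ → HasExpansionsAt (λ σ → f (im σ)) τ 0# f′
    expansions-∘im {f} f-exp = expansions (expansion-const (f (im τ)) (re τ)) f-exp

    expansions-+ : ∀ {f g fx fy gx gy} → HasExpansionsAt f τ fx fy → HasExpansionsAt g τ gx gy →
                   HasExpansionsAt (λ σ → f σ + g σ) τ (fx + gx) (fy + gy)
    expansions-+ (expansions fx-exp fy-exp) (expansions gx-exp gy-exp) = expansions (expansion-+ fx-exp gx-exp) (expansion-+ fy-exp gy-exp)

    expansions-* : ∀ {f g fx fy gx gy} → HasExpansionsAt f τ fx fy → HasExpansionsAt g τ gx gy →
                   HasExpansionsAt (λ σ → f σ * g σ) τ (fx * g τ + f τ * gx) (fy * g τ + f τ * gy)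
    expansions-* (expansions fx-exp fy-exp) (expansions gx-exp gy-exp) = expansions (expansion-* fx-exp gx-exp) (expansion-* fy-exp gy-exp)

    expansions-neg : ∀ {f fx fy} → HasExpansionsAt f τ fx fy → HasExpansionsAt (λ σ → - f σ) τ (- fx) (- fy)
    expansions-neg (expansions fx-exp fy-exp) = expansions (expansion-neg fx-exp) (expansion-neg fy-exp)

  -- Horizontal displacements never leave ℍ, so any radius serves for ∂x; for ∂y the radius must
  -- keep the imaginary part positive.
  partials-local : ∀ {f g τ fx fy} → (∀ σ → 0# < im σ → f σ ≈ g σ) → 0# < im τ →
                   HasPartialsAt f τ fx fy → HasPartialsAt g τ fx fy
  partials-local {f} {g} {τ} f≈g 0<y partials = record
    { ∂x = derivative-local (1# , 0<1 , λ x _ → f≈g (x +i im τ) 0<y) (HasPartialsAt.∂x partials)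
    ; ∂y = derivative-local (near (near-positive 0<y)) (HasPartialsAt.∂y partials)
    }
    where
    near : Near (im τ) (0# <_) → Near (im τ) (λ y → f (re τ +i y) ≈ g (re τ +i y))
    near (δ , 0<δ , positive) = δ , 0<δ , λ y ∣y-im∣<δ → f≈g (re τ +i y) (positive y ∣y-im∣<δ)

  partials-unique : ∀ {f τ fx fy gx gy} → HasPartialsAt f τ fx fy → HasPartialsAt f τ gx gy → fx ≈ gx × fy ≈ gy
  partials-unique {f} {τ} p q =
    derivative-unique {f = λ x → f (x +i im τ)} (HasPartialsAt.∂x p) (HasPartialsAt.∂x q) ,
    derivative-unique {f = λ y → f (re τ +i y)} (HasPartialsAt.∂y p) (HasPartialsAt.∂y q)

  expansions⇒complexPartials : ∀ {f τ fx fy} →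
    HasExpansionsAt (λ σ → re (f σ)) τ (re fx) (re fy) → HasExpansionsAt (λ σ → im (f σ)) τ (im fx) (im fy) →
    HasComplexPartialsAt f τ fx fy
  expansions⇒complexPartials re-exp im-exp = record
    { real-part = expansions⇒partials re-exp ; imaginary-part = expansions⇒partials im-exp }

  complexPartials-local : ∀ {f g τ fx fy} → (∀ σ → 0# < im σ → f σ ≈ᶜ g σ) → 0# < im τ →
                          HasComplexPartialsAt f τ fx fy → HasComplexPartialsAt g τ fx fy
  complexPartials-local f≈g 0<y partials = record
    { real-part = partials-local (λ σ 0<im → proj₁ (f≈g σ 0<im)) 0<y (HasComplexPartialsAt.real-part partials)
    ; imaginary-part = partials-local (λ σ 0<im → proj₂ (f≈g σ 0<im)) 0<y (HasComplexPartialsAt.imaginary-part partials)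
    }

  complexPartials-unique : ∀ {f τ fx fy gx gy} →
    HasComplexPartialsAt f τ fx fy → HasComplexPartialsAt f τ gx gy → fx ≈ᶜ gx × fy ≈ᶜ gy
  complexPartials-unique p q =
    let re-x , re-y = partials-unique (HasComplexPartialsAt.real-part p) (HasComplexPartialsAt.real-part q)
        im-x , im-y = partials-unique (HasComplexPartialsAt.imaginary-part p) (HasComplexPartialsAt.imaginary-part q)
    in (re-x , im-x) , (re-y , im-y)

  +ᶜ-cong : ∀ {z z′ w w′} → z ≈ᶜ z′ → w ≈ᶜ w′ → z +ᶜ w ≈ᶜ z′ +ᶜ w′
  +ᶜ-cong (p , q) (r , s) = +-cong p r , +-cong q s

  -ᶜ-cong : ∀ {z z′ w w′} → z ≈ᶜ z′ → w ≈ᶜ w′ → z -ᶜ w ≈ᶜ z′ -ᶜ w′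
  -ᶜ-cong (p , q) (r , s) = +-cong p (-‿cong r) , +-cong q (-‿cong s)

  *ᶜ-cong : ∀ {z z′ w w′} → z ≈ᶜ z′ → w ≈ᶜ w′ → z *ᶜ w ≈ᶜ z′ *ᶜ w′
  *ᶜ-cong (p , q) (r , s) = +-cong (*-cong p r) (-‿cong (*-cong q s)) , +-cong (*-cong p s) (*-cong q r)

  ≈ᶜ-refl : ∀ {z} → z ≈ᶜ z
  ≈ᶜ-refl = refl , refl

  ≈ᶜ-sym : ∀ {z w} → z ≈ᶜ w → w ≈ᶜ z
  ≈ᶜ-sym (p , q) = sym p , sym q

  ≈ᶜ-trans : ∀ {z w v} → z ≈ᶜ w → w ≈ᶜ v → z ≈ᶜ v
  ≈ᶜ-trans (p , q) (r , s) = trans p r , trans q s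

  -- Two functions are allowed because `g-spec` differentiates the supplied `∂̄K`, and two
  -- admissible choices of that function agree only on ℍ.
  ∂τ-unique : ∀ {f g τ w v} → (∀ σ → 0# < im σ → f σ ≈ᶜ g σ) → 0# < im τ →
              Has∂τAt f τ w → Has∂τAt g τ v → w ≈ᶜ v
  ∂τ-unique f≈g 0<y (fx , fy , f-partials , w≈) (gx , gy , g-partials , v≈) =
    let fx≈gx , fy≈gy = complexPartials-unique (complexPartials-local f≈g 0<y f-partials) g-partials in
    ≈ᶜ-trans w≈ (≈ᶜ-trans (*ᶜ-cong ≈ᶜ-refl (-ᶜ-cong fx≈gx (*ᶜ-cong ≈ᶜ-refl fy≈gy))) (≈ᶜ-sym v≈))

  ∂τ̄-unique : ∀ {f g τ w v} → (∀ σ → 0# < im σ → f σ ≈ᶜ g σ) → 0# < im τ →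
              Has∂τ̄At f τ w → Has∂τ̄At g τ v → w ≈ᶜ v
  ∂τ̄-unique f≈g 0<y (fx , fy , f-partials , w≈) (gx , gy , g-partials , v≈) =
    let fx≈gx , fy≈gy = complexPartials-unique (complexPartials-local f≈g 0<y f-partials) g-partials in
    ≈ᶜ-trans w≈ (≈ᶜ-trans (*ᶜ-cong ≈ᶜ-refl (+ᶜ-cong fx≈gx (*ᶜ-cong ≈ᶜ-refl fy≈gy))) (≈ᶜ-sym v≈))

-- Taylor coefficients and the attractor equations

module TaylorCoefficients (R : CompleteOrderedField) (a b c d : CompleteOrderedField.Carrier R) where
  open CompleteOrderedField R hiding (ring)
  open OrderedField R

  B C D : Carrier → Carrier
  B x = 3# * a * x + b
  C x = (3# * a * x + 2# * b) * x + c
  D x = ((a * x + b) * x + c) * x + d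

  -- With Y = y² these are the derivatives of 3 D² y⁻³ + C² y⁻¹ + B² y + 3 a² y³ along x and y,
  -- cleared of the factors 2 y⁻³ and y⁻⁴; here B′ = 3 a, C′ = 2 B and D′ = C.
  E₁ E₂ : Carrier → Carrier → Carrier
  E₁ x Y = 3# * D x * C x + 2# * B x * C x * Y + 3# * a * B x * Y * Y
  E₂ x Y = B x * B x * Y * Y + 9# * a * a * Y * Y * Y - 9# * D x * D x - C x * C x * Y

  AttractorEquations : Carrier → Carrier → Set
  AttractorEquations x Y = E₁ x Y ≈ 0# × E₂ x Y ≈ 0#

-- The Kähler potential

module KählerPotential (R : CompleteOrderedField) (L : NaturalLogarithm R) where
  open CompleteOrderedField R hiding (ring)
  open NaturalLogarithm L
  open RealAnalysis R
  open T³Model R L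
  open OrderedField R
  open Differentiation R
  open Logarithm R L
  open PartialDerivatives R

  -- `fromℚ` counts with the plain multiple, which ends in `+ 0#`; hence the unfolded sums. Together
  -- with `four-thirds` this translates the constants of the model into solver numerals.
  half : 2# * fromℚ ½ ≈ 1#
  half =
    (linear 1 (λ i →
      # 2 :* ((# 1 :+ # 0) :* i) := # 1
      from # 1 ⊛ (# 1 :+ (# 1 :+ # 0)) :* i := # 1) ((1# + (1# + 0#)) ⁻¹) (⁻¹-inverseʳ (1# + (1# + 0#)) (<⇒≉ 0<2)))
    where
    0<2 : 0# < 1# + (1# + 0#)
    0<2 = 0<-resp (solve 0 ( # 2 := # 1 :+ (# 1 :+ # 0)) ) (0<ι 1)

  four-thirds : 3# * fromℚ (+ 4 ℚ./ 3) ≈ 4#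
  four-thirds =
    (linear 1 (λ i →
      # 3 :* ((# 1 :+ (# 1 :+ (# 1 :+ (# 1 :+ # 0)))) :* i) := # 4
      from # 4 ⊛ (# 1 :+ (# 1 :+ (# 1 :+ # 0))) :* i := # 1)
      ((1# + (1# + (1# + 0#))) ⁻¹) (⁻¹-inverseʳ (1# + (1# + (1# + 0#))) (<⇒≉ 0<3)))
    where
    0<3 : 0# < 1# + (1# + (1# + 0#))
    0<3 = 0<-resp (solve 0 ( # 3 := # 1 :+ (# 1 :+ (# 1 :+ # 0))) ) (0<ι 2)

  0<four-thirds : 0# < fromℚ (+ 4 ℚ./ 3)
  0<four-thirds = 0<x*y⇒0<y (0<ι 2) (0<-resp (sym four-thirds) (0<ι 3))

  -- The law of the logarithm is available only for positive arguments, hence only on ℍ; by locality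
  -- this form may be differentiated in place of `K`.
  K-on-ℍ : ∀ σ → 0# < im σ →
           - (log (fromℚ (+ 4 ℚ./ 3)) + (log (im σ) + log (im σ) + log (im σ))) ≈ K σ
  K-on-ℍ σ 0<y = -‿cong (sym (trans
    (log-* _ (y * y * y) 0<four-thirds (*-pos (*-pos 0<y 0<y) 0<y))
    (+-congˡ (trans (log-* (y * y) y (*-pos 0<y 0<y) 0<y) (+-congʳ (log-* y y 0<y 0<y))))))
    where
    y = im σ

  K-partials : ∀ τ → 0# < im τ → HasComplexPartialsAt (λ σ → real (K σ)) τ 0ᶜ (real (- (3# * im τ ⁻¹)))
  K-partials τ 0<y = complexPartials-local
    {f = λ σ → real (- (log (fromℚ (+ 4 ℚ./ 3)) + (log (im σ) + log (im σ) + log (im σ))))}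
    (λ σ 0<im → K-on-ℍ σ 0<im , refl) 0<y
    (expansions⇒complexPartials
      (expansions-cong
        (solve 0 ( :- (# 0 :+ (# 0 :+ # 0 :+ # 0)) := # 0) ) (solve 1 (λ j → :- (# 0 :+ (j :+ j :+ j)) := :- (# 3 :* j)) (im τ ⁻¹))
        (expansions-neg (expansions-+ (expansions-const _) (expansions-+ (expansions-+ log-exp log-exp) log-exp))))
      (expansions-const 0#))
    where
    log-exp : HasExpansionsAt (λ σ → log (im σ)) τ 0# (im τ ⁻¹)
    log-exp = expansions-∘im (expansion-log 0<y)

  inverse-im-expansions : ∀ τ → 0# < im τ → HasExpansionsAt (λ σ → im σ ⁻¹) τ 0# (- (im τ ⁻¹ * im τ ⁻¹))
  inverse-im-expansions τ 0<y = expansions-∘im (expansion-⁻¹ 0<y)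

-- The effective potential and its critical points

module EffectivePotential (R : CompleteOrderedField) (L : NaturalLogarithm R) (a b c d : ℚ) where
  open CompleteOrderedField R hiding (ring)
  open NaturalLogarithm L
  open RealAnalysis R
  open T³Model R L
  open OrderedField R
  open Differentiation R
  open PartialDerivatives R
  open KählerPotential R L

  F : CubicForm ℚ
  F = cubic a b c d

  open TaylorCoefficients R (fromℚ a) (fromℚ b) (fromℚ c) (fromℚ d) public

  a′ : ℝ
  a′ = fromℚ a

  expansions-B : ∀ {τ} → HasExpansionsAt (λ σ → B (re σ)) τ (3# * a′) 0#
  expansions-B {τ} = expansions-cong
    (solve 2 (λ x a → (# 0 :* x :+ # 3 :* a :* # 1) :+ # 0 := # 3 :* a) (re τ) a′)
    (solve 2 (λ x a → (# 0 :* x :+ # 3 :* a :* # 0) :+ # 0 := # 0) (re τ) a′)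
    (expansions-+ (expansions-* (expansions-const _) expansions-re) (expansions-const _))

  expansions-C : ∀ {τ} → HasExpansionsAt (λ σ → C (re σ)) τ (2# * B (re τ)) 0#
  expansions-C {τ} = expansions-cong
    (solve 3 (λ x a b →
      ((# 0 :* x :+ # 3 :* a :* # 1) :+ # 0) :* x :+ (# 3 :* a :* x :+ # 2 :* b) :* # 1 :+ # 0 :=
         # 2 :* (# 3 :* a :* x :+ b)) (re τ) a′ (fromℚ b))
    (solve 3 (λ x a b →
      ((# 0 :* x :+ # 3 :* a :* # 0) :+ # 0) :* x :+ (# 3 :* a :* x :+ # 2 :* b) :* # 0 :+ # 0 := # 0)
      (re τ) a′ (fromℚ b))
    (expansions-+ (expansions-* (expansions-+ (expansions-* (expansions-const _) expansions-re) (expansions-const _))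
      expansions-re) (expansions-const _))

  expansions-D : ∀ {τ} → HasExpansionsAt (λ σ → D (re σ)) τ (C (re τ)) 0#
  expansions-D {τ} = expansions-cong
    (solve 4 (λ x a b c →
      (((# 0 :* x :+ a :* # 1) :+ # 0) :* x :+ (a :* x :+ b) :* # 1 :+ # 0) :* x :+ ((a :* x :+ b) :* x :+ c) :* # 1
         :+ # 0 :=
         (# 3 :* a :* x :+ # 2 :* b) :* x :+ c) (re τ) a′ (fromℚ b) (fromℚ c))
    (solve 4 (λ x a b c →
      (((# 0 :* x :+ a :* # 0) :+ # 0) :* x :+ (a :* x :+ b) :* # 0 :+ # 0) :* x :+ ((a :* x :+ b) :* x :+ c) :* # 0
         :+ # 0 :=
         # 0) (re τ) a′ (fromℚ b) (fromℚ c))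
    (expansions-+ (expansions-* (expansions-+ (expansions-* (expansions-+ (expansions-* (expansions-const _) expansions-re)
      (expansions-const _)) expansions-re) (expansions-const _)) expansions-re) (expansions-const _))

  -- Real and imaginary part of F(x + i y, 1), by Taylor expansion about the real point x with
  -- increment i y.
  Zre Zim : ℂ → ℝ
  Zre σ = D (re σ) + - (im σ * im σ * B (re σ))
  Zim σ = im σ * (C (re σ) + - (im σ * im σ * a′))

  Z-on-ℂ : ∀ σ → (Zre σ +i Zim σ) ≈ᶜ Z F σ
  Z-on-ℂ σ =
    (solve 6 (λ x y a b c d →
      let p = x :* x :- y :* y
          q = x :* y :+ y :* x
          r = x :* # 1 :- y :* # 0
          s = x :* # 0 :+ y :* # 1
          u = # 1 :* # 1 :- # 0 :* # 0
          v = # 1 :* # 0 :+ # 0 :* # 1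
      in ((a :* x :+ b) :* x :+ c) :* x :+ d :+ :- (y :* y :* (# 3 :* a :* x :+ b)) :=
         (a :* (p :* x :- q :* y) :- # 0 :* (p :* y :+ q :* x)) :+ (b :* (p :* # 1 :- q :* # 0) :- # 0 :* (p :* # 0
         :+ q :* # 1)) :+ (c :* (r :* # 1 :- s :* # 0) :- # 0 :* (r :* # 0 :+ s :* # 1)) :+ (d :* (u :* # 1 :- v :*
         # 0) :- # 0 :* (u :* # 0 :+ v :* # 1))) (re σ) (im σ) a′ (fromℚ b) (fromℚ c) (fromℚ d)) ,
    (solve 6 (λ x y a b c d →
      let p = x :* x :- y :* y
          q = x :* y :+ y :* x
          r = x :* # 1 :- y :* # 0
          s = x :* # 0 :+ y :* # 1
          u = # 1 :* # 1 :- # 0 :* # 0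
          v = # 1 :* # 0 :+ # 0 :* # 1
      in y :* ((# 3 :* a :* x :+ # 2 :* b) :* x :+ c :+ :- (y :* y :* a)) :=
         (a :* (p :* y :+ q :* x) :+ # 0 :* (p :* x :- q :* y)) :+ (b :* (p :* # 0 :+ q :* # 1) :+ # 0 :* (p :* # 1
         :- q :* # 0)) :+ (c :* (r :* # 0 :+ s :* # 1) :+ # 0 :* (r :* # 1 :- s :* # 0)) :+ (d :* (u :* # 0 :+ v :*
         # 1) :+ # 0 :* (u :* # 1 :- v :* # 0))) (re σ) (im σ) a′ (fromℚ b) (fromℚ c) (fromℚ d))

  Z-partials : ∀ τ → 0# < im τ → HasComplexPartialsAt (Z F) τ
    ((C (re τ) - 3# * a′ * (im τ * im τ)) +i (2# * im τ * B (re τ)))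
    ((- (2# * im τ * B (re τ))) +i (C (re τ) - 3# * a′ * (im τ * im τ)))
  Z-partials τ 0<y = complexPartials-local {f = λ σ → Zre σ +i Zim σ} (λ σ _ → Z-on-ℂ σ) 0<y
    (expansions⇒complexPartials
      (expansions-cong
        (solve 4 (λ C y B a →
          C :+ :- ((# 0 :* y :+ y :* # 0) :* B :+ y :* y :* (# 3 :* a)) := C :- # 3 :* a :* (y :* y))
          (C (re τ)) (im τ) (B (re τ)) a′)
        (solve 2 (λ y B →
          # 0 :+ :- ((# 1 :* y :+ y :* # 1) :* B :+ y :* y :* # 0) := :- (# 2 :* y :* B)) (im τ) (B (re τ)))
        (expansions-+ expansions-D (expansions-neg (expansions-* (expansions-* expansions-im expansions-im) expansions-B))))
      (expansions-cong
        (solve 4 (λ C y a B →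
          # 0 :* (C :+ :- (y :* y :* a)) :+ y :* (# 2 :* B :+ :- ((# 0 :* y :+ y :* # 0) :* a :+ y :* y :* # 0)) :=
             # 2 :* y :* B) (C (re τ)) (im τ) a′ (B (re τ)))
        (solve 3 (λ C y a →
          # 1 :* (C :+ :- (y :* y :* a)) :+ y :* (# 0 :+ :- ((# 1 :* y :+ y :* # 1) :* a :+ y :* y :* # 0)) :=
             C :- # 3 :* a :* (y :* y)) (C (re τ)) (im τ) a′)
        (expansions-* expansions-im (expansions-+ expansions-C
          (expansions-neg (expansions-* (expansions-* expansions-im expansions-im) (expansions-const a′)))))))

  -- Here ∂Z is the derivative of the polynomial, ∂K = 3 i / (2 y), ∂̄K = -3 i / (2 y) and g = 3 /
  -- (4 y²). This choice serves as a witness for attractor points and as the reference with which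
  -- every other choice is compared on ℍ.
  potentialData : PotentialData F
  potentialData = record
    { ∂Z      = λ τ → (C (re τ) - 3# * a′ * (im τ * im τ)) +i (2# * im τ * B (re τ))
    ; ∂K      = λ τ → 0# +i (fromℚ ½ * (3# * im τ ⁻¹))
    ; ∂̄K      = λ τ → 0# +i (- (fromℚ ½ * (3# * im τ ⁻¹)))
    ; g       = λ τ → fromℚ ½ * (fromℚ ½ * (3# * (im τ ⁻¹ * im τ ⁻¹)))
    ; ∂Z-spec = λ { (mkℍ τ 0<y) → _ , _ , Z-partials τ 0<y ,
        (linear 3 (λ u h v →
          u := h :* (u :- (# 0 :* :- v :- # 1 :* u)) :- # 0 :* (v :- (# 0 :* u :+ # 1 :* :- v))
          from :- u ⊛ # 2 :* h := # 1) (C (re τ) - 3# * a′ * (im τ * im τ)) (fromℚ ½) (2# * im τ * B (re τ)) half) ,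
        (linear 3 (λ v h u →
          v := h :* (v :- (# 0 :* u :+ # 1 :* :- v)) :+ # 0 :* (u :- (# 0 :* :- v :- # 1 :* u))
          from :- v ⊛ # 2 :* h := # 1) (2# * im τ * B (re τ)) (fromℚ ½) (C (re τ) - 3# * a′ * (im τ * im τ)) half) }
    ; ∂K-spec = λ { (mkℍ τ 0<y) → _ , _ , K-partials τ 0<y ,
        (solve 2 (λ h j →
          # 0 :=
             h :* (# 0 :- (# 0 :* :- (# 3 :* j) :- # 1 :* # 0)) :- # 0 :* (# 0 :- (# 0 :* # 0 :+ # 1 :* :- (# 3 :*
             j)))) (fromℚ ½) (im τ ⁻¹)) ,
        (solve 2 (λ h j →
          h :* (# 3 :* j) :=
             h :* (# 0 :- (# 0 :* # 0 :+ # 1 :* :- (# 3 :* j))) :+ # 0 :* (# 0 :- (# 0 :* :- (# 3 :* j) :- # 1 :*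
             # 0))) (fromℚ ½) (im τ ⁻¹)) }
    ; ∂̄K-spec = λ { (mkℍ τ 0<y) → _ , _ , K-partials τ 0<y ,
        (solve 2 (λ h j →
          # 0 :=
             h :* (# 0 :+ (# 0 :* :- (# 3 :* j) :- # 1 :* # 0)) :- # 0 :* (# 0 :+ (# 0 :* # 0 :+ # 1 :* :- (# 3 :*
             j)))) (fromℚ ½) (im τ ⁻¹)) ,
        (solve 2 (λ h j →
          :- (h :* (# 3 :* j)) :=
             h :* (# 0 :+ (# 0 :* # 0 :+ # 1 :* :- (# 3 :* j))) :+ # 0 :* (# 0 :+ (# 0 :* :- (# 3 :* j) :- # 1 :*
             # 0))) (fromℚ ½) (im τ ⁻¹)) }
    ; g-spec  = λ { (mkℍ τ 0<y) → 0ᶜ , 0# +i (fromℚ ½ * (3# * (im τ ⁻¹ * im τ ⁻¹))) ,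
        expansions⇒complexPartials (expansions-const 0#)
          (expansions-cong
            (solve 2 (λ j h → :- (# 0 :* (# 3 :* j) :+ h :* (# 0 :* j :+ # 3 :* # 0)) := # 0) (im τ ⁻¹) (fromℚ ½))
            (solve 2 (λ j h →
              :- (# 0 :* (# 3 :* j) :+ h :* (# 0 :* j :+ # 3 :* :- (j :* j))) := h :* (# 3 :* (j :* j)))
              (im τ ⁻¹) (fromℚ ½))
            (expansions-neg (expansions-* (expansions-const _) (expansions-* (expansions-const _) (inverse-im-expansions τ 0<y))))) ,
        (solve 2 (λ h w →
          h :* w := h :* (# 0 :- (# 0 :* # 0 :- # 1 :* w)) :- # 0 :* (# 0 :- (# 0 :* w :+ # 1 :* # 0)))
          (fromℚ ½) (fromℚ ½ * (3# * (im τ ⁻¹ * im τ ⁻¹)))) ,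
        (solve 2 (λ h w →
          # 0 := h :* (# 0 :- (# 0 :* w :+ # 1 :* # 0)) :+ # 0 :* (# 0 :- (# 0 :* # 0 :- # 1 :* w)))
          (fromℚ ½) (fromℚ ½ * (3# * (im τ ⁻¹ * im τ ⁻¹)))) }
    }

  V : ℂ → ℝ
  V σ = 3# * (D (re σ) * D (re σ)) * (im σ ⁻¹ * im σ ⁻¹ * im σ ⁻¹) + C (re σ) * C (re σ) * im σ ⁻¹
    + B (re σ) * B (re σ) * im σ + 3# * (a′ * a′) * (im σ * im σ * im σ)

  private
    -- In ((y C + 3 A y³)² + (y² B + 3 D)²) / 3 + (D - y² B)² + y² (C - y² A)² the mixed terms A C
    -- and B D cancel, which leaves a sum of four squares. The hypotheses concern y P and y Q
    -- because multiplying DZ = P + i Q by y removes the inverse. The three steps eliminate P, Q, X,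
    -- W, then h = 1/2 and t = 4/3, then y j = 1.
    potential-identity : ∀ {h t y j A B C D P Q X W} → 2# * h ≈ 1# → 3# * t ≈ 4# → y * j ≈ 1# →
      y * P ≈ - (h * (y * C + 3# * A * (y * y * y))) → y * Q ≈ h * (y * y * B + 3# * D) →
      X ≈ D + - (y * y * B) → W ≈ y * (C + - (y * y * A)) →
      3# * h * h * (j * j * j) * (t * (y * y) * (P * P + Q * Q) + (X * X + W * W)) ≈
      3# * (D * D) * (j * j * j) + C * C * j + B * B * y + 3# * (A * A) * (y * y * y)
    potential-identity {h} {t} {y} {j} {A} {B} {C} {D} {P} {Q} {X} {W} 2h≈1 3t≈4 yj≈1 yP≈ yQ≈ X≈ W≈ = trans
      (linear 12 (λ j h y C A B D t P Q X W →
        let j³ = j :* j :* j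
            U = h :* (y :* C :+ # 3 :* A :* (y :* y :* y))
            V = h :* (y :* y :* B :+ # 3 :* D)
            M = D :+ :- (y :* y :* B)
            N = y :* (C :+ :- (y :* y :* A))
        in # 3 :* h :* h :* j³ :* (t :* (y :* y) :* (P :* P :+ Q :* Q) :+ (X :* X :+ W :* W)) :=
           # 3 :* h :* h :* j³ :* (t :* (U :* U :+ V :* V) :+ (M :* M :+ N :* N))
        from # 3 :* h :* h :* j³ :* t :* (y :* P :- U) ⊛ y :* P := :- U
        ⊕ # 3 :* h :* h :* j³ :* t :* (y :* Q :+ V) ⊛ y :* Q := V
        ⊕ # 3 :* h :* h :* j³ :* (X :+ M) ⊛ X := M
        ⊕ # 3 :* h :* h :* j³ :* (W :+ N) ⊛ W := N) j h y C A B D t P Q X W (yP≈ , yQ≈ , X≈ , W≈))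
      (trans
      (linear 8 (λ j y C A B D h t →
        let j³ = j :* j :* j
            U = y :* C :+ # 3 :* A :* (y :* y :* y)
            V = y :* y :* B :+ # 3 :* D
            M = D :+ :- (y :* y :* B)
            N = y :* (C :+ :- (y :* y :* A))
            S = # 3 :* D :* D :+ y :* y :* C :* C :+ y :* y :* y :* y :* B :* B :+ # 3 :* y :* y :* y :* y :* y :* y
              :* A :* A
        in # 3 :* h :* h :* j³ :* (t :* (h :* U :* (h :* U) :+ h :* V :* (h :* V)) :+ (M :* M :+ N :* N)) := j³ :* S
        from h :* h :* h :* h :* j³ :* (U :* U :+ V :* V) ⊛ # 3 :* t := # 4
        ⊕ (# 2 :* h :+ # 1) :* j³ :* (h :* h :* (U :* U :+ V :* V) :+ S) ⊛ # 2 :* h := # 1)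
        j y C A B D h t (3t≈4 , 2h≈1))
      (linear 6 (λ j D y C B A →
        j :* j :* j :* (# 3 :* D :* D :+ y :* y :* C :* C :+ y :* y :* y :* y :* B :* B :+ # 3 :* y :* y :* y :* y
           :* y :* y :* A :* A) :=
           # 3 :* (D :* D) :* (j :* j :* j) :+ C :* C :* j :+ B :* B :* y :+ # 3 :* (A :* A) :* (y :* y :* y)
        from C :* C :* j :* (y :* j :+ # 1) :+ (B :* B :* y :+ # 3 :* (A :* A) :* (y :* y :* y)) :* (y :* j :* (y :*
           j) :+ y :* j :+ # 1) ⊛ y :* j :=
           # 1) j D y C B A yj≈1))

  module _ (𝒟 : PotentialData F) where
    open PotentialData 𝒟

    Veff-on-ℍ : ∀ σ → 0# < im σ → V σ ≈ Veff σ
    Veff-on-ℍ σ 0<y = sym (trans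
      (*-cong exp-K⁻¹ (+-cong (*-cong g⁻¹ (+-cong (*-cong DZ-re DZ-re) (*-cong DZ-im DZ-im)))
        (+-cong (*-cong (sym (proj₁ (Z-on-ℂ σ))) (sym (proj₁ (Z-on-ℂ σ)))) (*-cong (sym (proj₂ (Z-on-ℂ σ))) (sym (proj₂ (Z-on-ℂ σ)))))))
      (potential-identity half four-thirds yj≈1
        (linear 6 (λ y C a X h j →
          y :* (C :- # 3 :* a :* (y :* y) :+ (# 0 :* X :- h :* (# 3 :* j) :* (y :* (C :+ :- (y :* y :* a))))) :=
             :- (h :* (y :* C :+ # 3 :* a :* (y :* y :* y)))
          from :- (# 3 :* h :* (y :* (C :+ :- (y :* y :* a)))) ⊛ y :* j := # 1
          ⊕ :- (y :* C :- # 3 :* a :* (y :* y :* y)) ⊛ # 2 :* h := # 1)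
          (im σ) (C (re σ)) a′ (Zre σ) (fromℚ ½) (im σ ⁻¹) (yj≈1 , half))
        (linear 6 (λ y B W h j D →
          y :* (# 2 :* y :* B :+ (# 0 :* W :+ h :* (# 3 :* j) :* (D :+ :- (y :* y :* B)))) :=
             h :* (y :* y :* B :+ # 3 :* D)
          from # 3 :* h :* (D :+ :- (y :* y :* B)) ⊛ y :* j := # 1
          ⊕ :- (# 2 :* y :* y :* B) ⊛ # 2 :* h := # 1)
          (im σ) (B (re σ)) (Zim σ) (fromℚ ½) (im σ ⁻¹) (D (re σ)) (yj≈1 , half))
        refl refl))
      where
      yj≈1 : im σ * im σ ⁻¹ ≈ 1#
      yj≈1 = ⁻¹-inverseʳ (im σ) (<⇒≉ 0<y)
      module 𝒟₀ = PotentialData potentialData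
      ∂Z≈ : ∂Z σ ≈ᶜ 𝒟₀.∂Z σ
      ∂Z≈ = ∂τ-unique (λ _ _ → ≈ᶜ-refl) 0<y (∂Z-spec (mkℍ σ 0<y)) (𝒟₀.∂Z-spec (mkℍ σ 0<y))
      ∂K≈ : ∂K σ ≈ᶜ 𝒟₀.∂K σ
      ∂K≈ = ∂τ-unique (λ _ _ → ≈ᶜ-refl) 0<y (∂K-spec (mkℍ σ 0<y)) (𝒟₀.∂K-spec (mkℍ σ 0<y))
      g≈ : g σ ≈ 𝒟₀.g σ
      g≈ = proj₁ (∂τ-unique
        (λ ρ 0<im → ∂τ̄-unique (λ _ _ → ≈ᶜ-refl) 0<im (∂̄K-spec (mkℍ ρ 0<im)) (𝒟₀.∂̄K-spec (mkℍ ρ 0<im)))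
        0<y (g-spec (mkℍ σ 0<y)) (𝒟₀.g-spec (mkℍ σ 0<y)))
      DZ≈ : DZ σ ≈ᶜ 𝒟₀.∂Z σ +ᶜ 𝒟₀.∂K σ *ᶜ (Zre σ +i Zim σ)
      DZ≈ = +ᶜ-cong ∂Z≈ (*ᶜ-cong ∂K≈ (≈ᶜ-sym (Z-on-ℂ σ)))
      DZ-re = proj₁ DZ≈
      DZ-im = proj₂ DZ≈
      exp-K⁻¹ : exp-K σ ⁻¹ ≈ 3# * fromℚ ½ * fromℚ ½ * (im σ ⁻¹ * im σ ⁻¹ * im σ ⁻¹)
      exp-K⁻¹ = inverse-unique
        (linear 4 (λ t y h j →
          t :* (y :* y :* y) :* (# 3 :* h :* h :* (j :* j :* j)) := # 1
          from h :* h :* (y :* j) :* (y :* j) :* (y :* j) ⊛ # 3 :* t := # 4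
          ⊕ (# 2 :* h :+ # 1) :* (y :* j) :* (y :* j) :* (y :* j) ⊛ # 2 :* h := # 1
          ⊕ y :* j :* (y :* j) :+ y :* j :+ # 1 ⊛ y :* j := # 1)
          (fromℚ (+ 4 ℚ./ 3)) (im σ) (fromℚ ½) (im σ ⁻¹) (four-thirds , half , yj≈1))
      g⁻¹ : g σ ⁻¹ ≈ fromℚ (+ 4 ℚ./ 3) * (im σ * im σ)
      g⁻¹ = trans (⁻¹-cong g≈) (inverse-unique
        (linear 4 (λ h j t y →
          h :* (h :* (# 3 :* (j :* j))) :* (t :* (y :* y)) := # 1
          from h :* h :* (y :* j) :* (y :* j) ⊛ # 3 :* t := # 4
          ⊕ (# 2 :* h :+ # 1) :* (y :* j) :* (y :* j) ⊛ # 2 :* h := # 1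
          ⊕ y :* j :+ # 1 ⊛ y :* j := # 1)
          (fromℚ ½) (im σ ⁻¹) (fromℚ (+ 4 ℚ./ 3)) (im σ) (four-thirds , half , yj≈1)))

  V-expansions : ∀ τ → 0# < im τ → HasExpansionsAt V τ
    (2# * (im τ ⁻¹ * im τ ⁻¹ * im τ ⁻¹) * E₁ (re τ) (im τ * im τ))
    (im τ ⁻¹ * im τ ⁻¹ * im τ ⁻¹ * im τ ⁻¹ * E₂ (re τ) (im τ * im τ))
  V-expansions τ 0<y = expansions-cong
    (linear 6 (λ D C j B a y →
      (# 0 :* (D :* D) :+ # 3 :* (C :* D :+ D :* C)) :* (j :* j :* j) :+ # 3 :* (D :* D) :* ((# 0 :* j :+ j :* # 0)
         :* j :+ j :* j :* # 0) :+ ((# 2 :* B :* C :+ C :* (# 2 :* B)) :* j :+ C :* C :* # 0) :+ ((# 3 :* a :* B :+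
         B :* (# 3 :* a)) :* y :+ B :* B :* # 0) :+ (# 0 :* (y :* y :* y) :+ # 3 :* (a :* a) :* ((# 0 :* y :+ y :*
         # 0) :* y :+ y :* y :* # 0)) :=
         # 2 :* (j :* j :* j) :* (# 3 :* D :* C :+ # 2 :* B :* C :* (y :* y) :+ # 3 :* a :* B :* (y :* y) :* (y :*
         y))
      from :- (# 4 :* B :* C :* j :* (y :* j :+ # 1) :+ # 2 :* # 3 :* a :* B :* y :* (y :* j :* (y :* j) :+ y :* j
         :+ # 1)) ⊛ y :* j :=
         # 1) (D (re τ)) (C (re τ)) (im τ ⁻¹) (B (re τ)) a′ (im τ) (⁻¹-inverseʳ (im τ) (<⇒≉ 0<y)))
    (linear 6 (λ D j C B y a →
      (# 0 :* (D :* D) :+ # 3 :* (# 0 :* D :+ D :* # 0)) :* (j :* j :* j) :+ # 3 :* (D :* D) :* ((:- (j :* j) :* j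
         :+ j :* :- (j :* j)) :* j :+ j :* j :* :- (j :* j)) :+ ((# 0 :* C :+ C :* # 0) :* j :+ C :* C :* :- (j :*
         j)) :+ ((# 0 :* B :+ B :* # 0) :* y :+ B :* B :* # 1) :+ (# 0 :* (y :* y :* y) :+ # 3 :* (a :* a) :* ((# 1
         :* y :+ y :* # 1) :* y :+ y :* y :* # 1)) :=
         j :* j :* j :* j :* (B :* B :* (y :* y) :* (y :* y) :+ # 9 :* a :* a :* (y :* y) :* (y :* y) :* (y :* y) :-
         # 9 :* D :* D :- C :* C :* (y :* y))
      from C :* C :* j :* j :* (y :* j :+ # 1) :- (B :* B :+ # 9 :* a :* a :* y :* y) :* (y :* j :* (y :* j) :+ # 1)
         :* (y :* j :+ # 1) ⊛ y :* j :=
         # 1) (D (re τ)) (im τ ⁻¹) (C (re τ)) (B (re τ)) (im τ) a′ (⁻¹-inverseʳ (im τ) (<⇒≉ 0<y)))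
    (expansions-+ (expansions-+ (expansions-+
      (expansions-* (expansions-* (expansions-const _) (expansions-* expansions-D expansions-D))
        (expansions-* (expansions-* 1/y-exp 1/y-exp) 1/y-exp))
      (expansions-* (expansions-* expansions-C expansions-C) 1/y-exp))
      (expansions-* (expansions-* expansions-B expansions-B) expansions-im))
      (expansions-* (expansions-const _) (expansions-* (expansions-* expansions-im expansions-im) expansions-im)))
    where
    1/y-exp : HasExpansionsAt (λ σ → im σ ⁻¹) τ 0# (- (im τ ⁻¹ * im τ ⁻¹))
    1/y-exp = inverse-im-expansions τ 0<y

  attractor⇒equations : ∀ τ → IsAttractorPoint F τ →
    AttractorEquations (re (point τ)) (im (point τ) * im (point τ))
  attractor⇒equations (mkℍ τ 0<y) (𝒟 , critical) =
    let Vx≈0 , Vy≈0 = partials-unique (expansions⇒partials (V-expansions τ 0<y))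
                        (partials-local (λ σ 0<im → sym (Veff-on-ℍ 𝒟 σ 0<im)) 0<y critical)
    in x*y≈0⇒y≈0 (<⇒≉ (*-pos (0<ι 1) 0<j³)) Vx≈0 , x*y≈0⇒y≈0 (<⇒≉ (*-pos 0<j³ 0<j)) Vy≈0
    where
    0<j : 0# < im τ ⁻¹
    0<j = 0<x⁻¹ 0<y
    0<j³ : 0# < im τ ⁻¹ * im τ ⁻¹ * im τ ⁻¹
    0<j³ = *-pos (*-pos 0<j 0<j) 0<j

  equations⇒attractor : ∀ τ → AttractorEquations (re (point τ)) (im (point τ) * im (point τ)) → IsAttractorPoint F τ
  equations⇒attractor (mkℍ τ 0<y) (E₁≈0 , E₂≈0) = potentialData ,
    partials-local (Veff-on-ℍ potentialData) 0<y (expansions⇒partials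
      (expansions-cong (trans (*-congˡ E₁≈0) (zeroʳ _)) (trans (*-congˡ E₂≈0) (zeroʳ _)) (V-expansions τ 0<y)))

-- Schur's inequality and the inequality of means

module SymmetricInequalities (R : CompleteOrderedField) where
  open CompleteOrderedField R hiding (ring)
  open OrderedField R

  private
    schurᴾ : ∀ {n} (x y z : Polynomial n) → Polynomial n
    schurᴾ x y z = x :* (x :- y) :* (x :- z) :+ y :* (y :- x) :* (y :- z) :+ z :* (z :- x) :* (z :- y)

    -- With z smallest, the first two terms combine to (x - y)² (x + y - z), and the third is a
    -- product of nonnegative factors.
    schur-min : ∀ {x y z} → 0# ≤ x → 0# ≤ y → 0# ≤ z → z ≤ x → z ≤ y →
      0# ≤ x * (x - y) * (x - z) + y * (y - x) * (y - z) + z * (z - x) * (z - y)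
    schur-min {x} {y} {z} 0≤x 0≤y 0≤z z≤x z≤y = 0≤-resp
      (solve 3 (λ x y z →
        (x :- y) :* (x :- y) :* (x :+ (y :- z)) :+ z :* ((x :- z) :* (y :- z)) := schurᴾ x y z) x y z)
      (0≤x+y (0≤x*y (0≤x² (x - y)) (0≤x+y 0≤x (x≤y⇒0≤y-x z≤y)))
        (0≤x*y 0≤z (0≤x*y (x≤y⇒0≤y-x z≤x) (x≤y⇒0≤y-x z≤y))))

  schur : ∀ {x y z} → 0# ≤ x → 0# ≤ y → 0# ≤ z →
    0# ≤ x * (x - y) * (x - z) + y * (y - x) * (y - z) + z * (z - x) * (z - y)
  schur {x} {y} {z} 0≤x 0≤y 0≤z = cases (≤-total x y) (≤-total y z) (≤-total x z)
    where
    cases : x ≤ y ⊎ y ≤ x → y ≤ z ⊎ z ≤ y → x ≤ z ⊎ z ≤ x →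
      0# ≤ x * (x - y) * (x - z) + y * (y - x) * (y - z) + z * (z - x) * (z - y)
    cases _          (inj₂ z≤y) (inj₂ z≤x) = schur-min 0≤x 0≤y 0≤z z≤x z≤y
    cases (inj₁ x≤y) _          (inj₁ x≤z) = 0≤-resp
      (solve 3 (λ z y x → schurᴾ z y x := schurᴾ x y z) z y x)
      (schur-min 0≤z 0≤y 0≤x x≤z x≤y)
    cases (inj₂ y≤x) (inj₁ y≤z) _          = 0≤-resp
      (solve 3 (λ x z y → schurᴾ x z y := schurᴾ x y z) x z y)
      (schur-min 0≤x 0≤z 0≤y y≤x y≤z)
    cases (inj₂ y≤x) (inj₂ z≤y) (inj₁ x≤z) = schur-min 0≤x 0≤y 0≤z (≤-trans z≤y y≤x) z≤y
    cases (inj₁ x≤y) (inj₁ y≤z) (inj₂ z≤x) = 0≤-resp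
      (solve 3 (λ z y x → schurᴾ z y x := schurᴾ x y z) z y x)
      (schur-min 0≤z 0≤y 0≤x (≤-trans x≤y y≤z) x≤y)

  -- Twice e₁³ - 27 e₃ equals e₁ Σ (x - y)² + 6 Σ x (y - z)². Naming the mean k instead of the
  -- product's root avoids cube roots.
  am-gm₃ : ∀ {x y z k} → 0# ≤ x → 0# ≤ y → 0# ≤ z → x + y + z ≈ 3# * k → x * y * z ≤ k * k * k
  am-gm₃ {x} {y} {z} {k} 0≤x 0≤y 0≤z e₁≈3k = 0≤y-x⇒x≤y (0≤x*y⇒0≤y (*-pos (0<ι 1) (*-pos (0<ι 8) (0<ι 2))) (0≤-resp
    (linear 4 (λ x y z k →
      (x :+ y :+ z) :* ((x :- y) :* (x :- y) :+ (y :- z) :* (y :- z) :+ (z :- x) :* (z :- x)) :+ # 2 :* # 3 :* (x :*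
         ((y :- z) :* (y :- z)) :+ y :* ((z :- x) :* (z :- x)) :+ z :* ((x :- y) :* (x :- y))) :=
         # 2 :* (# 9 :* # 3) :* (k :* k :* k :- x :* y :* z)
      from # 2 :* ((x :+ y :+ z) :* (x :+ y :+ z) :+ (x :+ y :+ z) :* (# 3 :* k) :+ # 9 :* k :* k) ⊛ x :+ y :+ z :=
         # 3 :* k) x y z k e₁≈3k)
    (0≤x+y (0≤x*y (0≤x+y (0≤x+y 0≤x 0≤y) 0≤z) (0≤x+y (0≤x+y (0≤x² _) (0≤x² _)) (0≤x² _)))
      (0≤x*y (<⇒≤ (*-pos (0<ι 1) (0<ι 2)))
        (0≤x+y (0≤x+y (0≤x*y 0≤x (0≤x² _)) (0≤x*y 0≤y (0≤x² _))) (0≤x*y 0≤z (0≤x² _)))))))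

  -- Schur's inequality reads 9 e₃ ≥ e₁ (4 e₂ − e₁²).
  schur-lower-bound : ∀ {x y z k} → 0# ≤ x → 0# ≤ y → 0# ≤ z →
    3# * (k * k) ≤ 4# * (x * y + y * z + z * x) - (x + y + z) * (x + y + z) →
    (x + y + z) * (k * k) ≤ 3# * (x * y * z)
  schur-lower-bound {x} {y} {z} {k} 0≤x 0≤y 0≤z 3k²≤ = 0≤y-x⇒x≤y (0≤x*y⇒0≤y (0<ι 2) (0≤-resp
    (solve 4 (λ x y z k →
      schurᴾ x y z :+ (x :+ y :+ z) :* (# 4 :* (x :* y :+ y :* z :+ z :* x) :- (x :+ y :+ z) :* (x :+ y :+ z) :- # 3
         :* (k :* k)) :=
         # 3 :* (# 3 :* (x :* y :* z) :- (x :+ y :+ z) :* (k :* k))) x y z k)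
    (0≤x+y (schur 0≤x 0≤y 0≤z) (0≤x*y (0≤x+y (0≤x+y 0≤x 0≤y) 0≤z) (x≤y⇒0≤y-x 3k²≤)))))

-- Triangles attached to three weighted points of the projective line

module WeightedConfigurations (R : CompleteOrderedField) where
  open CompleteOrderedField R hiding (ring)
  open RealAnalysis R
  open OrderedField R

  -- Homogeneous coordinates (X P : s P) of P.
  X : ℙ¹ → ℂ
  X [ z ] = z
  X ∞     = 1ᶜ

  s : ℙ¹ → ℝ
  s [ _ ] = 1#
  s ∞     = 0#

  minor : ℙ¹ → ℙ¹ → ℂ
  minor P Q = (re (X P) * s Q - re (X Q) * s P) +i (im (X P) * s Q - im (X Q) * s P)

  weight : ℙ¹ → ℙ¹ → ℝ
  weight P Q = ∣ minor P Q ∣²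

  displacement : ℙ¹ → ℂ → ℂ
  displacement P t = (s P * re t - re (X P)) +i (s P * im t - im (X P))

  -- For a finite point this is |t - z|² + v, where v plays the role of u²; for ∞ it is constantly
  -- 1, in agreement with the energy term log (1 / u).
  N : ℙ¹ → ℂ → ℝ → ℝ
  N P t v = ∣ displacement P t ∣² + s P * s P * v

  0≤∣z∣² : ∀ z → 0# ≤ ∣ z ∣²
  0≤∣z∣² z = 0≤x+y (0≤x² (re z)) (0≤x² (im z))

  0<N : ∀ P t {v} → 0# < v → 0# < N P t v
  0<N [ z ] t {v} 0<v = 0<-resp
    (solve 2 (λ v n →
      v :+ n := n :+ # 1 :* # 1 :* v) v (∣ displacement [ z ] t ∣²))
    (0<x+y 0<v (0≤∣z∣² (displacement [ z ] t)))
  0<N ∞     t {v} 0<v = 0<-resp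
    (solve 3 (λ x y v →
      # 1 := (# 0 :* x :- # 1) :* (# 0 :* x :- # 1) :+ (# 0 :* y :- # 0) :* (# 0 :* y :- # 0) :+ # 0 :* # 0 :* v)
      (re t) (im t) v) 0<1

  -- Heron's formula for the triangle with sides (P₁, √v Q₁), (P₂, √v Q₂) in ℂ² = ℝ⁴.
  heron : ∀ P₁ P₂ Q₁ Q₂ v →
    let g₁ = ∣ P₁ ∣² + v * ∣ Q₁ ∣²
        g₂ = ∣ P₂ ∣² + v * ∣ Q₂ ∣²
        g₃ = ∣ P₁ +ᶜ P₂ ∣² + v * ∣ Q₁ +ᶜ Q₂ ∣²
        k  = re P₁ * im P₂ - im P₁ * re P₂ + v * (re Q₁ * im Q₂ - im Q₁ * re Q₂)
    in 4# * (g₁ * g₂ + g₂ * g₃ + g₃ * g₁) - (g₁ + g₂ + g₃) * (g₁ + g₂ + g₃) ≈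
       4# * (v * ∣ P₁ *ᶜ Q₂ -ᶜ P₂ *ᶜ Q₁ ∣²) + 4# * (k * k)
  heron (a +i b) (c +i d) (e +i f) (g +i h) v =
    (solve 9 (λ a b v e f c d g h →
      let g1 = a :* a :+ b :* b :+ v :* (e :* e :+ f :* f)
          g2 = c :* c :+ d :* d :+ v :* (g :* g :+ h :* h)
          g3 = (a :+ c) :* (a :+ c) :+ (b :+ d) :* (b :+ d) :+ v :* ((e :+ g) :* (e :+ g) :+ (f :+ h) :* (f :+ h))
          l = a :* g :- b :* h :- (c :* e :- d :* f)
          m = a :* h :+ b :* g :- (c :* f :+ d :* e)
          k = a :* d :- b :* c :+ v :* (e :* h :- f :* g)
      in # 4 :* (g1 :* g2 :+ g2 :* g3 :+ g3 :* g1) :- (g1 :+ g2 :+ g3) :* (g1 :+ g2 :+ g3) :=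
         # 4 :* (v :* (l :* l :+ m :* m)) :+ # 4 :* (k :* k)) a b v e f c d g h)

  module _ (α β γ : ℙ¹) where
    w₁ w₂ w₃ S W X₀ Y₀ : ℝ
    w₁ = weight β γ
    w₂ = weight γ α
    w₃ = weight α β
    S  = w₁ * (s α * s α) + w₂ * (s β * s β) + w₃ * (s γ * s γ)
    W  = w₁ * w₂ * w₃
    X₀ = w₁ * (s α * re (X α)) + w₂ * (s β * re (X β)) + w₃ * (s γ * re (X γ))
    Y₀ = w₁ * (s α * im (X α)) + w₂ * (s β * im (X β)) + w₃ * (s γ * im (X γ))

    private
      lagrange : ∀ {w₁ w₂ w₃ s₁ s₂ s₃ x₁ x₂ x₃ y₁ y₂ y₃} →
        (w₁ * (s₁ * s₁) + w₂ * (s₂ * s₂) + w₃ * (s₃ * s₃)) *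
          (w₁ * (x₁ * x₁ + y₁ * y₁) + w₂ * (x₂ * x₂ + y₂ * y₂) + w₃ * (x₃ * x₃ + y₃ * y₃)) ≈
        (w₁ * (s₁ * x₁) + w₂ * (s₂ * x₂) + w₃ * (s₃ * x₃)) * (w₁ * (s₁ * x₁) + w₂ * (s₂ * x₂) + w₃ * (s₃ * x₃))
        + (w₁ * (s₁ * y₁) + w₂ * (s₂ * y₂) + w₃ * (s₃ * y₃)) * (w₁ * (s₁ * y₁) + w₂ * (s₂ * y₂) + w₃ * (s₃ * y₃))
        + (w₂ * w₃ * ((x₂ * s₃ - x₃ * s₂) * (x₂ * s₃ - x₃ * s₂) + (y₂ * s₃ - y₃ * s₂) * (y₂ * s₃ - y₃ * s₂))
          + w₃ * w₁ * ((x₃ * s₁ - x₁ * s₃) * (x₃ * s₁ - x₁ * s₃) + (y₃ * s₁ - y₁ * s₃) * (y₃ * s₁ - y₁ * s₃))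
          + w₁ * w₂ * ((x₁ * s₂ - x₂ * s₁) * (x₁ * s₂ - x₂ * s₁) + (y₁ * s₂ - y₂ * s₁) * (y₁ * s₂ - y₂ * s₁)))
      lagrange {w₁} {w₂} {w₃} {s₁} {s₂} {s₃} {x₁} {x₂} {x₃} {y₁} {y₂} {y₃} =
        (solve 12 (λ w1 s1 x1 w2 s2 x2 w3 s3 x3 y1 y2 y3 →
          let a = w1 :* (s1 :* x1) :+ w2 :* (s2 :* x2) :+ w3 :* (s3 :* x3)
              b = w1 :* (s1 :* y1) :+ w2 :* (s2 :* y2) :+ w3 :* (s3 :* y3)
              p1 = x2 :* s3 :- x3 :* s2
              q1 = y2 :* s3 :- y3 :* s2
              p2 = x3 :* s1 :- x1 :* s3
              q2 = y3 :* s1 :- y1 :* s3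
              p3 = x1 :* s2 :- x2 :* s1
              q3 = y1 :* s2 :- y2 :* s1
          in (w1 :* (s1 :* s1) :+ w2 :* (s2 :* s2) :+ w3 :* (s3 :* s3)) :* (w1 :* (x1 :* x1 :+ y1 :* y1) :+ w2 :*
             (x2 :* x2 :+ y2 :* y2) :+ w3 :* (x3 :* x3 :+ y3 :* y3)) :=
             a :* a :+ b :* b :+ (w2 :* w3 :* (p1 :* p1 :+ q1 :* q1) :+ w3 :* w1 :* (p2 :* p2 :+ q2 :* q2) :+ w1 :*
             w2 :* (p3 :* p3 :+ q3 :* q3))) w₁ s₁ x₁ w₂ s₂ x₂ w₃ s₃ x₃ y₁ y₂ y₃)

    -- In Lagrange's identity each cross term wᵢ wⱼ |minor|² is W again, because the weights are
    -- themselves the squared minors. The three copies are the origin of the 3 in u² = 3 W / S².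
    moment : S * (w₁ * ∣ X α ∣² + w₂ * ∣ X β ∣² + w₃ * ∣ X γ ∣²) ≈ X₀ * X₀ + Y₀ * Y₀ + 3# * W
    moment = trans lagrange (+-congˡ
      (solve 3 (λ b c a →
        b :* c :* a :+ c :* a :* b :+ a :* b :* c := # 3 :* (a :* b :* c)) w₂ w₃ w₁))

    -- Let mᵢ be the minor of the two other roots. The vectors mᵢ (sᵢ t - Xᵢ, sᵢ √v) have squared
    -- lengths Gᵢ, and their sum vanishes like a determinant with a repeated row, so they are the
    -- sides of a triangle. The complex determinant of two of them is m₁ m₂ m₃ √v up to sign,
    -- whatever t is. The discarded square k² comes from the imaginary part of their Hermitian
    -- product.
    gram : ∀ t v →
      let G₁ = w₁ * N α t v
          G₂ = w₂ * N β t v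
          G₃ = w₃ * N γ t v
      in 4# * (W * v) ≤ 4# * (G₁ * G₂ + G₂ * G₃ + G₃ * G₁) - (G₁ + G₂ + G₃) * (G₁ + G₂ + G₃)
    gram t v = ≤-diff {e = 4# * (k * k)} (trans (+-congʳ (trans
        (+-cong (*-congˡ (+-cong (+-cong (*-cong G₁≈ G₂≈) (*-cong G₂≈ G₃≈)) (*-cong G₃≈ G₁≈)))
          (-‿cong (*-cong (+-cong (+-cong G₁≈ G₂≈) G₃≈) (+-cong (+-cong G₁≈ G₂≈) G₃≈))))
        (trans (heron P₁ P₂ Q₁ Q₂ v) (+-congʳ (*-congˡ (*-congˡ area))))))
      (solve 3 (λ v W k → # 4 :* (v :* W) :+ k :- # 4 :* (W :* v) := k) v W (4# * (k * k))))
      (0≤x*y (<⇒≤ (0<ι 3)) (0≤x² k))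
      where
      P Q : ℂ → ℙ¹ → ℂ
      P m A = m *ᶜ displacement A t
      Q m A = (re m * s A) +i (im m * s A)
      P₁ = P (minor β γ) α
      P₂ = P (minor γ α) β
      Q₁ = Q (minor β γ) α
      Q₂ = Q (minor γ α) β
      k  = re P₁ * im P₂ - im P₁ * re P₂ + v * (re Q₁ * im Q₂ - im Q₁ * re Q₂)
      mᴾ : ∀ {n} (x s y r : Polynomial n) → Polynomial n
      mᴾ x s y r = x :* r :- y :* s

      factor : ∀ m A → ∣ m ∣² * N A t v ≈ ∣ P m A ∣² + v * ∣ Q m A ∣²
      factor m A =
        (solve 6 (λ a b c d r v →
          (a :* a :+ b :* b) :* (c :* c :+ d :* d :+ r :* r :* v) :=
             (a :* c :- b :* d) :* (a :* c :- b :* d) :+ (a :* d :+ b :* c) :* (a :* d :+ b :* c) :+ v :* (a :* r :*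
             (a :* r) :+ b :* r :* (b :* r))) (re m) (im m) (re (displacement A t)) (im (displacement A t)) (s A) v)
      G₁≈ = factor (minor β γ) α
      G₂≈ = factor (minor γ α) β
      ∣-z∣² : ∀ {x y z w} → x ≈ - z → y ≈ - w → x * x + y * y ≈ z * z + w * w
      ∣-z∣² {x} {y} {z} {w} x≈-z y≈-w =
        (linear 4 (λ x y z w →
          x :* x :+ y :* y := z :* z :+ w :* w
          from x :- z ⊛ x := :- z
          ⊕ y :- w ⊛ y := :- w) x y z w (x≈-z , y≈-w))
      G₃≈ : w₃ * N γ t v ≈ ∣ P₁ +ᶜ P₂ ∣² + v * ∣ Q₁ +ᶜ Q₂ ∣²
      G₃≈ = trans (factor (minor α β) γ) (+-cong
        (∣-z∣²
          (solve 11 (λ x1 p y1 q r t1 c1 x2 y2 t2 c2 →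
            mᴾ x1 p y1 q :* (r :* t1 :- c1) :- mᴾ x2 p y2 q :* (r :* t2 :- c2) :=
               :- (mᴾ y1 q c1 r :* (p :* t1 :- x1) :- mᴾ y2 q c2 r :* (p :* t2 :- x2) :+ (mᴾ c1 r x1 p :* (q :* t1
               :- y1) :- mᴾ c2 r x2 p :* (q :* t2 :- y2))))
            (re (X α)) (s α) (re (X β)) (s β) (s γ) (re t) (re (X γ)) (im (X α)) (im (X β)) (im t) (im (X γ)))
          (solve 11 (λ x1 p y1 q r t2 c2 x2 y2 t1 c1 →
            mᴾ x1 p y1 q :* (r :* t2 :- c2) :+ mᴾ x2 p y2 q :* (r :* t1 :- c1) :=
               :- (mᴾ y1 q c1 r :* (p :* t2 :- x2) :+ mᴾ y2 q c2 r :* (p :* t1 :- x1) :+ (mᴾ c1 r x1 p :* (q :* t2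
               :- y2) :+ mᴾ c2 r x2 p :* (q :* t1 :- y1))))
            (re (X α)) (s α) (re (X β)) (s β) (s γ) (im t) (im (X γ)) (im (X α)) (im (X β)) (re t) (re (X γ))))
        (*-congˡ (∣-z∣²
          (solve 6 (λ x1 q y1 p r c1 →
            (x1 :* q :- y1 :* p) :* r := :- ((y1 :* r :- c1 :* q) :* p :+ (c1 :* p :- x1 :* r) :* q))
            (re (X α)) (s β) (re (X β)) (s α) (s γ) (re (X γ)))
          (solve 6 (λ x1 q y1 p r c1 →
            (x1 :* q :- y1 :* p) :* r := :- ((y1 :* r :- c1 :* q) :* p :+ (c1 :* p :- x1 :* r) :* q))
            (im (X α)) (s β) (im (X β)) (s α) (s γ) (im (X γ))))))
      area : ∣ P₁ *ᶜ Q₂ -ᶜ P₂ *ᶜ Q₁ ∣² ≈ W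
      area = trans (product (minor β γ) (minor γ α) (displacement α t) (displacement β t) (s α) (s β))
        (*-congˡ (∣-z∣²
          (solve 5 (λ p t1 x1 q y1 →
            (p :* t1 :- x1) :* q :- (q :* t1 :- y1) :* p := :- (x1 :* q :- y1 :* p))
            (s α) (re t) (re (X α)) (s β) (re (X β)))
          (solve 5 (λ p t1 x1 q y1 →
            (p :* t1 :- x1) :* q :- (q :* t1 :- y1) :* p := :- (x1 :* q :- y1 :* p))
            (s α) (im t) (im (X α)) (s β) (im (X β)))))
        where
        product : ∀ m n z w p q →
          ∣ (m *ᶜ z) *ᶜ ((re n * q) +i (im n * q)) -ᶜ (n *ᶜ w) *ᶜ ((re m * p) +i (im m * p)) ∣² ≈
          ∣ m ∣² * ∣ n ∣² * ∣ (re z * q - re w * p) +i (im z * q - im w * p) ∣²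
        product (a +i b) (c +i d) (e +i f) (g +i h) p q =
          (solve 10 (λ e q g p f h a b c d →
            let u = e :* q :- g :* p
                v = f :* q :- h :* p
                l = (a :* e :- b :* f) :* (c :* q) :- (a :* f :+ b :* e) :* (d :* q) :- ((c :* g :- d :* h) :* (a :*
                  p) :- (c :* h :+ d :* g) :* (b :* p))
                m = (a :* e :- b :* f) :* (d :* q) :+ (a :* f :+ b :* e) :* (c :* q) :- ((c :* g :- d :* h) :* (b :*
                  p) :+ (c :* h :+ d :* g) :* (a :* p))
            in l :* l :+ m :* m := (a :* a :+ b :* b) :* (c :* c :+ d :* d) :* (u :* u :+ v :* v))
            e q g p f h a b c d)

    distance² : ℂ → ℝ → ℂ → ℝ → ℝ
    distance² t u z v = (re t - re z) * (re t - re z) + (im t - im z) * (im t - im z) + (u - v) * (u - v)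

    module _ (0<S : 0# < S) (z : ℂ) (u₀ : ℝ)
             (S-re : S * re z ≈ X₀) (S-im : S * im z ≈ Y₀) (S-u₀ : S * S * (u₀ * u₀) ≈ 3# * W) where

      -- By `moment`, the choice u₀² = 3 W / S² makes |z|² + u₀² the constant term of the weighted
      -- sum divided by S.
      centre-norm : S * (re z * re z + im z * im z + u₀ * u₀) ≈ w₁ * ∣ X α ∣² + w₂ * ∣ X β ∣² + w₃ * ∣ X γ ∣²
      centre-norm = *-cancelˡ (<⇒≉ 0<S)
        (linear 8 (λ S x y u n X0 Y0 w →
          S :* (S :* (x :* x :+ y :* y :+ u :* u)) := S :* n
          from S :* x :+ X0 ⊛ S :* x := X0
          ⊕ S :* y :+ Y0 ⊛ S :* y := Y0
          ⊕ # 1 ⊛ S :* S :* (u :* u) := w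
          ⊕ :- # 1 ⊛ S :* n := X0 :* X0 :+ Y0 :* Y0 :+ w)
          S (re z) (im z) u₀ (w₁ * ∣ X α ∣² + w₂ * ∣ X β ∣² + w₃ * ∣ X γ ∣²) X₀ Y₀ (3# * W) (S-re , S-im , S-u₀ ,
            moment))

      -- Completing the square gives S (|t - z|² + u² + u₀²), rewritten with (u - u₀)². After
      -- division by u the summand 2 S u u₀ becomes constant, which is why the sum of the Gᵢ / u is
      -- smallest at the centre.
      sum-N : ∀ t u → w₁ * N α t (u * u) + w₂ * N β t (u * u) + w₃ * N γ t (u * u) ≈
                      S * (distance² t u z u₀ + 2# * (u * u₀))
      sum-N t u = trans (split (X α) (X β) (X γ) (s α) (s β) (s γ) w₁ w₂ w₃ t u)
        (linear 10 (λ S t1 t2 u X0 Y0 n x y v →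
          S :* (t1 :* t1 :+ t2 :* t2 :+ u :* u) :- # 2 :* (t1 :* X0 :+ t2 :* Y0) :+ n :=
             S :* ((t1 :- x) :* (t1 :- x) :+ (t2 :- y) :* (t2 :- y) :+ (u :- v) :* (u :- v) :+ # 2 :* (u :* v))
          from # 2 :* t1 ⊛ S :* x := X0
          ⊕ # 2 :* t2 ⊛ S :* y := Y0
          ⊕ :- # 1 ⊛ S :* (x :* x :+ y :* y :+ v :* v) := n)
          S (re t) (im t) u X₀ Y₀ (w₁ * ∣ X α ∣² + w₂ * ∣ X β ∣² + w₃ * ∣ X γ ∣²) (re z) (im z) u₀ (S-re , S-im ,
            centre-norm))
        where
        split : ∀ A B C p q r k l m t u →
          k * (∣ (p * re t - re A) +i (p * im t - im A) ∣² + p * p * (u * u))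
          + l * (∣ (q * re t - re B) +i (q * im t - im B) ∣² + q * q * (u * u))
          + m * (∣ (r * re t - re C) +i (r * im t - im C) ∣² + r * r * (u * u)) ≈
          (k * (p * p) + l * (q * q) + m * (r * r)) * (re t * re t + im t * im t + u * u)
          - 2# * (re t * (k * (p * re A) + l * (q * re B) + m * (r * re C)) + im t * (k * (p * im A) + l * (q * im B) + m * (r * im C)))
          + (k * ∣ A ∣² + l * ∣ B ∣² + m * ∣ C ∣²)
        split (a +i a′) (b +i b′) (c +i c′) p q r k l m (t +i t′) u =
          (solve 15 (λ k p t a t′ a′ u l q b b′ m r c c′ →
            k :* ((p :* t :- a) :* (p :* t :- a) :+ (p :* t′ :- a′) :* (p :* t′ :- a′) :+ p :* p :* (u :* u)) :+ l
               :* ((q :* t :- b) :* (q :* t :- b) :+ (q :* t′ :- b′) :* (q :* t′ :- b′) :+ q :* q :* (u :* u)) :+ m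
               :* ((r :* t :- c) :* (r :* t :- c) :+ (r :* t′ :- c′) :* (r :* t′ :- c′) :+ r :* r :* (u :* u)) :=
               (k :* (p :* p) :+ l :* (q :* q) :+ m :* (r :* r)) :* (t :* t :+ t′ :* t′ :+ u :* u) :- # 2 :* (t :*
               (k :* (p :* a) :+ l :* (q :* b) :+ m :* (r :* c)) :+ t′ :* (k :* (p :* a′) :+ l :* (q :* b′) :+ m :*
               (r :* c′))) :+ (k :* (a :* a :+ a′ :* a′) :+ l :* (b :* b :+ b′ :* b′) :+ m :* (c :* c :+ c′ :* c′)))
            k p t a t′ a′ u l q b b′ m r c c′)

-- The weighted centre as unique minimiser of the energy

module CentreOfMass (R : CompleteOrderedField) (L : NaturalLogarithm R) where
  open CompleteOrderedField R hiding (ring)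
  open NaturalLogarithm L
  open RealAnalysis R
  open T³Model R L
  open OrderedField R
  open Logarithm R L
  open SymmetricInequalities R
  open WeightedConfigurations R

  energyTerm-N : ∀ P q → energyTerm P q ≈ log (N P (t q) (u q * u q) * u q ⁻¹)
  energyTerm-N [ z ] q = log-cong (*-congʳ
    (solve 5 (λ x a y b v →
      (x :- a) :* (x :- a) :+ (y :- b) :* (y :- b) :+ v :* v :=
         (# 1 :* x :- a) :* (# 1 :* x :- a) :+ (# 1 :* y :- b) :* (# 1 :* y :- b) :+ # 1 :* # 1 :* (v :* v))
      (re (t q)) (re z) (im (t q)) (im z) (u q)))
  energyTerm-N ∞     q = log-cong
    (solve 4 (λ j x y v →
      j :=
         ((# 0 :* x :- # 1) :* (# 0 :* x :- # 1) :+ (# 0 :* y :- # 0) :* (# 0 :* y :- # 0) :+ # 0 :* # 0 :* (v :*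
         v)) :* j) (u q ⁻¹) (re (t q)) (im (t q)) (u q))

  module _ (α β γ : ℙ¹) where

    -- The exponential of the energy. Since the logarithm both preserves and reflects the order on
    -- positive elements, the minimisation becomes purely algebraic.
    volume : ℍ₃ → ℝ
    volume q = N α (t q) (u q * u q) * u q ⁻¹ * (N β (t q) (u q * u q) * u q ⁻¹) * (N γ (t q) (u q * u q) * u q ⁻¹)

    0<N/u : ∀ P q → 0# < N P (t q) (u q * u q) * u q ⁻¹
    0<N/u P q = *-pos (0<N P (t q) (*-pos (0<u q) (0<u q))) (0<x⁻¹ (0<u q))

    0<volume : ∀ q → 0# < volume q
    0<volume q = *-pos (*-pos (0<N/u α q) (0<N/u β q)) (0<N/u γ q)

    energy-volume : ∀ q → energy α β γ q ≈ log (volume q)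
    energy-volume q = trans (+-cong (+-cong (energyTerm-N α q) (energyTerm-N β q)) (energyTerm-N γ q))
      (sym (trans (log-* _ _ (*-pos (0<N/u α q) (0<N/u β q)) (0<N/u γ q)) (+-congʳ (log-* _ _ (0<N/u α q) (0<N/u β q)))))

    module _ (0<w₁ : 0# < w₁ α β γ) (0<w₂ : 0# < w₂ α β γ) (0<w₃ : 0# < w₃ α β γ) (0<S : 0# < S α β γ)
             (p : ℍ₃) (S-re : S α β γ * re (t p) ≈ X₀ α β γ) (S-im : S α β γ * im (t p) ≈ Y₀ α β γ)
             (S-u : S α β γ * S α β γ * (u p * u p) ≈ 3# * W α β γ) where

      private
        𝒲 𝒮 : ℝ
        𝒲 = W α β γ
        𝒮 = S α β γ

        0<𝒲 : 0# < 𝒲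
        0<𝒲 = *-pos (*-pos 0<w₁ 0<w₂) 0<w₃

        g₁ g₂ g₃ : ℍ₃ → ℝ
        g₁ q = w₁ α β γ * N α (t q) (u q * u q) * u q ⁻¹
        g₂ q = w₂ α β γ * N β (t q) (u q * u q) * u q ⁻¹
        g₃ q = w₃ α β γ * N γ (t q) (u q * u q) * u q ⁻¹

        0≤g : ∀ {w} P q → 0# < w → 0# ≤ w * N P (t q) (u q * u q) * u q ⁻¹
        0≤g P q 0<w = <⇒≤ (*-pos (*-pos 0<w (0<N P (t q) (*-pos (0<u q) (0<u q)))) (0<x⁻¹ (0<u q)))

        g-volume : ∀ q → g₁ q * g₂ q * g₃ q ≈ 𝒲 * volume q
        g-volume q =
          (solve 7 (λ a n j b m c l →
            a :* n :* j :* (b :* m :* j) :* (c :* l :* j) := a :* b :* c :* (n :* j :* (m :* j) :* (l :* j)))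
            (w₁ α β γ) (N α (t q) (u q * u q)) (u q ⁻¹) (w₂ α β γ) (N β (t q) (u q * u q)) (w₃ α β γ) (N γ (t q) (u
              q * u q)))

        d² : ℍ₃ → ℝ
        d² q = distance² α β γ (t q) (u q) (t p) (u p)

        e₁ : ∀ q → g₁ q + g₂ q + g₃ q ≈ 𝒮 * d² q * u q ⁻¹ + 2# * (𝒮 * u p)
        e₁ q =
          (linear 8 (λ a j b c S e v w →
            a :* j :+ b :* j :+ c :* j := S :* e :* j :+ # 2 :* (S :* v)
            from j ⊛ a :+ b :+ c := S :* (e :+ # 2 :* (w :* v))
            ⊕ # 2 :* (S :* v) ⊛ w :* j := # 1)
            (w₁ α β γ * N α (t q) (u q * u q)) (u q ⁻¹) (w₂ α β γ * N β (t q) (u q * u q)) (w₃ α β γ * N γ (t q) (u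
              q * u q)) 𝒮 (d² q) (u p) (u q) (sum-N α β γ 0<S (t p) (u p) S-re S-im S-u (t q) (u q) , ⁻¹-inverseʳ (u
              q) (<⇒≉ (0<u q))))

        e₂ : ∀ q → 4# * 𝒲 ≤ 4# * (g₁ q * g₂ q + g₂ q * g₃ q + g₃ q * g₁ q) - (g₁ q + g₂ q + g₃ q) * (g₁ q + g₂ q + g₃ q)
        e₂ q = ≤-diff
          (linear 6 (λ a j b c W v →
            # 4 :* (a :* j :* (b :* j) :+ b :* j :* (c :* j) :+ c :* j :* (a :* j)) :- (a :* j :+ b :* j :+ c :* j)
               :* (a :* j :+ b :* j :+ c :* j) :- # 4 :* W :=
               (# 4 :* (a :* b :+ b :* c :+ c :* a) :- (a :+ b :+ c) :* (a :+ b :+ c) :- # 4 :* (W :* (v :* v))) :*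
               (j :* j)
            from # 4 :* W :* (v :* j :+ # 1) ⊛ v :* j := # 1)
            (w₁ α β γ * N α (t q) (u q * u q)) (u q ⁻¹) (w₂ α β γ * N β (t q) (u q * u q)) (w₃ α β γ * N γ (t q) (u
              q * u q)) 𝒲 (u q) (⁻¹-inverseʳ (u q) (<⇒≉ (0<u q))))
          (0≤x*y (x≤y⇒0≤y-x (gram α β γ (t q) (u q * u q))) (0≤x² (u q ⁻¹)))

        -- k is the mean of the three `gᵢ` at p, and 3 k² = 4 W turns `e₂` into exactly the
        -- hypothesis of `schur-lower-bound`.
        module _ {k : ℝ} (3k≈2Su : 3# * k ≈ 2# * (𝒮 * u p)) where
          0<k : 0# < k
          0<k = 0<x*y⇒0<y (0<ι 2) (0<-resp (sym 3k≈2Su) (*-pos (0<ι 1) (*-pos 0<S (0<u p))))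

          3k²≈4W : 3# * (k * k) ≈ 4# * 𝒲
          3k²≈4W = *-cancelˡ (<⇒≉ (0<ι 2))
            (linear 4 (λ k W S v →
              # 3 :* (# 3 :* (k :* k)) := # 3 :* (# 4 :* W)
              from # 3 :* k :+ # 2 :* (S :* v) ⊛ # 3 :* k := # 2 :* (S :* v)
              ⊕ # 4 ⊛ S :* S :* (v :* v) := # 3 :* W) k 𝒲 𝒮 (u p) (3k≈2Su , S-u))

          -- e₁ k² ≤ 3 e₃ ; here e₁ = 3 k + 𝒮 d² / u.
          lower : ∀ q → 3# * k * (k * k) + 𝒮 * d² q * u q ⁻¹ * (k * k) ≤ 3# * (𝒲 * volume q)
          lower q = ≤-trans
            (≤-reflexive (trans
              (linear 4 (λ k e S v →
                # 3 :* k :* (k :* k) :+ e :* (k :* k) := (e :+ # 2 :* (S :* v)) :* (k :* k)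
                from k :* k ⊛ # 3 :* k := # 2 :* (S :* v)) k (𝒮 * d² q * u q ⁻¹) 𝒮 (u p) 3k≈2Su)
              (*-congʳ (sym (e₁ q)))))
            (≤-trans (schur-lower-bound (0≤g α q 0<w₁) (0≤g β q 0<w₂) (0≤g γ q 0<w₃)
                (≤-trans (≤-reflexive 3k²≈4W) (e₂ q)))
              (≤-reflexive (*-congˡ (g-volume q))))

          0≤d² : ∀ q → 0# ≤ d² q
          0≤d² q = 0≤x+y (0≤x+y (0≤x² _) (0≤x² _)) (0≤x² _)

          d²-self : d² p ≈ 0#
          d²-self =
            (solve 3 (λ a b c →
              (a :- a) :* (a :- a) :+ (b :- b) :* (b :- b) :+ (c :- c) :* (c :- c) := # 0)
              (re (t p)) (im (t p)) (u p))

          -- At p the distance term of `e₁` vanishes, so the `gᵢ` have mean k and their product is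
          -- at most k³. This avoids evaluating them one by one.
          volume-self : 𝒲 * volume p ≤ k * k * k
          volume-self = ≤-trans (≤-reflexive (sym (g-volume p)))
            (am-gm₃ (0≤g α p 0<w₁) (0≤g β p 0<w₂) (0≤g γ p 0<w₃)
              (trans (e₁ p)
                (linear 5 (λ S e j v k →
                  S :* e :* j :+ # 2 :* (S :* v) := # 3 :* k
                  from S :* j ⊛ e := # 0
                  ⊕ :- # 1 ⊛ # 3 :* k := # 2 :* (S :* v)) 𝒮 (d² p) (u p ⁻¹) (u p) k (d²-self , 3k≈2Su))))

          0≤Sd²/u : ∀ q → 0# ≤ 𝒮 * d² q * u q ⁻¹
          0≤Sd²/u q = 0≤x*y (0≤x*y (<⇒≤ 0<S) (0≤d² q)) (<⇒≤ (0<x⁻¹ (0<u q)))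

          volume-minimal : ∀ q → volume p ≤ volume q
          volume-minimal q = 0≤y-x⇒x≤y (0≤x*y⇒0≤y (*-pos (0<ι 2) 0<𝒲) (0≤-resp
            (solve 5 (λ k W v0 e v →
              # 3 :* (k :* k :* k :- W :* v0) :+ (e :* (k :* k) :+ (# 3 :* (W :* v) :- (# 3 :* k :* (k :* k) :+ e :*
                 (k :* k)))) :=
                 # 3 :* W :* (v :- v0)) k 𝒲 (volume p) (𝒮 * d² q * u q ⁻¹) (volume q))
            (0≤x+y (0≤x*y (<⇒≤ (0<ι 2)) (x≤y⇒0≤y-x volume-self))
              (0≤x+y (0≤x*y (0≤Sd²/u q) (0≤x² k)) (x≤y⇒0≤y-x (lower q))))))

          -- The surplus 𝒮 d² k² / u in `lower` gives uniqueness: a volume not exceeding that of p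
          -- leaves no room for it.
          minimal⇒d²≈0 : ∀ q → volume q ≤ volume p → d² q ≈ 0#
          minimal⇒d²≈0 q v≤v₀ = *-cancelˡ (<⇒≉ 0<S) (trans (sym Sd²≈0) (sym (zeroʳ 𝒮)))
            where
            0≤-Sd²/u : 0# ≤ k * k * - (𝒮 * d² q * u q ⁻¹)
            0≤-Sd²/u = 0≤-resp
              (solve 5 (λ k W v0 v e →
                # 3 :* (k :* k :* k :- W :* v0) :+ # 3 :* W :* (v0 :- v) :+ (# 3 :* (W :* v) :- (# 3 :* k :* (k :*
                   k) :+ e :* (k :* k))) :=
                   k :* k :* :- e) k 𝒲 (volume p) (volume q) (𝒮 * d² q * u q ⁻¹))
              (0≤x+y (0≤x+y (0≤x*y (<⇒≤ (0<ι 2)) (x≤y⇒0≤y-x volume-self))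
                (0≤x*y (<⇒≤ (*-pos (0<ι 2) 0<𝒲)) (x≤y⇒0≤y-x v≤v₀))) (x≤y⇒0≤y-x (lower q)))
            Sd²/u≈0 : 𝒮 * d² q * u q ⁻¹ ≈ 0#
            Sd²/u≈0 = ≤-antisym (≤-diff (solve 1 (λ e → # 0 :- e := :- e) (𝒮 * d² q * u q ⁻¹))
              (0≤x*y⇒0≤y (*-pos 0<k 0<k) 0≤-Sd²/u)) (0≤Sd²/u q)
            Sd²≈0 : 0# ≈ 𝒮 * d² q
            Sd²≈0 = sym (x*y≈0⇒y≈0 (<⇒≉ (0<x⁻¹ (0<u q))) (trans (*-comm _ _) Sd²/u≈0))

      d²≈0⇒≈ : ∀ q → d² q ≈ 0# → q ≈³ p
      d²≈0⇒≈ q d²≈0 = (close a²≈0 , close b²≈0) , close c²≈0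
        where
        close : ∀ {x y} → (x - y) * (x - y) ≈ 0# → x ≈ y
        close {x} {y} sq = x-y≈0⇒x≈y (x²≈0⇒x≈0 sq)
        ab≈0 = x+y≈0⇒x≈0 (0≤x+y (0≤x² _) (0≤x² _)) (0≤x² _) d²≈0
        a²≈0 = x+y≈0⇒x≈0 (0≤x² _) (0≤x² _) ab≈0
        b²≈0 = x+y≈0⇒x≈0 (0≤x² _) (0≤x² _) (trans (+-comm _ _) ab≈0)
        c²≈0 = x+y≈0⇒x≈0 (0≤x² _) (0≤x+y (0≤x² _) (0≤x² _)) (trans (+-comm _ _) d²≈0)

      isCentreOfMass : IsCenterOfMass α β γ p
      isCentreOfMass = given (quotient (2# * (𝒮 * u p)) (0<ι 2))
        where
        given : ∃[ k ] 3# * k ≈ 2# * (𝒮 * u p) → IsCenterOfMass α β γ p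
        given (k , 3k≈) =
          (λ q → ≤-trans (≤-reflexive (energy-volume p))
            (≤-trans (log-mono-≤ (0<volume p) (volume-minimal 3k≈ q)) (≤-reflexive (sym (energy-volume q))))) ,
          (λ q q-min → d²≈0⇒≈ q (minimal⇒d²≈0 3k≈ q (log-cancel-≤ (0<volume p)
            (≤-trans (≤-reflexive (sym (energy-volume q))) (≤-trans (q-min p) (≤-reflexive (energy-volume p)))))))

-- Attractor equations of a cubic with nonnegative discriminant

module RealRootedCubics (R : CompleteOrderedField) (a b c d : CompleteOrderedField.Carrier R) where
  open CompleteOrderedField R hiding (ring)
  open OrderedField R
  open TaylorCoefficients R a b c d

  -- `H` is the leading coefficient of the Hessian H X² + (b c - 9 a d) X Y + (c² - 3 b d) Y², whose
  -- own discriminant is -3 Δ.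
  H Δ : Carrier
  H = b * b - 3# * a * c
  Δ = b * b * c * c - 4# * (a * c * c * c) - 4# * (b * b * b * d) - 3# * 9# * (a * a * d * d) + 2# * 9# * (a * b * c * d)

  private
    disc : ∀ {n} (a b c d : Polynomial n) → Polynomial n
    disc a b c d = b :* b :* c :* c :- # 4 :* (a :* c :* c :* c) :- # 4 :* (b :* b :* b :* d) :- # 3 :* # 9 :* (a :*
      a :* d :* d) :+ # 2 :* # 9 :* (a :* b :* c :* d)

  -- In the coordinate z = X + i Y centred at x + i √Y the cubic is Re (λ z³ + μ z² z̄) up to scaling,
  -- and the attractor equations say 3 λ μ̄ + μ² = 0. Either μ = 0 or 3 |λ| = |μ|, and in the second
  -- case the discriminant is negative. Here r, s are the components of μ and p, q those of λ.
  private
    μ≈0 : ∀ {A B C D Y} → 0# < Y →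
      0# ≤ B * B * C * C - 4# * (A * C * C * C) - 4# * (B * B * B * D) - 3# * 9# * (A * A * D * D) + 2# * 9# * (A * B * C * D) →
      3# * D * C + 2# * B * C * Y + 3# * A * B * Y * Y ≈ 0# →
      B * B * Y * Y + 9# * A * A * Y * Y * Y - 9# * D * D - C * C * Y ≈ 0# →
      3# * A * Y + C ≈ 0# × B * Y + 3# * D ≈ 0#
    μ≈0 {A} {B} {C} {D} {Y} 0<Y 0≤disc E₁≈0 E₂≈0 =
      x²≈0⇒x≈0 (x*y≈0⇒y≈0 (<⇒≉ 0<Y) (x+y≈0⇒x≈0 (0≤x*y (<⇒≤ 0<Y) (0≤x² _)) (0≤x² _) M≈0)) ,
      x²≈0⇒x≈0 (x+y≈0⇒x≈0 (0≤x² _) (0≤x*y (<⇒≤ 0<Y) (0≤x² _)) (trans (+-comm _ _) M≈0))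
      where
      -- For Taylor coefficients at Re τ and Y = (Im τ)², `Λ` is |Z|² and `M` is 3 g⁻¹ |DZ|². So M =
      -- 0 means DZ = 0, and M = 9 Λ means g⁻¹ |DZ|² = 3 |Z|².
      M Λ : Carrier
      M = Y * ((3# * A * Y + C) * (3# * A * Y + C)) + (B * Y + 3# * D) * (B * Y + 3# * D)
      Λ = Y * ((A * Y - C) * (A * Y - C)) + (D - B * Y) * (D - B * Y)

      dichotomy : M * (M - 9# * Λ) ≈ 0#
      dichotomy =
        (linear 5 (λ A Y C B D →
          let r = # 3 :* A :* Y :+ C
              s = B :* Y :+ # 3 :* D
              p = A :* Y :- C
              q = D :- B :* Y
              M = Y :* (r :* r) :+ s :* s
              Λ = Y :* (p :* p) :+ q :* q
          in M :* (M :- # 9 :* Λ) := # 0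
          from # 2 :* (Y :* r :* r :- s :* s :- # 3 :* (Y :* p :* r :- q :* s)) ⊛ B :* B :* Y :* Y :+ # 9 :* A :* A
             :* Y :* Y :* Y :- # 9 :* D :* D :- C :* C :* Y :=
             # 0
          ⊕ # 4 :* Y :* (# 2 :* r :* s :+ # 3 :* (q :* r :+ p :* s)) ⊛ # 3 :* D :* C :+ # 2 :* B :* C :* Y :+ # 3 :*
             A :* B :* Y :* Y :=
             # 0) A Y C B D (E₂≈0 , E₁≈0))

      -- The conclusion is 12 Y³ disc = -M² up to a factor 16, so a nonnegative discriminant forces
      -- M = 0 in this branch too.
      negative : M - 9# * Λ ≈ 0# →
        3# * 8# * 8# * (Y * Y * Y * (B * B * C * C - 4# * (A * C * C * C) - 4# * (B * B * B * D)
          - 3# * 9# * (A * A * D * D) + 2# * 9# * (A * B * C * D))) + 2# * 8# * (M * M) ≈ 0#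
      negative M≈9Λ =
        (linear 5 (λ A Y C B D →
          let r = # 3 :* A :* Y :+ C
              s = B :* Y :+ # 3 :* D
              p = A :* Y :- C
              q = D :- B :* Y
              M = Y :* (r :* r) :+ s :* s
              Λ = Y :* (p :* p) :+ q :* q
          in # 3 :* # 8 :* # 8 :* (Y :* Y :* Y :* disc A B C D) :+ # 2 :* # 8 :* (M :* M) := # 0
          from # 2 :* # 8 :* (Y :* r :* r :- s :* s) ⊛ B :* B :* Y :* Y :+ # 9 :* A :* A :* Y :* Y :* Y :- # 9 :* D
             :* D :- C :* C :* Y :=
             # 0
          ⊕ # 8 :* # 8 :* Y :* r :* s ⊛ # 3 :* D :* C :+ # 2 :* B :* C :* Y :+ # 3 :* A :* B :* Y :* Y := # 0
          ⊕ # 2 :* # 2 :* M :+ M :- # 9 :* Λ ⊛ M :- # 9 :* Λ := # 0) A Y C B D (E₂≈0 , E₁≈0 , M≈9Λ))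

      M≈0 : M ≈ 0#
      M≈0 = cases (x*y≈0⇒x≈0⊎y≈0 dichotomy)
        where
        cases : M ≈ 0# ⊎ M - 9# * Λ ≈ 0# → M ≈ 0#
        cases (inj₁ M≈0)  = M≈0
        cases (inj₂ M≈9Λ) = x²≈0⇒x≈0 (x*y≈0⇒y≈0 (<⇒≉ (*-pos (0<ι 1) (0<ι 7)))
          (x+y≈0⇒x≈0 (0≤x*y (<⇒≤ (*-pos (0<ι 1) (0<ι 7))) (0≤x² M))
            (0≤x*y (<⇒≤ (*-pos (*-pos (0<ι 2) (0<ι 7)) (0<ι 7))) (0≤x*y (<⇒≤ (*-pos (*-pos 0<Y 0<Y) 0<Y)) 0≤disc))
            (trans (+-comm _ _) (negative M≈9Λ))))

  -- By `μ≈0` the equations reduce to 3 a Y + C = 0 and B Y + 3 D = 0, which make x + i √Y a root of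
  -- the Hessian. The conclusions give its real part and the square of its imaginary part.
  equations⇒hessian : ∀ {x Y} → 0# ≤ Δ → 0# < Y → AttractorEquations x Y →
    2# * H * x ≈ 9# * a * d - b * c × 4# * (H * H) * Y ≈ 3# * Δ
  equations⇒hessian {x} {Y} 0≤Δ 0<Y (E₁≈0 , E₂≈0) =
    let r≈0 , s≈0 = μ≈0 {a} {B x} {C x} {D x} 0<Y (0≤-resp translate 0≤Δ) E₁≈0 E₂≈0
    in solve-x r≈0 s≈0 , solve-Y r≈0 s≈0
    where
    -- The discriminant is invariant under translation, so it may be computed from the Taylor
    -- coefficients at x.
    translate : Δ ≈ B x * B x * C x * C x - 4# * (a * C x * C x * C x) - 4# * (B x * B x * B x * D x)
      - 3# * 9# * (a * a * D x * D x) + 2# * 9# * (a * B x * C x * D x)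
    translate =
      (solve 5 (λ a x b c d →
        let B = # 3 :* a :* x :+ b
            C = (# 3 :* a :* x :+ # 2 :* b) :* x :+ c
            D = ((a :* x :+ b) :* x :+ c) :* x :+ d
        in disc a b c d := disc a B C D) a x b c d)
    solve-x : 3# * a * Y + C x ≈ 0# → B x * Y + 3# * D x ≈ 0# → 2# * H * x ≈ 9# * a * d - b * c
    solve-x r≈0 s≈0 =
      (linear 6 (λ a x b c d Y →
        let B = # 3 :* a :* x :+ b
            C = (# 3 :* a :* x :+ # 2 :* b) :* x :+ c
            D = ((a :* x :+ b) :* x :+ c) :* x :+ d
        in # 2 :* (b :* b :- # 3 :* a :* c) :* x := # 9 :* a :* d :- b :* c
        from b :+ # 3 :* a :* x ⊛ # 3 :* a :* Y :+ C := # 0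
        ⊕ :- (# 3 :* a) ⊛ B :* Y :+ # 3 :* D := # 0) a x b c d Y (r≈0 , s≈0))
    solve-N : 3# * a * Y + C x ≈ 0# → B x * Y + 3# * D x ≈ 0# → 2# * (H * (x * x + Y)) ≈ 2# * (c * c - 3# * b * d)
    solve-N r≈0 s≈0 =
      (linear 6 (λ a x b c d Y →
        let B = # 3 :* a :* x :+ b
            C = (# 3 :* a :* x :+ # 2 :* b) :* x :+ c
            D = ((a :* x :+ b) :* x :+ c) :* x :+ d
        in # 2 :* ((b :* b :- # 3 :* a :* c) :* (x :* x :+ Y)) := # 2 :* (c :* c :- # 3 :* b :* d)
        from :- (# 2 :* c :+ # 2 :* b :* x) ⊛ # 3 :* a :* Y :+ C := # 0
        ⊕ # 2 :* b ⊛ B :* Y :+ # 3 :* D := # 0) a x b c d Y (r≈0 , s≈0))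
    solve-Y : 3# * a * Y + C x ≈ 0# → B x * Y + 3# * D x ≈ 0# → 4# * (H * H) * Y ≈ 3# * Δ
    solve-Y r≈0 s≈0 =
      (linear 6 (λ b a c Y d x →
        let H = b :* b :- # 3 :* a :* c
        in # 4 :* (H :* H) :* Y := # 3 :* disc a b c d
        from # 2 :* H ⊛ # 2 :* (H :* (x :* x :+ Y)) := # 2 :* (c :* c :- # 3 :* b :* d)
        ⊕ :- (# 2 :* H :* x :+ (# 9 :* a :* d :- b :* c)) ⊛ # 2 :* H :* x := # 9 :* a :* d :- b :* c)
        b a c Y d x (solve-N r≈0 s≈0 , solve-x r≈0 s≈0))

  hessian⇒equations : ∀ {x Y} → 0# < H → 2# * H * x ≈ 9# * a * d - b * c → 4# * (H * H) * Y ≈ 3# * Δ →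
    AttractorEquations x Y
  hessian⇒equations {x} {Y} 0<H 2Hx≈ 4H²Y≈ =
    (linear 5 (λ D C B Y a →
      # 3 :* D :* C :+ # 2 :* B :* C :* Y :+ # 3 :* a :* B :* Y :* Y := # 0
      from C ⊛ B :* Y :+ # 3 :* D := # 0
      ⊕ B :* Y ⊛ # 3 :* a :* Y :+ C := # 0) (D x) (C x) (B x) Y a (s≈0 , r≈0)) ,
    (linear 5 (λ B Y a D C →
      B :* B :* Y :* Y :+ # 9 :* a :* a :* Y :* Y :* Y :- # 9 :* D :* D :- C :* C :* Y := # 0
      from B :* Y :- # 3 :* D ⊛ B :* Y :+ # 3 :* D := # 0
      ⊕ Y :* (# 3 :* a :* Y :- C) ⊛ # 3 :* a :* Y :+ C := # 0) (B x) Y a (D x) (C x) (s≈0 , r≈0))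
    where
    0<4H² : 0# < 4# * (H * H)
    0<4H² = *-pos (0<ι 3) (*-pos 0<H 0<H)
    r≈0 : 3# * a * Y + C x ≈ 0#
    r≈0 = x*y≈0⇒y≈0 (<⇒≉ 0<4H²)
      (linear 6 (λ b a c Y x d →
        let H = b :* b :- # 3 :* a :* c
        in # 4 :* (H :* H) :* (# 3 :* a :* Y :+ ((# 3 :* a :* x :+ # 2 :* b) :* x :+ c)) := # 0
        from # 3 :* a ⊛ # 4 :* (H :* H) :* Y := # 3 :* disc a b c d
        ⊕ # 3 :* a :* (# 2 :* H :* x :+ (# 9 :* a :* d :- b :* c)) :+ # 4 :* b :* H ⊛ # 2 :* H :* x :=
           # 9 :* a :* d :- b :* c) b a c Y x d (4H²Y≈ , 2Hx≈))
    s≈0 : B x * Y + 3# * D x ≈ 0#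
    s≈0 = x*y≈0⇒y≈0 (<⇒≉ 0<4H²)
      (linear 6 (λ b a c x Y d →
        let H = b :* b :- # 3 :* a :* c
        in # 4 :* (H :* H) :* ((# 3 :* a :* x :+ b) :* Y :+ # 3 :* (((a :* x :+ b) :* x :+ c) :* x :+ d)) := # 0
        from # 4 :* (H :* H) :* x ⊛ # 3 :* a :* Y :+ ((# 3 :* a :* x :+ # 2 :* b) :* x :+ c) := # 0
        ⊕ b ⊛ # 4 :* (H :* H) :* Y := # 3 :* disc a b c d
        ⊕ b :* (# 2 :* H :* x :+ (# 9 :* a :* d :- b :* c)) :+ # 4 :* c :* H ⊛ # 2 :* H :* x :=
           # 9 :* a :* d :- b :* c) b a c x Y d (r≈0 , 4H²Y≈ , 2Hx≈))

-- Attractor equations of a cubic with one real and two conjugate roots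

-- Taylor coefficients of (s X − ρ Y) ((X − p Y)² + q² Y²) at x, in terms of m = ρ − s x, n = p − x and Q = q².
module ComplexRootedCubics (R : CompleteOrderedField) where
  open CompleteOrderedField R hiding (ring)
  open OrderedField R

  module _ (s m n Q Y : Carrier) where
    -- `k` equals ρ - s p and so does not vary with x; `d` is the weight carried by each of the
    -- conjugate roots, and `T` is half of S.
    B C D E₁ E₂ k d T : Carrier
    B  = - (m + 2# * n * s)
    C  = 2# * m * n + s * (n * n + Q)
    D  = - (m * (n * n + Q))
    E₁ = 3# * D * C + 2# * B * C * Y + 3# * s * B * Y * Y
    E₂ = B * B * Y * Y + 9# * s * s * Y * Y * Y - 9# * D * D - C * C * Y
    k  = m - s * n
    d  = k * k + Q * (s * s)
    T  = 2# * Q * (s * s) + d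

    module _ (0<Q : 0# < Q) (0<Y : 0# < Y) (0<T : 0# < T) where
      private
        -- After scaling by √Y the real root has coordinate z = m + i s √Y; then `N` is |z|² and `ν`
        -- is 4 Im (μ z). `V` is the denominator that appears on solving for the conjugate roots.
        N V ν : Carrier
        N = s * s * Y + m * m
        V = s * s * Y + 3# * (m * m)
        ν = (3# * s * Y + C) * s * Y + (3# * (m * (n * n + Q)) + (m + 2# * n * s) * Y) * m

        0<N : 0# < N
        0<N = positive (0≤x+y (0≤x*y (0≤x² s) (<⇒≤ 0<Y)) (0≤x² m))
          where
          positive : 0# ≤ N → 0# < N
          positive (inj₁ 0<N) = 0<N
          positive (inj₂ 0≈N) = ⊥-elim (<⇒≉ 0<T
            (linear 4 (λ Q s m n →
              # 2 :* Q :* (s :* s) :+ ((m :- s :* n) :* (m :- s :* n) :+ Q :* (s :* s)) := # 0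
              from # 2 :* Q :* s :+ Q :* s :+ n :* n :* s :- # 2 :* m :* n ⊛ s := # 0
              ⊕ m ⊛ m := # 0) Q s m n (s≈0 , m≈0)))
            where
            m≈0 : m ≈ 0#
            m≈0 = x²≈0⇒x≈0 (x+y≈0⇒x≈0 (0≤x² m) (0≤x*y (0≤x² s) (<⇒≤ 0<Y)) (trans (+-comm _ _) (sym 0≈N)))
            s≈0 : s ≈ 0#
            s≈0 = x²≈0⇒x≈0 (x*y≈0⇒y≈0 (<⇒≉ 0<Y)
              (trans (*-comm Y (s * s)) (x+y≈0⇒x≈0 (0≤x*y (0≤x² s) (<⇒≤ 0<Y)) (0≤x² m) (sym 0≈N))))

        0<V : 0# < V
        0<V = 0<-resp
          (solve 3 (λ s Y m →
            s :* s :* Y :+ m :* m :+ # 2 :* (m :* m) := s :* s :* Y :+ # 3 :* (m :* m)) s Y m)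
          (0<x+y 0<N (0≤x*y (<⇒≤ (0<ι 1)) (0≤x² m)))

        -- An explicit sum of nonnegative terms whose first term N Y is positive. It rules out the
        -- branch μ = 0 and makes the second factor in `ω-cubic` strictly positive.
        0<ν : 0# < ν
        0<ν = 0<-resp
          (solve 5 (λ s Y m n Q →
            (s :* s :* Y :+ m :* m) :* Y :+ (# 2 :* ((m :* n :+ s :* Y) :* (m :* n :+ s :* Y)) :+ (m :* n :* (m :*
               n) :+ Y :* (s :* n :* (s :* n))) :+ Q :* (s :* s :* Y :+ m :* m :+ # 2 :* (m :* m))) :=
               (# 3 :* s :* Y :+ (# 2 :* m :* n :+ s :* (n :* n :+ Q))) :* s :* Y :+ (# 3 :* (m :* (n :* n :+ Q)) :+
               (m :+ # 2 :* n :* s) :* Y) :* m) s Y m n Q)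
          (0<x+y (*-pos 0<N 0<Y) (0≤x+y (0≤x+y (0≤x*y (<⇒≤ (0<ι 1)) (0≤x² _))
            (0≤x+y (0≤x² _) (0≤x*y (<⇒≤ 0<Y) (0≤x² _))))
            (0≤x*y (<⇒≤ 0<Q) (0≤x+y (<⇒≤ 0<N) (0≤x*y (<⇒≤ (0<ι 1)) (0≤x² m))))))

      -- The real root of the cubic is the zero of Re (μ z): with ω = μ z evaluated at that root,
      -- the attractor equations give 2 Re ω (Re ω² + 3 Im ω²) = 0.
      module _ (E₁≈0 : E₁ ≈ 0#) (E₂≈0 : E₂ ≈ 0#) where
        private
          Reω : Carrier
          Reω = (3# * s * Y + C) * m + (B * Y + 3# * D) * s

          -- Put λ = -μ² / (3 μ̄) into Re (λ z³ + μ z² z̄) = 0 and multiply by 3 |μ|²: this gives 3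
          -- |ω|² Re ω - Re (ω³) = 0, and the left side is 2 Re ω (Re ω² + 3 Im ω²).
          ω-cubic : Reω * (Y * (Reω * Reω) + 3# * (ν * ν)) ≈ 0#
          ω-cubic =
            (linear 5 (λ m n s Q Y →
              let B = :- (m :+ # 2 :* n :* s)
                  C = # 2 :* m :* n :+ s :* (n :* n :+ Q)
                  D = :- (m :* (n :* n :+ Q))
                  E1 = # 3 :* D :* C :+ # 2 :* B :* C :* Y :+ # 3 :* s :* B :* Y :* Y
                  E2 = B :* B :* Y :* Y :+ # 9 :* s :* s :* Y :* Y :* Y :- # 9 :* D :* D :- C :* C :* Y
                  ω = (# 3 :* s :* Y :+ C) :* m :+ (B :* Y :+ # 3 :* D) :* s
                  ν = (# 3 :* s :* Y :+ C) :* s :* Y :+ (# 3 :* (m :* (n :* n :+ Q)) :+ (m :+ # 2 :* n :* s) :* Y)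
                    :* m
              in ω :* (Y :* (ω :* ω) :+ # 3 :* (ν :* ν)) := # 0
              from :- (ω :* (m :* m :- s :* s :* Y) :- # 2 :* m :* s :* ν) ⊛ E2 := # 0
              ⊕ :- (# 2 :* (# 2 :* m :* s :* Y :* ω :+ ν :* (m :* m :- s :* s :* Y))) ⊛ E1 := # 0)
              m n s Q Y (E₂≈0 , E₁≈0))

          Reω≈0 : Reω ≈ 0#
          Reω≈0 = x*y≈0⇒y≈0
            (<⇒≉ (0<-resp (+-comm (3# * (ν * ν)) (Y * (Reω * Reω)))
              (0<x+y (*-pos (0<ι 2) (*-pos 0<ν 0<ν)) (0≤x*y (<⇒≤ 0<Y) (0≤x² Reω)))))
            (trans (*-comm _ _) ω-cubic)

          -- Since Re ω = 0, the components (3 s Y + C, B Y + 3 D) of μ are orthogonal to (m, s),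
          -- hence proportional to (s, -m); the factor is ν / N.
          μ-re : N * (3# * s * Y + C) ≈ s * ν
          μ-re =
            (linear 6 (λ s Y m C n Q →
              (s :* s :* Y :+ m :* m) :* (# 3 :* s :* Y :+ C) :=
                 s :* ((# 3 :* s :* Y :+ C) :* s :* Y :+ (# 3 :* (m :* (n :* n :+ Q)) :+ (m :+ # 2 :* n :* s) :* Y)
                 :* m)
              from m ⊛ (# 3 :* s :* Y :+ C) :* m :+ (:- (m :+ # 2 :* n :* s) :* Y :+ # 3 :* :- (m :* (n :* n :+ Q)))
                 :* s :=
                 # 0) s Y m C n Q Reω≈0)

          μ-im : N * (B * Y + 3# * D) ≈ - (m * ν)
          μ-im =
            (linear 6 (λ m n s Q Y C →
              let B = :- (m :+ # 2 :* n :* s)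
                  D = :- (m :* (n :* n :+ Q))
              in (s :* s :* Y :+ m :* m) :* (B :* Y :+ # 3 :* D) :=
                 :- (m :* ((# 3 :* s :* Y :+ C) :* s :* Y :+ (# 3 :* (m :* (n :* n :+ Q)) :+ (m :+ # 2 :* n :* s) :*
                 Y) :* m))
              from s :* Y ⊛ (# 3 :* s :* Y :+ C) :* m :+ (B :* Y :+ # 3 :* D) :* s := # 0) m n s Q Y C Reω≈0)

          -- With μ known up to the factor ν, dividing E₁ and E₂ by multiples of ν leaves relations
          -- linear in ν, n and n² + Q. The definition of ν supplies the third one, `ν-equation`, so
          -- all three become rational functions of s, m, Y with denominator V.
          n-equation : 3# * n * (N * N) ≈ - (ν * s * m)
          n-equation = *-cancelˡ (<⇒≉ (*-pos (0<ι 1) 0<ν))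
            (linear 6 (λ s Y m n Q ν →
              let N = s :* s :* Y :+ m :* m
                  B = :- (m :+ # 2 :* n :* s)
                  C = # 2 :* m :* n :+ s :* (n :* n :+ Q)
                  D = :- (m :* (n :* n :+ Q))
              in # 2 :* ν :* (# 3 :* n :* (N :* N)) := # 2 :* ν :* :- (ν :* s :* m)
              from :- (# 4 :* N :* N) ⊛ # 3 :* D :* C :+ # 2 :* B :* C :* Y :+ # 3 :* s :* B :* Y :* Y := # 0
              ⊕ :- (# 3 :* N :* (D :- B :* Y) :- # 2 :* (N :* (B :* Y :+ # 3 :* D))) ⊛ N :* (# 3 :* s :* Y :+ C) :=
                 s :* ν
              ⊕ :- (# 3 :* N :* (s :* Y :- C) :- # 2 :* (s :* ν)) ⊛ N :* (B :* Y :+ # 3 :* D) := :- (m :* ν))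
              s Y m n Q ν (E₁≈0 , μ-re , μ-im))

          σ-equation : 3# * (Y - (n * n + Q)) * (N * N) ≈ - (ν * (s * s * Y - m * m))
          σ-equation = *-cancelˡ (<⇒≉ 0<ν)
            (linear 6 (λ s Y m n Q ν →
              let N = s :* s :* Y :+ m :* m
                  B = :- (m :+ # 2 :* n :* s)
                  C = # 2 :* m :* n :+ s :* (n :* n :+ Q)
                  D = :- (m :* (n :* n :+ Q))
              in ν :* (# 3 :* (Y :- (n :* n :+ Q)) :* (N :* N)) := ν :* :- (ν :* (s :* s :* Y :- m :* m))
              from # 2 :* N :* N ⊛ B :* B :* Y :* Y :+ # 9 :* s :* s :* Y :* Y :* Y :- # 9 :* D :* D :- C :* C :* Y
                 :=
                 # 0
              ⊕ :- (# 3 :* N :* Y :* (s :* Y :- C) :+ Y :* (N :* (# 3 :* s :* Y :+ C) :+ s :* ν)) ⊛ N :* (# 3 :* s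
                 :* Y :+ C) :=
                 s :* ν
              ⊕ # 3 :* N :* (D :- B :* Y) :+ (N :* (B :* Y :+ # 3 :* D) :- m :* ν) ⊛ N :* (B :* Y :+ # 3 :* D) :=
                 :- (m :* ν)) s Y m n Q ν (E₂≈0 , μ-re , μ-im))

          ν-equation : ν * V ≈ 2# * 3# * Y * (N * N)
          ν-equation = *-cancelˡ (<⇒≉ (*-pos (0<ι 1) 0<N))
            (linear 5 (λ s Y m n Q →
              let N = s :* s :* Y :+ m :* m
                  V = s :* s :* Y :+ # 3 :* (m :* m)
                  C = # 2 :* m :* n :+ s :* (n :* n :+ Q)
                  ν = (# 3 :* s :* Y :+ C) :* s :* Y :+ (# 3 :* (m :* (n :* n :+ Q)) :+ (m :+ # 2 :* n :* s) :* Y)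
                    :* m
              in # 2 :* N :* (ν :* V) := # 2 :* N :* (# 2 :* # 3 :* Y :* (N :* N))
              from # 4 :* m :* s :* Y ⊛ # 3 :* n :* (N :* N) := :- (ν :* s :* m)
              ⊕ :- V ⊛ # 3 :* (Y :- (n :* n :+ Q)) :* (N :* N) := :- (ν :* (s :* s :* Y :- m :* m)))
              s Y m n Q (n-equation , σ-equation))

          nV : n * V ≈ - (2# * s * m * Y)
          nV = *-cancelˡ (<⇒≉ (*-pos (0<ι 2) (*-pos 0<N 0<N)))
            (linear 7 (λ N n V s m Y ν →
              # 3 :* (N :* N) :* (n :* V) := # 3 :* (N :* N) :* :- (# 2 :* s :* m :* Y)
              from V ⊛ # 3 :* n :* (N :* N) := :- (ν :* s :* m)
              ⊕ :- (s :* m) ⊛ ν :* V := # 2 :* # 3 :* Y :* (N :* N)) N n V s m Y ν (n-equation , ν-equation))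

          σV : (n * n + Q) * V ≈ Y * (3# * (s * s * Y) + m * m)
          σV = *-cancelˡ (<⇒≉ (*-pos (0<ι 2) (*-pos 0<N 0<N)))
            (linear 7 (λ s Y m N n Q ν →
              let V = s :* s :* Y :+ # 3 :* (m :* m)
              in # 3 :* (N :* N) :* ((n :* n :+ Q) :* V) := # 3 :* (N :* N) :* (Y :* (# 3 :* (s :* s :* Y) :+ m :*
                 m))
              from :- V ⊛ # 3 :* (Y :- (n :* n :+ Q)) :* (N :* N) := :- (ν :* (s :* s :* Y :- m :* m))
              ⊕ s :* s :* Y :- m :* m ⊛ ν :* V := # 2 :* # 3 :* Y :* (N :* N))
              s Y m N n Q ν (σ-equation , ν-equation))

          QV² : V * V * Q ≈ 3# * Y * (N * N)
          QV² =
            (linear 5 (λ s Y m Q n →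
              let N = s :* s :* Y :+ m :* m
                  V = s :* s :* Y :+ # 3 :* (m :* m)
              in V :* V :* Q := # 3 :* Y :* (N :* N)
              from V ⊛ (n :* n :+ Q) :* V := Y :* (# 3 :* (s :* s :* Y) :+ m :* m)
              ⊕ :- (n :* V :- # 2 :* s :* m :* Y) ⊛ n :* V := :- (# 2 :* s :* m :* Y)) s Y m Q n (σV , nV))

          kV : V * k ≈ 3# * m * N
          kV =
            (linear 4 (λ s Y m n →
              let V = s :* s :* Y :+ # 3 :* (m :* m)
              in V :* (m :- s :* n) := # 3 :* m :* (s :* s :* Y :+ m :* m)
              from :- s ⊛ n :* V := :- (# 2 :* s :* m :* Y)) s Y m n nV)

          dV : V * d ≈ 3# * (N * N)
          dV = *-cancelˡ (<⇒≉ 0<V)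
            (linear 6 (λ s Y m k Q N →
              let V = s :* s :* Y :+ # 3 :* (m :* m)
              in V :* (V :* (k :* k :+ Q :* (s :* s))) := V :* (# 3 :* (N :* N))
              from V :* k :+ # 3 :* m :* N ⊛ V :* k := # 3 :* m :* N
              ⊕ s :* s ⊛ V :* V :* Q := # 3 :* Y :* (N :* N)) s Y m k Q N (kV , QV²))

          TV² : V * V * T ≈ 9# * (N * N * N)
          TV² =
            (linear 5 (λ s Y m Q d →
              let N = s :* s :* Y :+ m :* m
                  V = s :* s :* Y :+ # 3 :* (m :* m)
              in V :* V :* (# 2 :* Q :* (s :* s) :+ d) := # 9 :* (N :* N :* N)
              from # 2 :* (s :* s) ⊛ V :* V :* Q := # 3 :* Y :* (N :* N)
              ⊕ V ⊛ V :* d := # 3 :* (N :* N)) s Y m Q d (QV² , dV))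

        -- After multiplication by V³ both sides equal -18 s m Y N³.
        equations⇒n : T * n ≈ - (2# * Q * s * k)
        equations⇒n = *-cancelˡ (<⇒≉ (*-pos (*-pos 0<V 0<V) 0<V))
          (linear 9 (λ V T n Q s k N m Y →
            V :* V :* V :* (T :* n) := V :* V :* V :* :- (# 2 :* Q :* s :* k)
            from V :* n ⊛ V :* V :* T := # 9 :* (N :* N :* N)
            ⊕ # 9 :* (N :* N :* N) ⊛ n :* V := :- (# 2 :* s :* m :* Y)
            ⊕ # 2 :* s :* k :* V ⊛ V :* V :* Q := # 3 :* Y :* (N :* N)
            ⊕ # 2 :* s :* (# 3 :* Y :* (N :* N)) ⊛ V :* k := # 3 :* m :* N) V T n Q s k N m Y (TV² , nV , QV² , kV))

        equations⇒Y : T * T * Y ≈ 3# * Q * (d * d)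
        equations⇒Y = *-cancelˡ (<⇒≉ (*-pos (*-pos 0<V 0<V) (*-pos 0<V 0<V)))
          (linear 6 (λ V T Y Q d N →
            V :* V :* (V :* V) :* (T :* T :* Y) := V :* V :* (V :* V) :* (# 3 :* Q :* (d :* d))
            from Y :* (V :* V :* T :+ # 9 :* (N :* N :* N)) ⊛ V :* V :* T := # 9 :* (N :* N :* N)
            ⊕ :- (# 3 :* (V :* d) :* (V :* d)) ⊛ V :* V :* Q := # 3 :* Y :* (N :* N)
            ⊕ :- (# 9 :* Y :* (N :* N) :* (V :* d :+ # 3 :* (N :* N))) ⊛ V :* d := # 3 :* (N :* N))
            V T Y Q d N (TV² , QV² , dV))

      module _ (Tn≈ : T * n ≈ - (2# * Q * s * k)) (T²Y≈ : T * T * Y ≈ 3# * Q * (d * d)) where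
        private
          -- The converse direction starts from m = k d / T and V = 3 d³ / T², which recover the
          -- same expressions for n and n² + Q over V. Then V B and V C acquire the common factor s²
          -- Y - m², and E₁, E₂ vanish after multiplication by V².
          Tm : T * m ≈ k * d
          Tm =
            (linear 4 (λ Q s m n →
              let T = # 2 :* Q :* (s :* s) :+ ((m :- s :* n) :* (m :- s :* n) :+ Q :* (s :* s))
              in T :* m := (m :- s :* n) :* ((m :- s :* n) :* (m :- s :* n) :+ Q :* (s :* s))
              from s ⊛ T :* n := :- (# 2 :* Q :* s :* (m :- s :* n))) Q s m n Tn≈)

          T²V : T * T * V ≈ 3# * (d * d * d)
          T²V =
            (linear 6 (λ k Q s T Y m →
              let d = k :* k :+ Q :* (s :* s)
              in T :* T :* (s :* s :* Y :+ # 3 :* (m :* m)) := # 3 :* (d :* d :* d)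
              from s :* s ⊛ T :* T :* Y := # 3 :* Q :* (d :* d)
              ⊕ # 3 :* (T :* m :+ k :* d) ⊛ T :* m := k :* d) k Q s T Y m (T²Y≈ , Tm))

          nV : n * V ≈ - (2# * s * m * Y)
          nV = *-cancelˡ (<⇒≉ (*-pos (*-pos 0<T 0<T) 0<T))
            (linear 9 (λ T n V s m Y Q k d →
              T :* T :* T :* (n :* V) := T :* T :* T :* :- (# 2 :* s :* m :* Y)
              from T :* T :* V ⊛ T :* n := :- (# 2 :* Q :* s :* k)
              ⊕ :- (# 2 :* Q :* s :* k) ⊛ T :* T :* V := # 3 :* (d :* d :* d)
              ⊕ # 2 :* s :* (T :* T :* Y) ⊛ T :* m := k :* d
              ⊕ # 2 :* s :* k :* d ⊛ T :* T :* Y := # 3 :* Q :* (d :* d)) T n V s m Y Q k d (Tn≈ , T²V , Tm , T²Y≈))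

          σV : (n * n + Q) * V ≈ Y * (3# * (s * s * Y) + m * m)
          σV = *-cancelˡ (<⇒≉ (*-pos (*-pos 0<T 0<T) (*-pos 0<T 0<T)))
            (linear 7 (λ k Q s n V Y m →
              let d = k :* k :+ Q :* (s :* s)
                  T = # 2 :* Q :* (s :* s) :+ d
              in T :* T :* (T :* T) :* ((n :* n :+ Q) :* V) :=
                 T :* T :* (T :* T) :* (Y :* (# 3 :* (s :* s :* Y) :+ m :* m))
              from (T :* n :- # 2 :* Q :* s :* k) :* (T :* T :* V) ⊛ T :* n := :- (# 2 :* Q :* s :* k)
              ⊕ # 4 :* Q :* Q :* s :* s :* k :* k :+ T :* T :* Q ⊛ T :* T :* V := # 3 :* (d :* d :* d)
              ⊕ :- (# 3 :* (s :* s) :* (T :* T :* Y :+ # 3 :* Q :* (d :* d)) :+ k :* d :* (k :* d)) ⊛ T :* T :* Y :=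
                 # 3 :* Q :* (d :* d)
              ⊕ :- (T :* T :* Y :* (T :* m :+ k :* d)) ⊛ T :* m := k :* d) k Q s n V Y m (Tn≈ , T²V , T²Y≈ , Tm))

          BV : V * B ≈ 3# * m * (s * s * Y - m * m)
          BV =
            (linear 4 (λ s Y m n →
              let V = s :* s :* Y :+ # 3 :* (m :* m)
              in V :* :- (m :+ # 2 :* n :* s) := # 3 :* m :* (s :* s :* Y :- m :* m)
              from :- (# 2 :* s) ⊛ n :* V := :- (# 2 :* s :* m :* Y)) s Y m n nV)

          CV : V * C ≈ 3# * s * Y * (s * s * Y - m * m)
          CV =
            (linear 6 (λ V m n s Q Y →
              V :* (# 2 :* m :* n :+ s :* (n :* n :+ Q)) := # 3 :* s :* Y :* (s :* s :* Y :- m :* m)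
              from # 2 :* m ⊛ n :* V := :- (# 2 :* s :* m :* Y)
              ⊕ s ⊛ (n :* n :+ Q) :* V := Y :* (# 3 :* (s :* s :* Y) :+ m :* m)) V m n s Q Y (nV , σV))

          DV : V * D ≈ - (m * Y * (3# * (s * s * Y) + m * m))
          DV =
            (linear 6 (λ V m n Q Y s →
              V :* :- (m :* (n :* n :+ Q)) := :- (m :* Y :* (# 3 :* (s :* s :* Y) :+ m :* m))
              from :- m ⊛ (n :* n :+ Q) :* V := Y :* (# 3 :* (s :* s :* Y) :+ m :* m)) V m n Q Y s σV)

        centre⇒E₁ : E₁ ≈ 0#
        centre⇒E₁ = x*y≈0⇒y≈0 (<⇒≉ (*-pos 0<V 0<V))
          (linear 6 (λ s Y m D C B →
            let V = s :* s :* Y :+ # 3 :* (m :* m)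
            in V :* V :* (# 3 :* D :* C :+ # 2 :* B :* C :* Y :+ # 3 :* s :* B :* Y :* Y) := # 0
            from # 3 :* (V :* C) ⊛ V :* D := :- (m :* Y :* (# 3 :* (s :* s :* Y) :+ m :* m))
            ⊕ :- (# 3 :* m :* Y :* (# 3 :* (s :* s :* Y) :+ m :* m)) :+ # 2 :* (V :* B) :* Y ⊛ V :* C :=
               # 3 :* s :* Y :* (s :* s :* Y :- m :* m)
            ⊕ # 2 :* Y :* (# 3 :* s :* Y :* (s :* s :* Y :- m :* m)) :+ # 3 :* s :* V :* Y :* Y ⊛ V :* B :=
               # 3 :* m :* (s :* s :* Y :- m :* m)) s Y m D C B (DV , CV , BV))

        centre⇒E₂ : E₂ ≈ 0#
        centre⇒E₂ = x*y≈0⇒y≈0 (<⇒≉ (*-pos 0<V 0<V))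
          (linear 6 (λ s Y m B D C →
            let V = s :* s :* Y :+ # 3 :* (m :* m)
            in V :* V :* (B :* B :* Y :* Y :+ # 9 :* s :* s :* Y :* Y :* Y :- # 9 :* D :* D :- C :* C :* Y) := # 0
            from :- (# 9 :* (V :* D :- m :* Y :* (# 3 :* (s :* s :* Y) :+ m :* m))) ⊛ V :* D :=
               :- (m :* Y :* (# 3 :* (s :* s :* Y) :+ m :* m))
            ⊕ :- (Y :* (V :* C :+ # 3 :* s :* Y :* (s :* s :* Y :- m :* m))) ⊛ V :* C :=
               # 3 :* s :* Y :* (s :* s :* Y :- m :* m)
            ⊕ Y :* Y :* (V :* B :+ # 3 :* m :* (s :* s :* Y :- m :* m)) ⊛ V :* B :=
               # 3 :* m :* (s :* s :* Y :- m :* m)) s Y m B D C (DV , CV , BV))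

-- Factorization over the roots, and the pattern of real and conjugate roots

module Factorizations (R : CompleteOrderedField) where
  open CompleteOrderedField R hiding (ring)
  open RealAnalysis R
  open OrderedField R
  open WeightedConfigurations R

  x²+y²≈0⇒≈0 : ∀ {x y} → x * x + y * y ≈ 0# → x ≈ 0# × y ≈ 0#
  x²+y²≈0⇒≈0 {x} {y} eq =
    x²≈0⇒x≈0 (x+y≈0⇒x≈0 (0≤x² x) (0≤x² y) eq) , x²≈0⇒x≈0 (x+y≈0⇒x≈0 (0≤x² y) (0≤x² x) (trans (+-comm _ _) eq))

  ∣z∣²-positive : ∀ z → ¬ (z ≈ᶜ 0ᶜ) → 0# < ∣ z ∣²
  ∣z∣²-positive z z≉0 = cases (0≤∣z∣² z)
    where
    cases : 0# ≤ ∣ z ∣² → 0# < ∣ z ∣²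
    cases (inj₁ 0<n) = 0<n
    cases (inj₂ 0≈n) = ⊥-elim (z≉0 (x²+y²≈0⇒≈0 (sym 0≈n)))

  *ᶜ-cancel : ∀ z w → ¬ (z ≈ᶜ 0ᶜ) → z *ᶜ w ≈ᶜ 0ᶜ → w ≈ᶜ 0ᶜ
  *ᶜ-cancel (a +i b) (c +i d) z≉0 (re≈0 , im≈0) =
    x*y≈0⇒y≈0 (<⇒≉ (∣z∣²-positive (a +i b) z≉0))
      (linear 4 (λ a b c d →
        (a :* a :+ b :* b) :* c := # 0
        from a ⊛ a :* c :- b :* d := # 0
        ⊕ b ⊛ a :* d :+ b :* c := # 0) a b c d (re≈0 , im≈0)) ,
    x*y≈0⇒y≈0 (<⇒≉ (∣z∣²-positive (a +i b) z≉0))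
      (linear 4 (λ a b d c →
        (a :* a :+ b :* b) :* d := # 0
        from :- b ⊛ a :* c :- b :* d := # 0
        ⊕ a ⊛ a :* d :+ b :* c := # 0) a b d c (re≈0 , im≈0))

  *ᶜ-zero-product : ∀ z w → z *ᶜ w ≈ᶜ 0ᶜ → z ≈ᶜ 0ᶜ ⊎ w ≈ᶜ 0ᶜ
  *ᶜ-zero-product z w zw≈0 = cases (re z ≈? 0#) (im z ≈? 0#)
    where
    cases : Dec (re z ≈ 0#) → Dec (im z ≈ 0#) → z ≈ᶜ 0ᶜ ⊎ w ≈ᶜ 0ᶜ
    cases (yes re≈0) (yes im≈0) = inj₁ (re≈0 , im≈0)
    cases (no re≉0)  _          = inj₂ (*ᶜ-cancel z w (λ z≈0 → re≉0 (proj₁ z≈0)) zw≈0)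
    cases _          (no im≉0)  = inj₂ (*ᶜ-cancel z w (λ z≈0 → im≉0 (proj₂ z≈0)) zw≈0)

  ≈ᴾ-sym : ∀ {P Q} → P ≈ᴾ Q → Q ≈ᴾ P
  ≈ᴾ-sym {[ _ ]} {[ _ ]} (p , q) = sym p , sym q
  ≈ᴾ-sym {∞}     {∞}     _       = tt

  0<weight : ∀ P Q → ¬ (P ≈ᴾ Q) → 0# < weight P Q
  0<weight [ z ] [ w ] P≉Q = ∣z∣²-positive (minor [ z ] [ w ]) λ { (p , q) → P≉Q
    (
      (linear 2 (λ x y →
        x := y
        from # 1 ⊛ x :* # 1 :- y :* # 1 := # 0) (re z) (re w) p) ,
     (linear 2 (λ x y → x := y from # 1 ⊛ x :* # 1 :- y :* # 1 := # 0) (im z) (im w) q)) }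
  0<weight [ z ] ∞     _   = ∣z∣²-positive (minor [ z ] ∞) λ { (p , _) →
    <⇒≉ 0<1
      (linear 1 (λ x →
        # 1 := # 0
        from :- # 1 ⊛ x :* # 0 :- # 1 :* # 1 := # 0) (re z) p) }
  0<weight ∞     [ w ] _   = ∣z∣²-positive (minor ∞ [ w ]) λ { (p , _) →
    <⇒≉ 0<1
      (linear 1 (λ x →
        # 1 := # 0
        from # 1 ⊛ # 1 :* # 1 :- x :* # 0 := # 0) (re w) p) }
  0<weight ∞     ∞     P≉Q = ⊥-elim (P≉Q tt)

  σ₁ σ₂ σ₃ : ℙ¹ → ℙ¹ → ℙ¹ → ℂ
  σ₁ P Q O = (re (X P) * (s Q * s O) + re (X Q) * (s O * s P) + re (X O) * (s P * s Q))
          +i (im (X P) * (s Q * s O) + im (X Q) * (s O * s P) + im (X O) * (s P * s Q))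
  σ₂ P Q O = (re (X P *ᶜ X Q) * s O + re (X Q *ᶜ X O) * s P + re (X O *ᶜ X P) * s Q)
          +i (im (X P *ᶜ X Q) * s O + im (X Q *ᶜ X O) * s P + im (X O *ᶜ X P) * s Q)
  σ₃ P Q O = X P *ᶜ X Q *ᶜ X O

  -- a T³ + b T² U + c T U² + d U³ = κ ∏ (s P · T − X P · U).
  record Factorization (a b c d : ℝ) (P Q O : ℙ¹) : Set where
    field
      κ     : ℝ
      κ≉0   : ¬ (κ ≈ 0#)
      a≈    : a ≈ κ * (s P * s Q * s O)
      b≈    : b ≈ - (κ * re (σ₁ P Q O))
      c≈    : c ≈ κ * re (σ₂ P Q O)
      d≈    : d ≈ - (κ * re (σ₃ P Q O))
      σ₁-im : im (σ₁ P Q O) ≈ 0#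
      σ₂-im : im (σ₂ P Q O) ≈ 0#
      σ₃-im : im (σ₃ P Q O) ≈ 0#

  rotate : ∀ {a b c d P Q O} → Factorization a b c d P Q O → Factorization a b c d Q O P
  rotate {P = P} {Q} {O} f = record
    { κ     = κ
    ; κ≉0   = κ≉0
    ; a≈    = trans a≈
      (solve 4 (λ κ s1 s2 s3 →
        κ :* (s1 :* s2 :* s3) := κ :* (s2 :* s3 :* s1)) κ (s P) (s Q) (s O))
    ; b≈    = trans b≈
      (solve 7 (λ κ x1 s2 s3 x2 s1 x3 →
        :- (κ :* (x1 :* (s2 :* s3) :+ x2 :* (s3 :* s1) :+ x3 :* (s1 :* s2))) :=
           :- (κ :* (x2 :* (s3 :* s1) :+ x3 :* (s1 :* s2) :+ x1 :* (s2 :* s3))))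
        κ (re (X P)) (s Q) (s O) (re (X Q)) (s P) (re (X O)))
    ; c≈    = trans c≈
      (solve 10 (λ κ x1 x2 y1 y2 s3 x3 y3 s1 s2 →
        κ :* ((x1 :* x2 :- y1 :* y2) :* s3 :+ (x2 :* x3 :- y2 :* y3) :* s1 :+ (x3 :* x1 :- y3 :* y1) :* s2) :=
           κ :* ((x2 :* x3 :- y2 :* y3) :* s1 :+ (x3 :* x1 :- y3 :* y1) :* s2 :+ (x1 :* x2 :- y1 :* y2) :* s3))
        κ (re (X P)) (re (X Q)) (im (X P)) (im (X Q)) (s O) (re (X O)) (im (X O)) (s P) (s Q))
    ; d≈    = trans d≈
      (solve 7 (λ κ x1 x2 y1 y2 x3 y3 →
        :- (κ :* ((x1 :* x2 :- y1 :* y2) :* x3 :- (x1 :* y2 :+ y1 :* x2) :* y3)) :=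
           :- (κ :* ((x2 :* x3 :- y2 :* y3) :* x1 :- (x2 :* y3 :+ y2 :* x3) :* y1)))
        κ (re (X P)) (re (X Q)) (im (X P)) (im (X Q)) (re (X O)) (im (X O)))
    ; σ₁-im = trans
      (solve 6 (λ y2 s3 s1 y3 s2 y1 →
        y2 :* (s3 :* s1) :+ y3 :* (s1 :* s2) :+ y1 :* (s2 :* s3) :=
           y1 :* (s2 :* s3) :+ y2 :* (s3 :* s1) :+ y3 :* (s1 :* s2))
        (im (X Q)) (s O) (s P) (im (X O)) (s Q) (im (X P))) σ₁-im
    ; σ₂-im = trans
      (solve 9 (λ x2 y3 y2 x3 s1 y1 x1 s2 s3 →
        (x2 :* y3 :+ y2 :* x3) :* s1 :+ (x3 :* y1 :+ y3 :* x1) :* s2 :+ (x1 :* y2 :+ y1 :* x2) :* s3 :=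
           (x1 :* y2 :+ y1 :* x2) :* s3 :+ (x2 :* y3 :+ y2 :* x3) :* s1 :+ (x3 :* y1 :+ y3 :* x1) :* s2)
        (re (X Q)) (im (X O)) (im (X Q)) (re (X O)) (s P) (im (X P)) (re (X P)) (s Q) (s O)) σ₂-im
    ; σ₃-im = trans
      (solve 6 (λ x2 x3 y2 y3 y1 x1 →
        (x2 :* x3 :- y2 :* y3) :* y1 :+ (x2 :* y3 :+ y2 :* x3) :* x1 :=
           (x1 :* x2 :- y1 :* y2) :* y3 :+ (x1 :* y2 :+ y1 :* x2) :* x3)
        (re (X Q)) (re (X O)) (im (X Q)) (im (X O)) (im (X P)) (re (X P))) σ₃-im
    }
    where open Factorization f

  private
    value-re : ∀ {n} (a b c d x y : Polynomial n) → Polynomial n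
    value-re a b c d x y = ((a :* x :+ b) :* x :+ c) :* x :+ d :+ :- (y :* y :* (# 3 :* a :* x :+ b))

    value-im : ∀ {n} (a b c x y : Polynomial n) → Polynomial n
    value-im a b c x y = y :* ((# 3 :* a :* x :+ # 2 :* b) :* x :+ c :+ :- (y :* y :* a))

    slope-re : ∀ {n} (a b c x y x′ y′ : Polynomial n) → Polynomial n
    slope-re a b c x y x′ y′ = a :* (x :* x :- y :* y :+ (x :* x′ :- y :* y′) :+ (x′ :* x′ :- y′ :* y′)) :+ b :* (x
      :+ x′) :+ c

    slope-im : ∀ {n} (a b x y x′ y′ : Polynomial n) → Polynomial n
    slope-im a b x y x′ y′ = a :* (# 2 :* x :* y :+ (x :* y′ :+ y :* x′) :+ # 2 :* x′ :* y′) :+ b :* (y :+ y′)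

  module _ {a b c d : ℝ} (nonzero : ¬ (a ≈ 0# × b ≈ 0# × c ≈ 0# × d ≈ 0#)) where

    IsFiniteRoot : ℂ → Set
    IsFiniteRoot z =
      ((a * re z + b) * re z + c) * re z + d + - (im z * im z * (3# * a * re z + b)) ≈ 0# ×
      im z * ((3# * a * re z + 2# * b) * re z + c + - (im z * im z * a)) ≈ 0#

    module _ {x y x′ y′ : ℝ} (z-root : IsFiniteRoot (x +i y)) (z′-root : IsFiniteRoot (x′ +i y′))
             (z≉z′ : ¬ ((x +i y) ≈ᶜ (x′ +i y′))) where
      -- F(z) - F(z′) is z - z′ times the displayed complex number, and the nonzero factor z - z′
      -- cancels.
      divided-difference :
        a * (x * x - y * y + (x * x′ - y * y′) + (x′ * x′ - y′ * y′)) + b * (x + x′) + c ≈ 0# ×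
        a * (2# * x * y + (x * y′ + y * x′) + 2# * x′ * y′) + b * (y + y′) ≈ 0#
      divided-difference = *ᶜ-cancel ((x - x′) +i (y - y′)) (_ +i _)
        (λ { (p , q) → z≉z′ (x-y≈0⇒x≈y p , x-y≈0⇒x≈y q) })
        (
          (linear 8 (λ x x′ a b c y y′ d →
            (x :- x′) :* slope-re a b c x y x′ y′ :- (y :- y′) :* slope-im a b x y x′ y′ := # 0
            from # 1 ⊛ value-re a b c d x y := # 0
            ⊕ :- # 1 ⊛ value-re a b c d x′ y′ := # 0) x x′ a b c y y′ d (proj₁ z-root , proj₁ z′-root)) ,
         (linear 7 (λ x x′ a b y y′ c →
           (x :- x′) :* slope-im a b x y x′ y′ :+ (y :- y′) :* slope-re a b c x y x′ y′ := # 0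
           from # 1 ⊛ value-im a b c x y := # 0
           ⊕ :- # 1 ⊛ value-im a b c x′ y′ := # 0) x x′ a b y y′ c (proj₂ z-root , proj₂ z′-root)))

    finite-factorization : ∀ z₁ z₂ z₃ → IsFiniteRoot z₁ → IsFiniteRoot z₂ → IsFiniteRoot z₃ →
      ¬ (z₁ ≈ᶜ z₂) → ¬ (z₂ ≈ᶜ z₃) → ¬ (z₁ ≈ᶜ z₃) → Factorization a b c d [ z₁ ] [ z₂ ] [ z₃ ]
    finite-factorization (x₁ +i y₁) (x₂ +i y₂) (x₃ +i y₃) root₁ root₂ root₃ z₁≉z₂ z₂≉z₃ z₁≉z₃ = record
      { κ     = a
      ; κ≉0   = a≉0
      ; a≈    = (solve 1 (λ a → a := a :* (# 1 :* # 1 :* # 1)) a)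
      ; b≈    =
        (linear 5 (λ b a x1 x2 x3 →
          b := :- (a :* (x1 :* (# 1 :* # 1) :+ x2 :* (# 1 :* # 1) :+ x3 :* (# 1 :* # 1)))
          from # 1 ⊛ a :* (x1 :+ x2 :+ x3) :+ b := # 0) b a x₁ x₂ x₃ b+)
      ; c≈    =
        (linear 9 (λ c a x1 x2 y1 y2 x3 y3 b →
          c :=
             a :* ((x1 :* x2 :- y1 :* y2) :* # 1 :+ (x2 :* x3 :- y2 :* y3) :* # 1 :+ (x3 :* x1 :- y3 :* y1) :* # 1)
          from # 1 ⊛ slope-re a b c x1 y1 x2 y2 := # 0
          ⊕ :- (x1 :+ x2) ⊛ a :* (x1 :+ x2 :+ x3) :+ b := # 0
          ⊕ y1 :+ y2 ⊛ a :* (y1 :+ y2 :+ y3) := # 0) c a x₁ x₂ y₁ y₂ x₃ y₃ b (q-re , b+ , a*σ₁))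
      ; d≈    =
        (linear 10 (λ d a x1 x2 y1 y2 x3 y3 b c →
          d := :- (a :* ((x1 :* x2 :- y1 :* y2) :* x3 :- (x1 :* y2 :+ y1 :* x2) :* y3))
          from # 1 ⊛ value-re a b c d x1 y1 := # 0
          ⊕ :- x1 ⊛ slope-re a b c x1 y1 x2 y2 := # 0
          ⊕ y1 ⊛ slope-im a b x1 y1 x2 y2 := # 0
          ⊕ x1 :* x2 :- y1 :* y2 ⊛ a :* (x1 :+ x2 :+ x3) :+ b := # 0
          ⊕ :- (x1 :* y2 :+ y1 :* x2) ⊛ a :* (y1 :+ y2 :+ y3) := # 0)
          d a x₁ x₂ y₁ y₂ x₃ y₃ b c (proj₁ root₁ , q-re , q-im , b+ , a*σ₁))
      ; σ₁-im = x*y≈0⇒y≈0 a≉0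
        (linear 4 (λ a y1 y2 y3 →
          a :* (y1 :* (# 1 :* # 1) :+ y2 :* (# 1 :* # 1) :+ y3 :* (# 1 :* # 1)) := # 0
          from # 1 ⊛ a :* (y1 :+ y2 :+ y3) := # 0) a y₁ y₂ y₃ a*σ₁)
      ; σ₂-im = x*y≈0⇒y≈0 a≉0 a*σ₂
      ; σ₃-im = x*y≈0⇒y≈0 a≉0
        (linear 9 (λ a x1 x2 y1 y2 y3 x3 b c →
          a :* ((x1 :* x2 :- y1 :* y2) :* y3 :+ (x1 :* y2 :+ y1 :* x2) :* x3) := # 0
          from # 1 ⊛ value-im a b c x1 y1 := # 0
          ⊕ :- y1 ⊛ slope-re a b c x1 y1 x2 y2 := # 0
          ⊕ :- x1 ⊛ slope-im a b x1 y1 x2 y2 := # 0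
          ⊕ x1 :* y2 :+ y1 :* x2 ⊛ a :* (x1 :+ x2 :+ x3) :+ b := # 0
          ⊕ x1 :* x2 :- y1 :* y2 ⊛ a :* (y1 :+ y2 :+ y3) := # 0)
          a x₁ x₂ y₁ y₂ y₃ x₃ b c (proj₂ root₁ , q-re , q-im , b+ , a*σ₁))
      }
      where
      q₁₂ = divided-difference root₁ root₂ z₁≉z₂
      q₁₃ = divided-difference root₁ root₃ z₁≉z₃
      q-re = proj₁ q₁₂
      q-im = proj₂ q₁₂
      -- The divided differences at (z₁, z₂) and (z₁, z₃) differ by (z₂ - z₃) (a (z₁ + z₂ + z₃) +
      -- b).
      sum : a * (x₁ + x₂ + x₃) + b ≈ 0# × a * (y₁ + y₂ + y₃) ≈ 0#
      sum = *ᶜ-cancel ((x₂ - x₃) +i (y₂ - y₃)) (_ +i _)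
        (λ { (p , q) →
          z₂≉z₃ (x-y≈0⇒x≈y p , x-y≈0⇒x≈y q) })
        (
          (linear 9 (λ x2 x3 a x1 b y2 y3 y1 c →
            (x2 :- x3) :* (a :* (x1 :+ x2 :+ x3) :+ b) :- (y2 :- y3) :* (a :* (y1 :+ y2 :+ y3)) := # 0
            from # 1 ⊛ slope-re a b c x1 y1 x2 y2 := # 0
            ⊕ :- # 1 ⊛ slope-re a b c x1 y1 x3 y3 := # 0) x₂ x₃ a x₁ b y₂ y₃ y₁ c (proj₁ q₁₂ , proj₁ q₁₃)) ,
         (linear 8 (λ x2 x3 a y1 y2 y3 x1 b →
           (x2 :- x3) :* (a :* (y1 :+ y2 :+ y3)) :+ (y2 :- y3) :* (a :* (x1 :+ x2 :+ x3) :+ b) := # 0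
           from # 1 ⊛ slope-im a b x1 y1 x2 y2 := # 0
           ⊕ :- # 1 ⊛ slope-im a b x1 y1 x3 y3 := # 0) x₂ x₃ a y₁ y₂ y₃ x₁ b (proj₂ q₁₂ , proj₂ q₁₃)))
      b+ = proj₁ sum
      a*σ₁ = proj₂ sum
      a*σ₂ : a * ((x₁ * y₂ + y₁ * x₂) * 1# + (x₂ * y₃ + y₂ * x₃) * 1# + (x₃ * y₁ + y₃ * x₁) * 1#) ≈ 0#
      a*σ₂ =
        (linear 8 (λ a x1 y2 y1 x2 y3 x3 b →
          a :* ((x1 :* y2 :+ y1 :* x2) :* # 1 :+ (x2 :* y3 :+ y2 :* x3) :* # 1 :+ (x3 :* y1 :+ y3 :* x1) :* # 1) :=
             # 0
          from :- # 1 ⊛ slope-im a b x1 y1 x2 y2 := # 0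
          ⊕ y1 :+ y2 ⊛ a :* (x1 :+ x2 :+ x3) :+ b := # 0
          ⊕ x1 :+ x2 ⊛ a :* (y1 :+ y2 :+ y3) := # 0) a x₁ y₂ y₁ x₂ y₃ x₃ b (q-im , b+ , a*σ₁))
      -- If a vanished, the root relations would make b, c and d vanish in turn.
      a≉0 : ¬ (a ≈ 0#)
      a≉0 a≈0 = nonzero (a≈0 , b≈0 , c≈0 ,
          (linear 6 (λ d a b c x1 y1 →
            d := # 0
            from # 1 ⊛ value-re a b c d x1 y1 := # 0
            ⊕ # 3 :* y1 :* y1 :* x1 :- x1 :* x1 :* x1 ⊛ a := # 0
            ⊕ y1 :* y1 :- x1 :* x1 ⊛ b := # 0
            ⊕ :- x1 ⊛ c := # 0) d a b c x₁ y₁ (proj₁ root₁ , a≈0 , b≈0 , c≈0)))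
        where
        b≈0 : b ≈ 0#
        b≈0 =
          (linear 5 (λ b a x1 x2 x3 →
            b := # 0
            from # 1 ⊛ a :* (x1 :+ x2 :+ x3) :+ b := # 0
            ⊕ :- (x1 :+ x2 :+ x3) ⊛ a := # 0) b a x₁ x₂ x₃ (b+ , a≈0))
        c≈0 : c ≈ 0#
        c≈0 =
          (linear 7 (λ c a b x1 y1 x2 y2 →
            c := # 0
            from # 1 ⊛ slope-re a b c x1 y1 x2 y2 := # 0
            ⊕ :- (x1 :* x1 :- y1 :* y1 :+ (x1 :* x2 :- y1 :* y2) :+ (x2 :* x2 :- y2 :* y2)) ⊛ a := # 0
            ⊕ :- (x1 :+ x2) ⊛ b := # 0) c a b x₁ y₁ x₂ y₂ (q-re , a≈0 , b≈0))

    -- The root ∞ contributes the linear factor -U, so the leading coefficient b of the remaining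
    -- quadratic enters as κ = -b.
    infinite-factorization : ∀ z₂ z₃ → a ≈ 0# → IsFiniteRoot z₂ → IsFiniteRoot z₃ → ¬ (z₂ ≈ᶜ z₃) →
      Factorization a b c d ∞ [ z₂ ] [ z₃ ]
    infinite-factorization (x₂ +i y₂) (x₃ +i y₃) a≈0 root₂ root₃ z₂≉z₃ = record
      { κ     = - b
      ; κ≉0   = λ -b≈0 → b≉0 (linear 1 (λ b → b := # 0 from :- # 1 ⊛ :- b := # 0) b -b≈0)
      ; a≈    =
        (linear 2 (λ a b →
          a := :- b :* (# 0 :* # 1 :* # 1)
          from # 1 ⊛ a := # 0) a b a≈0)
      ; b≈    =
        (solve 3 (λ b x2 x3 →
          b := :- (:- b :* (# 1 :* (# 1 :* # 1) :+ x2 :* (# 1 :* # 0) :+ x3 :* (# 0 :* # 1)))) b x₂ x₃)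
      ; c≈    =
        (linear 7 (λ c b x2 y2 x3 y3 a →
          c :=
             :- b :* ((# 1 :* x2 :- # 0 :* y2) :* # 1 :+ (x2 :* x3 :- y2 :* y3) :* # 0 :+ (x3 :* # 1 :- y3 :* # 0)
             :* # 1)
          from # 1 ⊛ slope-re a b c x2 y2 x3 y3 := # 0
          ⊕ :- (x2 :* x2 :- y2 :* y2 :+ (x2 :* x3 :- y2 :* y3) :+ (x3 :* x3 :- y3 :* y3)) ⊛ a := # 0)
          c b x₂ y₂ x₃ y₃ a (proj₁ q , a≈0))
      ; d≈    =
        (linear 8 (λ y2 x2 x3 y3 d b a c →
          let e = # 3 :* y2 :* y2 :* x2 :- x2 :* x2 :* x2 :+ x2 :* (x2 :* x2 :- y2 :* y2 :+ (x2 :* x3 :- y2 :* y3)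
                :+ (x3 :* x3 :- y3 :* y3)) :- y2 :* (# 2 :* x2 :* y2 :+ (x2 :* y3 :+ y2 :* x3) :+ # 2 :* x3 :* y3)
          in d := :- (:- b :* ((# 1 :* x2 :- # 0 :* y2) :* x3 :- (# 1 :* y2 :+ # 0 :* x2) :* y3))
          from # 1 ⊛ value-re a b c d x2 y2 := # 0
          ⊕ :- x2 ⊛ slope-re a b c x2 y2 x3 y3 := # 0
          ⊕ y2 ⊛ slope-im a b x2 y2 x3 y3 := # 0
          ⊕ e ⊛ a := # 0) y₂ x₂ x₃ y₃ d b a c (proj₁ root₂ , proj₁ q , proj₂ q , a≈0))
      ; σ₁-im =
        (solve 2 (λ y2 y3 →
          # 0 :* (# 1 :* # 1) :+ y2 :* (# 1 :* # 0) :+ y3 :* (# 0 :* # 1) := # 0) y₂ y₃)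
      ; σ₂-im = trans
        (solve 4 (λ y2 x2 y3 x3 →
          (# 1 :* y2 :+ # 0 :* x2) :* # 1 :+ (x2 :* y3 :+ y2 :* x3) :* # 0 :+ (x3 :* # 0 :+ y3 :* # 1) :* # 1 :=
             y2 :+ y3) y₂ x₂ y₃ x₃) y₂+y₃≈0
      ; σ₃-im = x*y≈0⇒y≈0 b≉0
        (linear 7 (λ y2 x2 x3 y3 b a c →
          let e = y2 :* (# 3 :* x2 :* x2 :- y2 :* y2) :- y2 :* (x2 :* x2 :- y2 :* y2 :+ (x2 :* x3 :- y2 :* y3) :+
                (x3 :* x3 :- y3 :* y3))
          in b :* ((# 1 :* x2 :- # 0 :* y2) :* y3 :+ (# 1 :* y2 :+ # 0 :* x2) :* x3) := # 0
          from :- # 1 ⊛ value-im a b c x2 y2 := # 0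
          ⊕ y2 ⊛ slope-re a b c x2 y2 x3 y3 := # 0
          ⊕ b :* x2 ⊛ y2 :+ y3 := # 0
          ⊕ e ⊛ a := # 0) y₂ x₂ x₃ y₃ b a c (proj₂ root₂ , proj₁ q , y₂+y₃≈0 , a≈0))
      }
      where
      q = divided-difference root₂ root₃ z₂≉z₃
      b≉0 : ¬ (b ≈ 0#)
      b≉0 b≈0 = nonzero (a≈0 , b≈0 , c≈0 ,
          (linear 6 (λ d a b c x2 y2 →
            d := # 0
            from # 1 ⊛ value-re a b c d x2 y2 := # 0
            ⊕ # 3 :* y2 :* y2 :* x2 :- x2 :* x2 :* x2 ⊛ a := # 0
            ⊕ y2 :* y2 :- x2 :* x2 ⊛ b := # 0
            ⊕ :- x2 ⊛ c := # 0) d a b c x₂ y₂ (proj₁ root₂ , a≈0 , b≈0 , c≈0)))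
        where
        c≈0 : c ≈ 0#
        c≈0 =
          (linear 7 (λ c a b x2 y2 x3 y3 →
            c := # 0
            from # 1 ⊛ slope-re a b c x2 y2 x3 y3 := # 0
            ⊕ :- (x2 :* x2 :- y2 :* y2 :+ (x2 :* x3 :- y2 :* y3) :+ (x3 :* x3 :- y3 :* y3)) ⊛ a := # 0
            ⊕ :- (x2 :+ x3) ⊛ b := # 0) c a b x₂ y₂ x₃ y₃ (proj₁ q , a≈0 , b≈0))
      y₂+y₃≈0 : y₂ + y₃ ≈ 0#
      y₂+y₃≈0 = x*y≈0⇒y≈0 b≉0
        (linear 6 (λ b y2 y3 a x2 x3 →
          b :* (y2 :+ y3) := # 0
          from # 1 ⊛ slope-im a b x2 y2 x3 y3 := # 0
          ⊕ :- (# 2 :* x2 :* y2 :+ (x2 :* y3 :+ y2 :* x3) :+ # 2 :* x3 :* y3) ⊛ a := # 0)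
          b y₂ y₃ a x₂ x₃ (proj₂ q , a≈0))

  -- ∞ counts as real, since its coordinates are (1 : 0).
  IsReal : ℙ¹ → Set
  IsReal P = im (X P) ≈ 0#

  data AreConjugate : ℙ¹ → ℙ¹ → Set where
    conjugate : ∀ {x y x′ y′} → ¬ (y ≈ 0#) → x′ ≈ x → y′ ≈ - y → AreConjugate [ x +i y ] [ x′ +i y′ ]

  module _ {a b c d : ℝ} where

    -- Evaluating the conjugate cubic, which is the cubic itself, at a nonreal root P.
    conjugate-root : ∀ {P Q O} → Factorization a b c d P Q O → ¬ IsReal P → AreConjugate P Q ⊎ AreConjugate P O
    conjugate-root {∞} f P-nonreal = ⊥-elim (P-nonreal refl)
    conjugate-root {[ x₁ +i y₁ ]} {Q} {O} f y₁≉0 =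
      cases (*ᶜ-zero-product ((x₁ * s Q - re (X Q)) +i (- (y₁ * s Q) - im (X Q))) ((x₁ * s O - re (X O)) +i (- (y₁ * s O) - im (X O)))
        (x*y≈0⇒y≈0 y₁≉0
          (linear 8 (λ y1 x1 s2 x2 s3 x3 y2 y3 →
            y1 :* ((x1 :* s2 :- x2) :* (x1 :* s3 :- x3) :- (:- (y1 :* s2) :- y2) :* (:- (y1 :* s3) :- y3)) := # 0
            from x1 :* x1 :- y1 :* y1 ⊛ y1 :* (s2 :* s3) :+ y2 :* (s3 :* # 1) :+ y3 :* (# 1 :* s2) := # 0
            ⊕ :- x1 ⊛ (x1 :* y2 :+ y1 :* x2) :* s3 :+ (x2 :* y3 :+ y2 :* x3) :* # 1 :+ (x3 :* y1 :+ y3 :* x1) :* s2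
               :=
               # 0
            ⊕ # 1 ⊛ (x1 :* x2 :- y1 :* y2) :* y3 :+ (x1 :* y2 :+ y1 :* x2) :* x3 := # 0)
            y₁ x₁ (s Q) (re (X Q)) (s O) (re (X O)) (im (X Q)) (im (X O)) (σ₁-im , σ₂-im , σ₃-im)) ,
         x*y≈0⇒y≈0 y₁≉0
          (linear 8 (λ y1 x1 s2 x2 s3 y3 y2 x3 →
            y1 :* ((x1 :* s2 :- x2) :* (:- (y1 :* s3) :- y3) :+ (:- (y1 :* s2) :- y2) :* (x1 :* s3 :- x3)) := # 0
            from :- (# 2 :* x1 :* y1) ⊛ y1 :* (s2 :* s3) :+ y2 :* (s3 :* # 1) :+ y3 :* (# 1 :* s2) := # 0
            ⊕ y1 ⊛ (x1 :* y2 :+ y1 :* x2) :* s3 :+ (x2 :* y3 :+ y2 :* x3) :* # 1 :+ (x3 :* y1 :+ y3 :* x1) :* s2 :=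
               # 0) y₁ x₁ (s Q) (re (X Q)) (s O) (im (X O)) (im (X Q)) (re (X O)) (σ₁-im , σ₂-im))))
      where
      open Factorization f
      conjugate-of : ∀ A → ((x₁ * s A - re (X A)) +i (- (y₁ * s A) - im (X A))) ≈ᶜ 0ᶜ → AreConjugate [ x₁ +i y₁ ] A
      conjugate-of [ x +i y ] (p , q) = conjugate y₁≉0
        (linear 2 (λ x x1 → x := x1 from :- # 1 ⊛ x1 :* # 1 :- x := # 0) x x₁ p)
          (linear 2 (λ y y1 →
            y := :- y1
            from :- # 1 ⊛ :- (y1 :* # 1) :- y := # 0) y y₁ q)
      conjugate-of ∞          (p , _) = ⊥-elim (<⇒≉ 0<1
        (linear 1 (λ x1 →
          # 1 := # 0
          from :- # 1 ⊛ x1 :* # 0 :- # 1 := # 0) x₁ p))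
      cases : _ ⊎ _ → AreConjugate [ x₁ +i y₁ ] Q ⊎ AreConjugate [ x₁ +i y₁ ] O
      cases (inj₁ u≈0) = inj₁ (conjugate-of Q u≈0)
      cases (inj₂ v≈0) = inj₂ (conjugate-of O v≈0)

    conjugate-imaginary : ∀ {P Q} → AreConjugate P Q → IsReal Q → ⊥
    conjugate-imaginary (conjugate {y = y} {y′ = y′} y≉0 _ y′≈-y) y′≈0 =
      y≉0
        (linear 2 (λ y y′ →
          y := # 0
          from :- # 1 ⊛ y′ := # 0
          ⊕ # 1 ⊛ y′ := :- y) y y′ (y′≈0 , y′≈-y))

    third-real : ∀ {P Q O} → Factorization a b c d P Q O → AreConjugate P Q → IsReal O
    third-real {O = O} f (conjugate {y = y} {y′ = y′} _ _ y′≈-y) =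
      (linear 4 (λ z y r y′ →
        z := # 0
        from # 1 ⊛ y :* (# 1 :* r) :+ y′ :* (r :* # 1) :+ z :* (# 1 :* # 1) := # 0
        ⊕ :- r ⊛ y′ := :- y) (im (X O)) y (s O) y′ (Factorization.σ₁-im f , y′≈-y))

    -- Up to a rotation, a cubic form with real coefficients has real roots or one real and two conjugate roots.
    module RootPattern (Goal : ℙ¹ → ℙ¹ → ℙ¹ → Set)
      (rotate-goal : ∀ {P Q O} → Goal P Q O → Goal Q O P)
      (all-real : ∀ {P Q O} → Factorization a b c d P Q O → IsReal P → IsReal Q → IsReal O → Goal P Q O)
      (one-real : ∀ {P Q O} → Factorization a b c d P Q O → IsReal P → AreConjugate Q O → Goal P Q O) where

      private
        sym-conjugate : ∀ {P Q} → AreConjugate P Q → AreConjugate Q P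
        sym-conjugate (conjugate {y = y} {y′ = y′} y≉0 x′≈x y′≈-y) = conjugate
          (λ y′≈0 → y≉0
            (linear 2 (λ y y′ →
              y := # 0
              from :- # 1 ⊛ y′ := # 0
              ⊕ # 1 ⊛ y′ := :- y) y y′ (y′≈0 , y′≈-y)))
          (sym x′≈x) (linear 2 (λ y y′ → y := :- y′ from # 1 ⊛ y′ := :- y) y y′ y′≈-y)

      goal : ∀ {P Q O} → Factorization a b c d P Q O → Goal P Q O
      goal {P} {Q} {O} f = cases (im (X P) ≈? 0#) (im (X Q) ≈? 0#) (im (X O) ≈? 0#)
        where
        cases : Dec (IsReal P) → Dec (IsReal Q) → Dec (IsReal O) → Goal P Q O
        cases (yes P-real) (yes Q-real) (yes O-real) = all-real f P-real Q-real O-real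
        cases (yes P-real) (yes Q-real) (no O-nonreal) with conjugate-root (rotate (rotate f)) O-nonreal
        ... | inj₁ conj = ⊥-elim (conjugate-imaginary conj P-real)
        ... | inj₂ conj = ⊥-elim (conjugate-imaginary conj Q-real)
        cases (yes P-real) (no Q-nonreal) _ with conjugate-root (rotate f) Q-nonreal
        ... | inj₁ conj = one-real f P-real conj
        ... | inj₂ conj = ⊥-elim (conjugate-imaginary conj P-real)
        cases (no P-nonreal) _ _ with conjugate-root f P-nonreal
        ... | inj₁ conj = rotate-goal (one-real (rotate (rotate f)) (third-real f conj) conj)
        ... | inj₂ conj = rotate-goal (rotate-goal (one-real (rotate f)
                (third-real (rotate (rotate f)) (sym-conjugate conj)) (sym-conjugate conj)))

-- Three real roots: the Hessian in terms of the roots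

module RealFactors (R : CompleteOrderedField) (κ x₁ x₂ x₃ s₁ s₂ s₃ : CompleteOrderedField.Carrier R) where
  open CompleteOrderedField R hiding (ring)
  open OrderedField R

  a b c d m₁ m₂ m₃ S W X₀ : Carrier
  a  = κ * (s₁ * s₂ * s₃)
  b  = - (κ * (x₁ * (s₂ * s₃) + x₂ * (s₃ * s₁) + x₃ * (s₁ * s₂)))
  c  = κ * (x₁ * x₂ * s₃ + x₂ * x₃ * s₁ + x₃ * x₁ * s₂)
  d  = - (κ * (x₁ * x₂ * x₃))
  m₁ = x₂ * s₃ - x₃ * s₂
  m₂ = x₃ * s₁ - x₁ * s₃
  m₃ = x₁ * s₂ - x₂ * s₁
  S  = m₁ * m₁ * (s₁ * s₁) + m₂ * m₂ * (s₂ * s₂) + m₃ * m₃ * (s₃ * s₃)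
  W  = m₁ * m₁ * (m₂ * m₂) * (m₃ * m₃)
  X₀ = m₁ * m₁ * (s₁ * x₁) + m₂ * m₂ * (s₂ * x₂) + m₃ * m₃ * (s₃ * x₃)

  open RealRootedCubics R a b c d
  open TaylorCoefficients R a b c d using (AttractorEquations)

  private
    bᴾ : ∀ {n} (κ x1 x2 x3 s1 s2 s3 : Polynomial n) → Polynomial n
    bᴾ κ x1 x2 x3 s1 s2 s3 = :- (κ :* (x1 :* (s2 :* s3) :+ x2 :* (s3 :* s1) :+ x3 :* (s1 :* s2)))

    cᴾ : ∀ {n} (κ x1 x2 x3 s1 s2 s3 : Polynomial n) → Polynomial n
    cᴾ κ x1 x2 x3 s1 s2 s3 = κ :* (x1 :* x2 :* s3 :+ x2 :* x3 :* s1 :+ x3 :* x1 :* s2)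

    mᴾ : ∀ {n} (x s y r : Polynomial n) → Polynomial n
    mᴾ x s y r = x :* r :- y :* s

    -- The Hessian of κ l₁ l₂ l₃ is (κ² / 2) Σ mᵢ² lᵢ². This identity and the next read off its
    -- leading and middle coefficients; with Δ as κ⁴ times the product of the squared minors, the
    -- root of the Hessian is the weighted centre.
    2H≈κ²S : 2# * H ≈ κ * κ * S
    2H≈κ²S =
      (solve 7 (λ κ s1 s2 s3 x1 x2 x3 →
        let a = κ :* (s1 :* s2 :* s3)
            b = bᴾ κ x1 x2 x3 s1 s2 s3
            c = cᴾ κ x1 x2 x3 s1 s2 s3
            m1 = mᴾ x2 s2 x3 s3
            m2 = mᴾ x3 s3 x1 s1
            m3 = mᴾ x1 s1 x2 s2
        in # 2 :* (b :* b :- # 3 :* a :* c) :=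
           κ :* κ :* (m1 :* m1 :* (s1 :* s1) :+ m2 :* m2 :* (s2 :* s2) :+ m3 :* m3 :* (s3 :* s3)))
        κ s₁ s₂ s₃ x₁ x₂ x₃)

    9ad-bc≈κ²X₀ : 9# * a * d - b * c ≈ κ * κ * X₀
    9ad-bc≈κ²X₀ =
      (solve 7 (λ κ s1 s2 s3 x1 x2 x3 →
        let a = κ :* (s1 :* s2 :* s3)
            b = bᴾ κ x1 x2 x3 s1 s2 s3
            c = cᴾ κ x1 x2 x3 s1 s2 s3
            d = :- (κ :* (x1 :* x2 :* x3))
            m1 = mᴾ x2 s2 x3 s3
            m2 = mᴾ x3 s3 x1 s1
            m3 = mᴾ x1 s1 x2 s2
        in # 9 :* a :* d :- b :* c :=
           κ :* κ :* (m1 :* m1 :* (s1 :* x1) :+ m2 :* m2 :* (s2 :* x2) :+ m3 :* m3 :* (s3 :* x3)))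
        κ s₁ s₂ s₃ x₁ x₂ x₃)

    Δ≈κ⁴W : Δ ≈ κ * κ * (κ * κ) * W
    Δ≈κ⁴W =
      (solve 7 (λ κ s1 s2 s3 x1 x2 x3 →
        let a = κ :* (s1 :* s2 :* s3)
            b = bᴾ κ x1 x2 x3 s1 s2 s3
            c = cᴾ κ x1 x2 x3 s1 s2 s3
            d = :- (κ :* (x1 :* x2 :* x3))
            m1 = mᴾ x2 s2 x3 s3
            m2 = mᴾ x3 s3 x1 s1
            m3 = mᴾ x1 s1 x2 s2
        in b :* b :* c :* c :- # 4 :* (a :* c :* c :* c) :- # 4 :* (b :* b :* b :* d) :- # 3 :* # 9 :* (a :* a :* d
           :* d) :+ # 2 :* # 9 :* (a :* b :* c :* d) :=
           κ :* κ :* (κ :* κ) :* (m1 :* m1 :* (m2 :* m2) :* (m3 :* m3))) κ s₁ s₂ s₃ x₁ x₂ x₃)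

  module _ (κ≉0 : ¬ (κ ≈ 0#)) where
    private
      κ²≉0 : ¬ (κ * κ ≈ 0#)
      κ²≉0 = <⇒≉ (0<x² κ≉0)

    equations⇒centre : ∀ {x Y} → 0# < Y → AttractorEquations x Y → S * x ≈ X₀ × S * S * Y ≈ 3# * W
    equations⇒centre {x} {Y} 0<Y eqs =
      let 2Hx≈ , 4H²Y≈ = equations⇒hessian (0≤-resp (sym Δ≈κ⁴W)
                           (0≤x*y (0≤x² (κ * κ)) (0≤x*y (0≤x*y (0≤x² m₁) (0≤x² m₂)) (0≤x² m₃)))) 0<Y eqs
      in *-cancelˡ κ²≉0
        (linear 6 (λ κ S x X0 H e →
          κ :* κ :* (S :* x) := κ :* κ :* X0
          from # 1 ⊛ # 2 :* H :* x := e
          ⊕ :- x ⊛ # 2 :* H := κ :* κ :* S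
          ⊕ # 1 ⊛ e := κ :* κ :* X0) κ S x X₀ H (9# * a * d - b * c) (2Hx≈ , 2H≈κ²S , 9ad-bc≈κ²X₀)) ,
         *-cancelˡ κ²≉0 (*-cancelˡ κ²≉0
           (linear 6 (λ κ S Y W H Δ →
             κ :* κ :* (κ :* κ :* (S :* S :* Y)) := κ :* κ :* (κ :* κ :* (# 3 :* W))
             from # 1 ⊛ # 4 :* (H :* H) :* Y := # 3 :* Δ
             ⊕ :- (Y :* (# 2 :* H :+ κ :* κ :* S)) ⊛ # 2 :* H := κ :* κ :* S
             ⊕ # 3 ⊛ Δ := κ :* κ :* (κ :* κ) :* W) κ S Y W H Δ (4H²Y≈ , 2H≈κ²S , Δ≈κ⁴W)))

    centre⇒equations : ∀ {x Y} → 0# < S → S * x ≈ X₀ → S * S * Y ≈ 3# * W → AttractorEquations x Y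
    centre⇒equations {x} {Y} 0<S Sx≈ S²Y≈ = hessian⇒equations
      (0<x*y⇒0<y (0<ι 1) (0<-resp (sym 2H≈κ²S) (*-pos (0<x² κ≉0) 0<S)))
      (linear 6 (λ H x e κ S X0 →
        # 2 :* H :* x := e
        from κ :* κ ⊛ S :* x := X0
        ⊕ x ⊛ # 2 :* H := κ :* κ :* S
        ⊕ :- # 1 ⊛ e := κ :* κ :* X0) H x (9# * a * d - b * c) κ S X₀ (Sx≈ , 2H≈κ²S , 9ad-bc≈κ²X₀))
      (linear 6 (λ H Y Δ κ S W →
        # 4 :* (H :* H) :* Y := # 3 :* Δ
        from κ :* κ :* (κ :* κ) ⊛ S :* S :* Y := # 3 :* W
        ⊕ Y :* (# 2 :* H :+ κ :* κ :* S) ⊛ # 2 :* H := κ :* κ :* S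
        ⊕ :- # 3 ⊛ Δ := κ :* κ :* (κ :* κ) :* W) H Y Δ κ S W (S²Y≈ , 2H≈κ²S , Δ≈κ⁴W))

-- One real and two conjugate roots: restoring κ and the coordinate x

module ComplexFactors (R : CompleteOrderedField) (κ s ρ p q : CompleteOrderedField.Carrier R) where
  open CompleteOrderedField R hiding (ring)
  open OrderedField R

  a b c d k w T : Carrier
  a = κ * s
  b = - (κ * (ρ + 2# * p * s))
  c = κ * (2# * p * ρ + s * (p * p + q * q))
  d = - (κ * (ρ * (p * p + q * q)))
  k = ρ - s * p
  w = k * k + q * q * (s * s)
  T = 2# * (q * q) * (s * s) + w

  open TaylorCoefficients R a b c d

  module _ (κ≉0 : ¬ (κ ≈ 0#)) (q≉0 : ¬ (q ≈ 0#)) (0<T : 0# < T) (x Y : Carrier) (0<Y : 0# < Y) where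
    private
      module L = ComplexRootedCubics R
      m n : Carrier
      m = ρ - s * x
      n = p - x

      -- The Taylor coefficients carry a factor κ, and E₁ and E₂ are quadratic in them.
      E₁≈ : E₁ x Y ≈ κ * κ * L.E₁ s m n (q * q) Y
      E₁≈ =
        (solve 7 (λ κ s ρ p q x Y →
          let a = κ :* s
              b = :- (κ :* (ρ :+ # 2 :* p :* s))
              e = p :* p :+ q :* q
              c = κ :* (# 2 :* p :* ρ :+ s :* e)
              d = :- (κ :* (ρ :* e))
              B = # 3 :* a :* x :+ b
              C = (# 3 :* a :* x :+ # 2 :* b) :* x :+ c
              D = ((a :* x :+ b) :* x :+ c) :* x :+ d
              m = ρ :- s :* x
              n = p :- x
              B′ = :- (m :+ # 2 :* n :* s)
              f = n :* n :+ q :* q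
              C′ = # 2 :* m :* n :+ s :* f
              D′ = :- (m :* f)
          in # 3 :* D :* C :+ # 2 :* B :* C :* Y :+ # 3 :* a :* B :* Y :* Y :=
             κ :* κ :* (# 3 :* D′ :* C′ :+ # 2 :* B′ :* C′ :* Y :+ # 3 :* s :* B′ :* Y :* Y)) κ s ρ p q x Y)

      E₂≈ : E₂ x Y ≈ κ * κ * L.E₂ s m n (q * q) Y
      E₂≈ =
        (solve 7 (λ κ s ρ p q x Y →
          let a = κ :* s
              b = :- (κ :* (ρ :+ # 2 :* p :* s))
              e = p :* p :+ q :* q
              c = κ :* (# 2 :* p :* ρ :+ s :* e)
              d = :- (κ :* (ρ :* e))
              B = # 3 :* a :* x :+ b
              C = (# 3 :* a :* x :+ # 2 :* b) :* x :+ c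
              D = ((a :* x :+ b) :* x :+ c) :* x :+ d
              m = ρ :- s :* x
              n = p :- x
              B′ = :- (m :+ # 2 :* n :* s)
              f = n :* n :+ q :* q
              C′ = # 2 :* m :* n :+ s :* f
              D′ = :- (m :* f)
          in B :* B :* Y :* Y :+ # 9 :* a :* a :* Y :* Y :* Y :- # 9 :* D :* D :- C :* C :* Y :=
             κ :* κ :* (B′ :* B′ :* Y :* Y :+ # 9 :* s :* s :* Y :* Y :* Y :- # 9 :* D′ :* D′ :- C′ :* C′ :* Y))
          κ s ρ p q x Y)

      k≈ : L.k s m n (q * q) Y ≈ k
      k≈ =
        (solve 4 (λ ρ s x p →
          ρ :- s :* x :- s :* (p :- x) := ρ :- s :* p) ρ s x p)

      w≈ : L.d s m n (q * q) Y ≈ w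
      w≈ = +-congʳ (*-cong k≈ k≈)

      T≈ : L.T s m n (q * q) Y ≈ T
      T≈ = +-congˡ w≈

      κ²≉0 : ¬ (κ * κ ≈ 0#)
      κ²≉0 = <⇒≉ (0<x² κ≉0)

    equations⇒centre : AttractorEquations x Y → T * x ≈ 2# * (q * q) * s * ρ + w * p × T * T * Y ≈ 3# * (q * q) * (w * w)
    equations⇒centre (E₁≈0 , E₂≈0) =
      (linear 9 (λ T x q s ρ w p T′ k′ →
        T :* x := # 2 :* (q :* q) :* s :* ρ :+ w :* p
        from :- # 1 ⊛ T′ :* (p :- x) := :- (# 2 :* (q :* q) :* s :* k′)
        ⊕ p :- x ⊛ T′ := T
        ⊕ # 2 :* (q :* q) :* s ⊛ k′ := ρ :- s :* p
        ⊕ p ⊛ T := # 2 :* (q :* q) :* (s :* s) :+ w)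
        T x q s ρ w p (L.T s m n (q * q) Y) (L.k s m n (q * q) Y) (L.equations⇒n s m n (q * q) Y (0<x² q≉0) 0<Y 0<T′
          e₁≈0 e₂≈0 , T≈ , k≈ , refl)) ,
      trans (*-congʳ (sym (*-cong T≈ T≈)))
        (trans (L.equations⇒Y s m n (q * q) Y (0<x² q≉0) 0<Y 0<T′ e₁≈0 e₂≈0) (*-congˡ (*-cong w≈ w≈)))
      where
      0<T′ = 0<-resp (sym T≈) 0<T
      e₁≈0 = x*y≈0⇒y≈0 κ²≉0 (trans (sym E₁≈) E₁≈0)
      e₂≈0 = x*y≈0⇒y≈0 κ²≉0 (trans (sym E₂≈) E₂≈0)

    centre⇒equations : T * x ≈ 2# * (q * q) * s * ρ + w * p → T * T * Y ≈ 3# * (q * q) * (w * w) → AttractorEquations x Y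
    centre⇒equations Tx≈ T²Y≈ =
      trans E₁≈ (trans (*-congˡ (L.centre⇒E₁ s m n (q * q) Y (0<x² q≉0) 0<Y 0<T′ Tn≈ T′²Y≈)) (zeroʳ _)) ,
      trans E₂≈ (trans (*-congˡ (L.centre⇒E₂ s m n (q * q) Y (0<x² q≉0) 0<Y 0<T′ Tn≈ T′²Y≈)) (zeroʳ _))
      where
      0<T′ = 0<-resp (sym T≈) 0<T
      Tn≈ : L.T s m n (q * q) Y * n ≈ - (2# * (q * q) * s * L.k s m n (q * q) Y)
      Tn≈ =
        (linear 9 (λ T′ p x q s k′ T ρ w →
          T′ :* (p :- x) := :- (# 2 :* (q :* q) :* s :* k′)
          from :- # 1 ⊛ T :* x := # 2 :* (q :* q) :* s :* ρ :+ w :* p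
          ⊕ p :- x ⊛ T′ := T
          ⊕ # 2 :* (q :* q) :* s ⊛ k′ := ρ :- s :* p
          ⊕ p ⊛ T := # 2 :* (q :* q) :* (s :* s) :+ w)
          (L.T s m n (q * q) Y) p x q s (L.k s m n (q * q) Y) T ρ w (Tx≈ , T≈ , k≈ , refl))
      T′²Y≈ : L.T s m n (q * q) Y * L.T s m n (q * q) Y * Y ≈ 3# * (q * q) * (L.d s m n (q * q) Y * L.d s m n (q * q) Y)
      T′²Y≈ = trans (*-congʳ (*-cong T≈ T≈)) (trans T²Y≈ (*-congˡ (sym (*-cong w≈ w≈))))

-- Equivalence of the attractor equations with the formula for the centre

module Centrality (R : CompleteOrderedField) where
  open CompleteOrderedField R hiding (ring)
  open RealAnalysis R
  open OrderedField R
  open WeightedConfigurations R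
  open Factorizations R

  equations-cong : ∀ {a a′ b b′ c c′ d d′ x Y} → a ≈ a′ → b ≈ b′ → c ≈ c′ → d ≈ d′ →
    TaylorCoefficients.AttractorEquations R a b c d x Y → TaylorCoefficients.AttractorEquations R a′ b′ c′ d′ x Y
  equations-cong {a} {a′} {b} {b′} {c} {c′} {d} {d′} {x} {Y} a≈ b≈ c≈ d≈ (E₁≈0 , E₂≈0) =
    trans (sym (+-cong (+-cong (*-cong (*-congˡ D≈) C≈) (*-congʳ (*-cong (*-congˡ B≈) C≈)))
      (*-congʳ (*-congʳ (*-cong (*-congˡ a≈) B≈))))) E₁≈0 ,
    trans (sym (+-cong (+-cong (+-cong (*-congʳ (*-congʳ (*-cong B≈ B≈))) (*-congʳ (*-congʳ (*-congʳ (*-cong (*-congˡ a≈) a≈)))))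
      (-‿cong (*-cong (*-congˡ D≈) D≈))) (-‿cong (*-congʳ (*-cong C≈ C≈))))) E₂≈0
    where
    module T = TaylorCoefficients R a b c d
    module T′ = TaylorCoefficients R a′ b′ c′ d′
    B≈ : T.B x ≈ T′.B x
    B≈ = +-cong (*-congʳ (*-congˡ a≈)) b≈
    C≈ : T.C x ≈ T′.C x
    C≈ = +-cong (*-congʳ (+-cong (*-congʳ (*-congˡ a≈)) (*-congˡ b≈))) c≈
    D≈ : T.D x ≈ T′.D x
    D≈ = +-cong (*-congʳ (+-cong (*-congʳ (+-cong (*-congʳ a≈) b≈)) c≈)) d≈

  module _ (a b c d : ℝ) where
    open TaylorCoefficients R a b c d

    -- The equivalence is phrased through S, W, X₀ and Y₀ because these are unchanged by a cyclic
    -- rotation of the roots, so each root pattern is treated in one arrangement only. `Y₀≈0` places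
    -- the centre in ℍ.
    record IsCentral (P Q O : ℙ¹) : Set where
      field
        Y₀≈0             : Y₀ P Q O ≈ 0#
        equations⇒centre : ∀ {x Y} → 0# < Y → AttractorEquations x Y →
                           S P Q O * x ≈ X₀ P Q O × S P Q O * S P Q O * Y ≈ 3# * W P Q O
        centre⇒equations : ∀ {x Y} → 0# < Y → S P Q O * x ≈ X₀ P Q O → S P Q O * S P Q O * Y ≈ 3# * W P Q O →
                           AttractorEquations x Y

    isCentral-resp : ∀ {P Q O P′ Q′ O′} → S P Q O ≈ S P′ Q′ O′ → W P Q O ≈ W P′ Q′ O′ →
      X₀ P Q O ≈ X₀ P′ Q′ O′ → Y₀ P Q O ≈ Y₀ P′ Q′ O′ → IsCentral P Q O → IsCentral P′ Q′ O′
    isCentral-resp S≈ W≈ X≈ Y≈ central = record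
      { Y₀≈0             = trans (sym Y≈) Y₀≈0
      ; equations⇒centre = λ 0<Y eqs → let Sx≈ , S²Y≈ = equations⇒centre 0<Y eqs in
          trans (*-congʳ (sym S≈)) (trans Sx≈ X≈) ,
          trans (*-congʳ (sym (*-cong S≈ S≈))) (trans S²Y≈ (*-congˡ W≈))
      ; centre⇒equations = λ 0<Y Sx≈ S²Y≈ → centre⇒equations 0<Y
          (trans (*-congʳ S≈) (trans Sx≈ (sym X≈)))
          (trans (*-congʳ (*-cong S≈ S≈)) (trans S²Y≈ (*-congˡ (sym W≈))))
      }
      where open IsCentral central

    private
      cyclic : ∀ x y z → x + y + z ≈ y + z + x
      cyclic x y z = (solve 3 (λ x y z → x :+ y :+ z := y :+ z :+ x) x y z)

    S-rotate : ∀ P Q O → S P Q O ≈ S Q O P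
    S-rotate P Q O = cyclic _ _ _

    isCentral-rotate : ∀ {P Q O} → IsCentral P Q O → IsCentral Q O P
    isCentral-rotate {P} {Q} {O} = isCentral-resp (S-rotate P Q O)
      (solve 3 (λ x y z → x :* y :* z := y :* z :* x) (weight Q O) (weight O P) (weight P Q)) (cyclic _ _ _) (cyclic _ _ _)

    real-weight : ∀ P Q → IsReal P → IsReal Q → weight P Q ≈ re (minor P Q) * re (minor P Q)
    real-weight P Q P-real Q-real =
      (linear 6 (λ x1 s2 x2 s1 y1 y2 →
        (x1 :* s2 :- x2 :* s1) :* (x1 :* s2 :- x2 :* s1) :+ (y1 :* s2 :- y2 :* s1) :* (y1 :* s2 :- y2 :* s1) :=
           (x1 :* s2 :- x2 :* s1) :* (x1 :* s2 :- x2 :* s1)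
        from (y1 :* s2 :- y2 :* s1) :* s2 ⊛ y1 := # 0
        ⊕ :- (y1 :* s2 :- y2 :* s1) :* s1 ⊛ y2 := # 0)
        (re (X P)) (s Q) (re (X Q)) (s P) (im (X P)) (im (X Q)) (P-real , Q-real))

    all-real-central : ∀ {P Q O} → Factorization a b c d P Q O → IsReal P → IsReal Q → IsReal O →
                       0# < S P Q O → IsCentral P Q O
    all-real-central {P} {Q} {O} f P-real Q-real O-real 0<S = record
      { Y₀≈0             =
        (linear 9 (λ u s1 y1 v s2 y2 w s3 y3 →
          u :* (s1 :* y1) :+ v :* (s2 :* y2) :+ w :* (s3 :* y3) := # 0
          from u :* s1 ⊛ y1 := # 0
          ⊕ v :* s2 ⊛ y2 := # 0
          ⊕ w :* s3 ⊛ y3 := # 0)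
          (weight Q O) (s P) (im (X P)) (weight O P) (s Q) (im (X Q)) (weight P Q) (s O) (im (X O)) (P-real , Q-real
            , O-real))
      ; equations⇒centre = λ 0<Y eqs →
          let Sx≈ , S²Y≈ = 𝓕.equations⇒centre κ≉0 0<Y (equations-cong a≈ b≈ c≈′ d≈′ eqs) in
          trans (*-congʳ S≈) (trans Sx≈ (sym X≈)) , trans (*-congʳ (*-cong S≈ S≈)) (trans S²Y≈ (*-congˡ (sym W≈)))
      ; centre⇒equations = λ _ Sx≈ S²Y≈ → equations-cong (sym a≈) (sym b≈) (sym c≈′) (sym d≈′)
          (𝓕.centre⇒equations κ≉0 (0<-resp S≈ 0<S)
            (trans (*-congʳ (sym S≈)) (trans Sx≈ X≈)) (trans (*-congʳ (sym (*-cong S≈ S≈))) (trans S²Y≈ (*-congˡ W≈))))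
      }
      where
      open Factorization f
      module 𝓕 = RealFactors R κ (re (X P)) (re (X Q)) (re (X O)) (s P) (s Q) (s O)
      c≈′ : c ≈ 𝓕.c
      c≈′ = trans c≈
        (linear 10 (λ κ x1 x2 y1 y2 s3 x3 y3 s1 s2 →
          κ :* ((x1 :* x2 :- y1 :* y2) :* s3 :+ (x2 :* x3 :- y2 :* y3) :* s1 :+ (x3 :* x1 :- y3 :* y1) :* s2) :=
             κ :* (x1 :* x2 :* s3 :+ x2 :* x3 :* s1 :+ x3 :* x1 :* s2)
          from :- (κ :* (y2 :* s3 :+ y3 :* s2)) ⊛ y1 := # 0
          ⊕ :- (κ :* (y3 :* s1)) ⊛ y2 := # 0)
          κ (re (X P)) (re (X Q)) (im (X P)) (im (X Q)) (s O) (re (X O)) (im (X O)) (s P) (s Q) (P-real , Q-real))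
      d≈′ : d ≈ 𝓕.d
      d≈′ = trans d≈
        (linear 7 (λ κ x1 x2 y1 y2 x3 y3 →
          :- (κ :* ((x1 :* x2 :- y1 :* y2) :* x3 :- (x1 :* y2 :+ y1 :* x2) :* y3)) := :- (κ :* (x1 :* x2 :* x3))
          from κ :* (y2 :* x3 :+ x2 :* y3) ⊛ y1 := # 0
          ⊕ κ :* (x1 :* y3) ⊛ y2 := # 0)
          κ (re (X P)) (re (X Q)) (im (X P)) (im (X Q)) (re (X O)) (im (X O)) (P-real , Q-real))
      w₁≈ = real-weight Q O Q-real O-real
      w₂≈ = real-weight O P O-real P-real
      w₃≈ = real-weight P Q P-real Q-real
      S≈ : S P Q O ≈ 𝓕.S
      S≈ = +-cong (+-cong (*-congʳ w₁≈) (*-congʳ w₂≈)) (*-congʳ w₃≈)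
      W≈ : W P Q O ≈ 𝓕.W
      W≈ = *-cong (*-cong w₁≈ w₂≈) w₃≈
      X≈ : X₀ P Q O ≈ 𝓕.X₀
      X≈ = +-cong (+-cong (*-congʳ w₁≈) (*-congʳ w₂≈)) (*-congʳ w₃≈)

    -- Conjugate roots are equally far from the real one, so their weights agree. Hence S and X₀ are
    -- twice the quantities `𝓕.T` and `X′`, and the two nonreal contributions to Y₀ cancel.
    one-real-central : ∀ {P Q O} → Factorization a b c d P Q O → IsReal P → AreConjugate Q O →
                       0# < S P Q O → IsCentral P Q O
    one-real-central {P} f P-real (conjugate {p} {q} {p′} {q′} q≉0 p′≈p q′≈-q) 0<S = record
      { Y₀≈0             =
        (linear 8 (λ u s1 η v q w q′ z →
          u :* (s1 :* η) :+ v :* (# 1 :* q) :+ w :* (# 1 :* q′) := # 0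
          from u :* s1 ⊛ η := # 0
          ⊕ w ⊛ q′ := :- q
          ⊕ q ⊛ v := z
          ⊕ :- q ⊛ w := z)
          (weight [ p +i q ] [ p′ +i q′ ]) (s P) (im (X P)) (weight [ p′ +i q′ ] P) q (weight P [ p +i q ]) q′ 𝓕.w
            (P-real , q′≈-q , w₂≈ , w₃≈))
      ; equations⇒centre = λ {x} {Y} 0<Y eqs →
          let Tx≈ , T²Y≈ = 𝓕.equations⇒centre κ≉0 q≉0 0<T x Y 0<Y (equations-cong a≈′ b≈′ c≈′ d≈′ eqs) in
          trans (*-congʳ S≈) (trans
            (linear 3 (λ T x X0 →
              # 2 :* T :* x := # 2 :* X0
              from # 2 ⊛ T :* x := X0) 𝓕.T x X′ Tx≈) (sym X≈)) ,
          trans (*-congʳ (*-cong S≈ S≈)) (trans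
            (linear 4 (λ T Y q w →
              # 2 :* T :* (# 2 :* T) :* Y := # 3 :* (# 4 :* (q :* q) :* w :* w)
              from # 4 ⊛ T :* T :* Y := # 3 :* (q :* q) :* (w :* w)) 𝓕.T Y q 𝓕.w T²Y≈) (*-congˡ (sym W≈)))
      ; centre⇒equations = λ {x} {Y} 0<Y Sx≈ S²Y≈ → equations-cong (sym a≈′) (sym b≈′) (sym c≈′) (sym d≈′)
          (𝓕.centre⇒equations κ≉0 q≉0 0<T x Y 0<Y
            (*-cancelˡ (<⇒≉ (0<ι 1)) (trans (trans (sym (*-assoc 2# 𝓕.T x)) (*-congʳ (sym S≈))) (trans Sx≈ X≈)))
            (*-cancelˡ (<⇒≉ (0<ι 3)) (trans (trans
              (solve 2 (λ T Y →
                # 4 :* (T :* T :* Y) := # 2 :* T :* (# 2 :* T) :* Y) 𝓕.T Y)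
                (*-congʳ (sym (*-cong S≈ S≈)))) (trans S²Y≈ (trans (*-congˡ W≈)
                (solve 2 (λ q w → # 3 :* (# 4 :* (q :* q) :* w :* w) := # 4 :* (# 3 :* (q :* q) :* (w :* w))) q 𝓕.w))))))
      }
      where
      open Factorization f
      module 𝓕 = ComplexFactors R κ (s P) (re (X P)) p q
      X′ : ℝ
      X′ = 2# * (q * q) * s P * re (X P) + 𝓕.w * p
      a≈′ : a ≈ 𝓕.a
      a≈′ = trans a≈ (solve 2 (λ κ s1 → κ :* (s1 :* # 1 :* # 1) := κ :* s1) κ (s P))
      b≈′ : b ≈ 𝓕.b
      b≈′ = trans b≈
        (linear 5 (λ κ ρ p s1 p′ →
          :- (κ :* (ρ :* (# 1 :* # 1) :+ p :* (# 1 :* s1) :+ p′ :* (s1 :* # 1))) := :- (κ :* (ρ :+ # 2 :* p :* s1))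
          from :- (κ :* s1) ⊛ p′ := p) κ (re (X P)) p (s P) p′ p′≈p)
      c≈′ : c ≈ 𝓕.c
      c≈′ = trans c≈
        (linear 8 (λ κ ρ p η q p′ q′ s1 →
          κ :* ((ρ :* p :- η :* q) :* # 1 :+ (p :* p′ :- q :* q′) :* s1 :+ (p′ :* ρ :- q′ :* η) :* # 1) :=
             κ :* (# 2 :* p :* ρ :+ s1 :* (p :* p :+ q :* q))
          from κ :* (p :* s1 :+ ρ) ⊛ p′ := p
          ⊕ :- (κ :* (q :* s1 :+ η)) ⊛ q′ := :- q) κ (re (X P)) p (im (X P)) q p′ q′ (s P) (p′≈p , q′≈-q))
      d≈′ : d ≈ 𝓕.d
      d≈′ = trans d≈
        (linear 7 (λ κ ρ p η q p′ q′ →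
          :- (κ :* ((ρ :* p :- η :* q) :* p′ :- (ρ :* q :+ η :* p) :* q′)) := :- (κ :* (ρ :* (p :* p :+ q :* q)))
          from :- (κ :* (ρ :* p :- η :* q)) ⊛ p′ := p
          ⊕ κ :* (ρ :* q :+ η :* p) ⊛ q′ := :- q) κ (re (X P)) p (im (X P)) q p′ q′ (p′≈p , q′≈-q))
      w₁≈ : weight [ p +i q ] [ p′ +i q′ ] ≈ 4# * (q * q)
      w₁≈ =
        (linear 4 (λ p p′ q q′ →
          (p :* # 1 :- p′ :* # 1) :* (p :* # 1 :- p′ :* # 1) :+ (q :* # 1 :- q′ :* # 1) :* (q :* # 1 :- q′ :* # 1)
             :=
             # 4 :* (q :* q)
          from p′ :- p ⊛ p′ := p
          ⊕ q′ :- # 3 :* q ⊛ q′ := :- q) p p′ q q′ (p′≈p , q′≈-q))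
      w₂≈ : weight [ p′ +i q′ ] P ≈ 𝓕.w
      w₂≈ =
        (linear 7 (λ p′ s1 ρ q′ η p q →
          (p′ :* s1 :- ρ :* # 1) :* (p′ :* s1 :- ρ :* # 1) :+ (q′ :* s1 :- η :* # 1) :* (q′ :* s1 :- η :* # 1) :=
             (ρ :- s1 :* p) :* (ρ :- s1 :* p) :+ q :* q :* (s1 :* s1)
          from s1 :* (s1 :* p′ :- # 2 :* ρ :+ s1 :* p) ⊛ p′ := p
          ⊕ s1 :* s1 :* (q′ :- q) ⊛ q′ := :- q
          ⊕ η :- # 2 :* q′ :* s1 ⊛ η := # 0) p′ (s P) (re (X P)) q′ (im (X P)) p q (p′≈p , q′≈-q , P-real))
      w₃≈ : weight P [ p +i q ] ≈ 𝓕.w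
      w₃≈ =
        (linear 5 (λ ρ p s1 η q →
          (ρ :* # 1 :- p :* s1) :* (ρ :* # 1 :- p :* s1) :+ (η :* # 1 :- q :* s1) :* (η :* # 1 :- q :* s1) :=
             (ρ :- s1 :* p) :* (ρ :- s1 :* p) :+ q :* q :* (s1 :* s1)
          from η :- # 2 :* q :* s1 ⊛ η := # 0) (re (X P)) p (s P) (im (X P)) q P-real)
      S≈ : S P [ p +i q ] [ p′ +i q′ ] ≈ 2# * 𝓕.T
      S≈ = trans (+-cong (+-cong (*-congʳ w₁≈) (*-congʳ w₂≈)) (*-congʳ w₃≈))
        (solve 3 (λ q s1 w →
          # 4 :* (q :* q) :* (s1 :* s1) :+ w :* (# 1 :* # 1) :+ w :* (# 1 :* # 1) :=
             # 2 :* (# 2 :* (q :* q) :* (s1 :* s1) :+ w)) q (s P) 𝓕.w)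
      W≈ : W P [ p +i q ] [ p′ +i q′ ] ≈ 4# * (q * q) * 𝓕.w * 𝓕.w
      W≈ = *-cong (*-cong w₁≈ w₂≈) w₃≈
      X≈ : X₀ P [ p +i q ] [ p′ +i q′ ] ≈ 2# * X′
      X≈ = trans (+-cong (+-cong (*-congʳ w₁≈) (*-congʳ w₂≈)) (*-congʳ w₃≈))
        (linear 6 (λ q s1 ρ w p p′ →
          # 4 :* (q :* q) :* (s1 :* ρ) :+ w :* (# 1 :* p) :+ w :* (# 1 :* p′) :=
             # 2 :* (# 2 :* (q :* q) :* s1 :* ρ :+ w :* p)
          from w ⊛ p′ := p) q (s P) (re (X P)) 𝓕.w p p′ p′≈p)
      0<T : 0# < 𝓕.T
      0<T = 0<x*y⇒0<y (0<ι 1) (0<-resp S≈ 0<S)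

    factorization⇒central : ∀ {P Q O} → Factorization a b c d P Q O → 0# < S P Q O → IsCentral P Q O
    factorization⇒central = RootPattern.goal (λ P Q O → 0# < S P Q O → IsCentral P Q O)
      (λ {P} {Q} {O} central 0<S → isCentral-rotate (central (0<-resp (sym (S-rotate P Q O)) 0<S)))
      all-real-central one-real-central

-- Existence and uniqueness of the attractor point at the centre of mass

module AttractorIsCentreOfMass (R : CompleteOrderedField) (L : NaturalLogarithm R) where
  open CompleteOrderedField R hiding (ring)
  open RealAnalysis R
  open T³Model R L
  open OrderedField R
  open WeightedConfigurations R
  open Factorizations R
  open Centrality R

  -- An ordered field has characteristic zero, so the numerator of q must vanish.
  fromℚ≈0⇒≡0 : ∀ q → fromℚ q ≈ 0# → q ≡ 0ℚ
  fromℚ≈0⇒≡0 q@(mkℚ n d-1 _) q≈0 = ℚₚ.↥p≡0⇒p≡0 q (numerator n (x*y≈0⇒y≈0 (<⇒≉ (0<x⁻¹ (0<multiple d-1))) (trans (*-comm _ _) q≈0)))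
    where
    0<multiple : ∀ n → 0# < fromℤ (+ suc n)
    0<multiple zero    = 0<-resp (sym (+-identityʳ 1#)) 0<1
    0<multiple (suc n) = 0<x+y 0<1 (<⇒≤ (0<multiple n))
    numerator : ∀ n → fromℤ n ≈ 0# → n ≡ + 0
    numerator (+ zero)  _    = ≡.refl
    numerator (+ suc n) n≈0  = ⊥-elim (<⇒≉ (0<multiple n) n≈0)
    numerator -[1+ n ]  -n≈0 = ⊥-elim (<⇒≉ (0<multiple n)
      (linear 1 (λ x →
        x := # 0
        from :- # 1 ⊛ :- x := # 0) (fromℤ (+ suc n)) -n≈0))

  -- At most one of P and Q is ∞; the other has s = 1 and contributes its positive weight.
  0<S : ∀ {P Q O} → 0# < weight Q O → 0# < weight O P → 0# < weight P Q → ¬ (P ≈ᴾ Q) → 0# < S P Q O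
  0<S {[ z ]} {Q}     {O} 0<w₁ 0<w₂ 0<w₃ _   = 0<x+y (0<x+y
    (*-pos 0<w₁ (*-pos 0<1 0<1)) (0≤x*y (<⇒≤ 0<w₂) (0≤x² (s Q)))) (0≤x*y (<⇒≤ 0<w₃) (0≤x² (s O)))
  0<S {∞}     {[ z ]} {O} 0<w₁ 0<w₂ 0<w₃ _   = 0<x+y (0<-resp (+-comm _ _)
    (0<x+y (*-pos 0<w₂ (*-pos 0<1 0<1)) (0≤x*y (<⇒≤ 0<w₁) (0≤x² 0#)))) (0≤x*y (<⇒≤ 0<w₃) (0≤x² (s O)))
  0<S {∞}     {∞}     {O} 0<w₁ 0<w₂ 0<w₃ P≉Q = ⊥-elim (P≉Q tt)

  module _ (a b c d : ℚ) where
    open EffectivePotential R L a b c d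

    finite-root : ∀ z → IsRoot F [ z ] →
      ((a′ * re z + fromℚ b) * re z + fromℚ c) * re z + fromℚ d + - (im z * im z * (3# * a′ * re z + fromℚ b)) ≈ 0# ×
      im z * ((3# * a′ * re z + 2# * fromℚ b) * re z + fromℚ c + - (im z * im z * a′)) ≈ 0#
    finite-root z (re≈0 , im≈0) = trans (proj₁ (Z-on-ℂ z)) re≈0 , trans (proj₂ (Z-on-ℂ z)) im≈0

    infinite-root : IsRoot F ∞ → a′ ≈ 0#
    infinite-root (re≈0 , _) = trans
      (solve 4 (λ a b c d →
        let p = # 1 :* # 1 :- # 0 :* # 0
            q = # 1 :* # 0 :+ # 0 :* # 1
            u = # 1 :* # 0 :- # 0 :* # 0
            v = # 1 :* # 0 :+ # 0 :* # 0
            z = # 0 :* # 0 :- # 0 :* # 0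
            w = # 0 :* # 0 :+ # 0 :* # 0
        in a :=
           (a :* (p :* # 1 :- q :* # 0) :- # 0 :* (p :* # 0 :+ q :* # 1)) :+ (b :* (p :* # 0 :- q :* # 0) :- # 0 :*
           (p :* # 0 :+ q :* # 0)) :+ (c :* (u :* # 0 :- v :* # 0) :- # 0 :* (u :* # 0 :+ v :* # 0)) :+ (d :* (z :*
           # 0 :- w :* # 0) :- # 0 :* (z :* # 0 :+ w :* # 0))) (fromℚ a) (fromℚ b) (fromℚ c) (fromℚ d)) re≈0

    module _ (disc≢0 : discriminant F ≢ 0ℚ) where

      nonzero : ¬ (a′ ≈ 0# × fromℚ b ≈ 0# × fromℚ c ≈ 0# × fromℚ d ≈ 0#)
      nonzero (a≈0 , b≈0 , c≈0 , d≈0) = disc≢0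
        (zero-form (fromℚ≈0⇒≡0 a a≈0) (fromℚ≈0⇒≡0 b b≈0) (fromℚ≈0⇒≡0 c c≈0) (fromℚ≈0⇒≡0 d d≈0))
        where
        zero-form : ∀ {a b c d} → a ≡ 0ℚ → b ≡ 0ℚ → c ≡ 0ℚ → d ≡ 0ℚ → discriminant (cubic a b c d) ≡ 0ℚ
        -- The discriminant of the zero form computes to `0ℚ`.
        zero-form ≡.refl ≡.refl ≡.refl ≡.refl = ≡.refl

      factorization : ∀ {α β γ} → AreTheRoots F α β γ → Factorization a′ (fromℚ b) (fromℚ c) (fromℚ d) α β γ
      factorization {α} {β} {γ} roots = cases α β γ root-α root-β root-γ α≉β β≉γ α≉γ
        where
        open AreTheRoots roots
        cases : ∀ α β γ → IsRoot F α → IsRoot F β → IsRoot F γ → ¬ (α ≈ᴾ β) → ¬ (β ≈ᴾ γ) → ¬ (α ≈ᴾ γ) →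
                Factorization a′ (fromℚ b) (fromℚ c) (fromℚ d) α β γ
        cases [ x ] [ y ] [ z ] x-root y-root z-root x≉y y≉z x≉z =
          finite-factorization nonzero x y z (finite-root x x-root) (finite-root y y-root) (finite-root z z-root) x≉y y≉z x≉z
        cases ∞ [ y ] [ z ] ∞-root y-root z-root _ y≉z _ =
          infinite-factorization nonzero y z (infinite-root ∞-root) (finite-root y y-root) (finite-root z z-root) y≉z
        -- Rotations bring ∞ to the front, so one factorization with an infinite root suffices.
        cases [ x ] ∞ [ z ] x-root ∞-root z-root _ _ x≉z =
          rotate (rotate (infinite-factorization nonzero z x (infinite-root ∞-root) (finite-root z z-root) (finite-root x x-root)
            λ z≈x → x≉z (≈ᴾ-sym {[ z ]} {[ x ]} z≈x)))
        cases [ x ] [ y ] ∞ x-root y-root ∞-root x≉y _ _ =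
          rotate (infinite-factorization nonzero x y (infinite-root ∞-root) (finite-root x x-root) (finite-root y y-root) x≉y)
        cases ∞ ∞ _ _ _ _ ∞≉∞ _ _ = ⊥-elim (∞≉∞ tt)
        cases ∞ [ _ ] ∞ _ _ _ _ _ ∞≉∞ = ⊥-elim (∞≉∞ tt)
        cases [ _ ] ∞ ∞ _ _ _ _ ∞≉∞ _ = ⊥-elim (∞≉∞ tt)

      attractor-is-centre-of-mass : ∀ {α β γ} → AreTheRoots F α β γ →
        ∃[ τ ] (IsTheAttractorPoint F τ × IsCenterOfMass α β γ (embed τ))
      attractor-is-centre-of-mass {α} {β} {γ} roots =
        centre (quotient (X₀ α β γ) 0<𝒮) (quotient (3# * W α β γ) (*-pos 0<𝒮 0<𝒮))
        where
        open AreTheRoots roots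
        0<w₁ = 0<weight β γ β≉γ
        0<w₂ = 0<weight γ α (λ γ≈α → α≉γ (≈ᴾ-sym {γ} {α} γ≈α))
        0<w₃ = 0<weight α β α≉β
        0<𝒮 : 0# < S α β γ
        0<𝒮 = 0<S {α} {β} {γ} 0<w₁ 0<w₂ 0<w₃ α≉β
        open IsCentral (factorization⇒central a′ (fromℚ b) (fromℚ c) (fromℚ d) (factorization roots) 0<𝒮)

        centre : ∃[ x ] S α β γ * x ≈ X₀ α β γ → ∃[ Y ] S α β γ * S α β γ * Y ≈ 3# * W α β γ →
                 ∃[ τ ] (IsTheAttractorPoint F τ × IsCenterOfMass α β γ (embed τ))
        centre (x , Sx≈) (Y , S²Y≈) = at (square-root (0<x*y⇒0<y (*-pos 0<𝒮 0<𝒮)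
            (0<-resp (sym S²Y≈) (*-pos (0<ι 2) (*-pos (*-pos 0<w₁ 0<w₂) 0<w₃)))))
          where
          at : ∃[ y ] (0# < y × y * y ≈ Y) → ∃[ τ ] (IsTheAttractorPoint F τ × IsCenterOfMass α β γ (embed τ))
          at (y , 0<y , y²≈Y) = mkℍ (x +i y) 0<y ,
            (equations⇒attractor (mkℍ (x +i y) 0<y) (centre⇒equations (*-pos 0<y 0<y) Sx≈ S²y²≈) , unique) ,
            CentreOfMass.isCentreOfMass R L α β γ 0<w₁ 0<w₂ 0<w₃ 0<𝒮 (embed (mkℍ (x +i y) 0<y)) Sx≈
              -- `embed` gives t the imaginary part 0, so the condition S · 0 = Y₀ is `Y₀≈0`.
              (trans (zeroʳ _) (sym Y₀≈0)) S²y²≈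
            where
            S²y²≈ : S α β γ * S α β γ * (y * y) ≈ 3# * W α β γ
            S²y²≈ = trans (*-congˡ y²≈Y) S²Y≈
            unique : ∀ σ → IsAttractorPoint F σ → σ ≈ᴴ mkℍ (x +i y) 0<y
            unique σ σ-attractor =
              let Sx′≈ , S²y′²≈ = equations⇒centre (*-pos (0<im σ) (0<im σ)) (attractor⇒equations σ σ-attractor) in
              *-cancelˡ (<⇒≉ 0<𝒮) (trans Sx′≈ (sym Sx≈)) ,
              square-injective (0<im σ) 0<y (*-cancelˡ (<⇒≉ (*-pos 0<𝒮 0<𝒮)) (trans S²y′²≈ (sym S²y²≈)))

theorem1p0p10 : (R : CompleteOrderedField) (L : NaturalLogarithm R) →
    let open RealAnalysis R
        open T³Model R L
    in (F : CubicForm ℚ) → discriminant F ≢ 0ℚ →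
       (α β γ : ℙ¹) → AreTheRoots F α β γ →
       ∃[ τ ] (IsTheAttractorPoint F τ × IsCenterOfMass α β γ (embed τ))
theorem1p0p10 R L (cubic a b c d) disc≢0 α β γ roots =
  AttractorIsCentreOfMass.attractor-is-centre-of-mass R L a b c d disc≢0 roots
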